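{- Let $\widehat{G}$ be a ribbon graph with a 2-decomposition $\left(G,\{H_e\}_{e\in E}\right)$, such that each $H_e$ is embedded in a neighbourhood of the ribbon $e$ of $G$. Let $A_e$ be $H_e$ with an additional ribbon $e$ joining $u_e$ and $w_e$. Then \[ Z(\widehat{G};a,b,c)=(ac)^{ -e(G)}\Big(\prod_{e\in E}g_e\Big)\,Z\big(G;a,\{f_e/g_e\}_{e\in E},c\big), \] where $f_e,g_e$ are the solutions of \[ acg_e+f_e=Z(H_e;a,b,c),\qquad g_e+cf_e=Z(A_e/e;a,b,c). \]
   Context: A ribbon graph is an orientable surface with boundary made of closed discs (vertices) and ribbons $I\times I$ (edges) attached along disjoint segments $\{0,1\}\times I$, each ribbon meeting discs in exactly two such segments; equivalently (once oriented) a graph with a cyclic order of half-edges at each vertex. A state of a ribbon graph $F=(V,E)$ is a spanning ribbon subgraph $(V,E')$; $k(s)$, $e(s)$, $\partial(s)$ are its numbers of connected components, edges and boundary components. $Z(F;a,\{x_e\},c)=\sum_{s}a^{k(s)}\big(\prod_{e\in s}x_e\big)c^{\partial(s)}$; $Z(F;a,b,c)$ sets all $x_e=b$. $A_e/e$: contraction of the non-loop ribbon $e$, i.e. its two end discs together with $e$ are replaced by a single disc. 2-sum of ribbon graphs: choose orientations, identify the distinguished edges (endpoints identified in a chosen way), delete the edge, and merge cyclic orders at the identified vertices ($(e,e_1,\dots,e_n)$ and $(f,f_1,\dots,f_m)$ become $(e_1,\dots,e_n,f_1,\dots,f_m)$; if $e$ is a loop with order $(e,e_1,\dots,e_k,e,e_{k+1},\dots,e_n)$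 and $f=(u_f,w_f)$ has orders $(f,f^1_1,\dots,f^1_m)$, $(f,f^2_1,\dots,f^2_l)$, the result is $(e_1,\dots,e_k,f^1_1,\dots,f^1_m,e_{k+1},\dots,e_n,f^2_1,\dots,f^2_l)$). 2-decomposition $(G,\{H_e\}_{e\in E})$ of $\widehat{G}$: $G=(V,E)$ ribbon graph, $A_e$ ribbon graphs with distinguished non-loop edge $e$ joining distinct vertices $u_e,w_e$, $\widehat{G}$ obtained by 2-summing $G$ with every $A_e$ along $e$, $H_e=A_e\setminus e$. "Embedded in a neighbourhood of $e$" means the part of $\widehat{G}$ coming from $H_e$ lies within a neighbourhood of the ribbon $e$ (so $A_e$, $H_e$ are planar). $e(G)$ is the number of edges of $G$. -}

module Defs where

open import Level using (Level)
open import Data.Nat using (ℕ; zero; suc) renaming (_+_ to _+ℕ_; _*_ to _*ℕ_)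
open import Data.Bool using (Bool; true; false; not; _∧_; _∨_; if_then_else_; T)
open import Data.Fin using (Fin; zero; suc; punchIn; punchOut; _≟_)
open import Data.Product using (Σ; _×_; _,_; proj₁; proj₂)
open import Data.Sum using (_⊎_; inj₁; inj₂)
open import Data.List using (List; []; _∷_; _++_; map; concatMap; filter; filterᵇ; allFin; upTo; drop; take; foldr)
open import Data.Bool.ListAction using (any)
open import Data.List.Relation.Binary.Permutation.Propositional using (_↭_)
open import Relation.Nullary using (Dec; yes; no; ¬_)
open import Relation.Nullary.Decidable using (⌊_⌋; False; fromWitnessFalse)
open import Relation.Binary.PropositionalEquality using (_≡_; _≢_)
open import Function.Bundles using (_↔_; Inverse)
open import Algebra.Bundles using (CommutativeRing)

-- Ribbon graphs (oriented), as rotation systems.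
-- Vertices are Fin nV, edges Fin nE; the half-edge (e , b) is the end b of
-- the ribbon e (b = false / true are the two ends).  'end e b' is the disc
-- to which end b of e is attached, and 'rot v' lists the half-edges at the
-- disc v in their cyclic order (the list is read up to cyclic rotation).

HE : ℕ → Set
HE n = Fin n × Bool

record RG (nV nE : ℕ) : Set where
  field
    end : Fin nE → Bool → Fin nV
    rot : Fin nV → List (HE nE)
open RG public

allHE : (n : ℕ) → List (HE n)
allHE n = concatMap (λ e → (e , false) ∷ (e , true) ∷ []) (allFin n)

WellFormed : ∀ {nV nE} → RG nV nE → Set
WellFormed {nV} {nE} F =
  ∀ v → rot F v ↭ filter (λ h → end F (proj₁ h) (proj₂ h) ≟ v) (allHE nE)

eqFin : ∀ {n} → Fin n → Fin n → Bool
eqFin i j = ⌊ i ≟ j ⌋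

eqBool : Bool → Bool → Bool
eqBool true true = true
eqBool false false = true
eqBool _ _ = false

eqHE : ∀ {n} → HE n → HE n → Bool
eqHE (e , b) (e' , b') = eqFin e e' ∧ eqBool b b'

countNew : {A : Set} → (A → A → Bool) → List A → List A → ℕ
countNew R prev [] = 0
countNew R prev (x ∷ xs) =
  (if any (λ y → R y x) prev then 0 else 1) +ℕ countNew R (x ∷ prev) xs

countClasses : {A : Set} → (A → A → Bool) → List A → ℕ
countClasses R xs = countNew R [] xs

iter : {A : Set} → (A → A) → ℕ → A → A
iter f zero x = x
iter f (suc t) x = f (iter f t x)

-- the element following h in the cyclic list L (h itself if absent)
succCycAux : ∀ {n} → HE n → HE n → List (HE n) → HE n
succCycAux first h [] = h
succCycAux first h (x ∷ []) = if eqHE x h then first else h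
succCycAux first h (x ∷ y ∷ xs) = if eqHE x h then y else succCycAux first h (y ∷ xs)

succCyc : ∀ {n} → List (HE n) → HE n → HE n
succCyc [] h = h
succCyc (x ∷ xs) h = succCycAux x h (x ∷ xs)

afterAux : ∀ {n} → HE n → List (HE n) → List (HE n) → List (HE n)
afterAux h pre [] = pre
afterAux h pre (x ∷ xs) = if eqHE x h then xs ++ pre else afterAux h (pre ++ (x ∷ [])) xs

after : ∀ {n} → HE n → List (HE n) → List (HE n)
after h L = afterAux h [] L

-- States (spanning ribbon subgraphs) and their invariants

State : ℕ → Set
State n = Fin n → Bool

cons : ∀ {n} → Bool → State n → State (suc n)
cons b s zero = b
cons b s (suc i) = s i

allStates : (n : ℕ) → List (State n)
allStates zero = (λ ()) ∷ []
allStates (suc n) = concatMap (λ s → cons false s ∷ cons true s ∷ []) (allStates n)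

module _ {nV nE : ℕ} (F : RG nV nE) (s : State nE) where

  adj : Fin nV → Fin nV → Bool
  adj u w = any (λ e → s e ∧ ((eqFin (end F e false) u ∧ eqFin (end F e true) w)
                              ∨ (eqFin (end F e true) u ∧ eqFin (end F e false) w)))
                (allFin nE)

  reachIn : ℕ → Fin nV → Fin nV → Bool
  reachIn zero u w = eqFin u w
  reachIn (suc t) u w = reachIn t u w ∨ any (λ x → reachIn t u x ∧ adj x w) (allFin nV)

  reach : Fin nV → Fin nV → Bool
  reach = reachIn nV

  kSt : ℕ
  kSt = countClasses reach (allFin nV)

  eSt : ℕ
  eSt = foldr (λ e n → (if s e then 1 else 0) +ℕ n) 0 (allFin nE)

  inS : HE nE → Bool
  inS h = s (proj₁ h)

  darts : List (HE nE)
  darts = filterᵇ inS (allHE nE)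

  rotS : Fin nV → List (HE nE)
  rotS v = filterᵇ inS (rot F v)

  -- boundary walk: cross the ribbon, then turn to the next half-edge
  face : HE nE → HE nE
  face (e , b) = succCyc (rotS (end F e (not b))) (e , not b)

  sameFace : HE nE → HE nE → Bool
  sameFace h h' = any (λ t → eqHE (iter face t h) h') (upTo (suc (2 *ℕ nE)))

  isolated : Fin nV → Bool
  isolated v = not (any inS (rot F v))

  -- ∂(s): boundary components = face cycles + isolated discs
  bdSt : ℕ
  bdSt = countClasses sameFace darts
         +ℕ foldr (λ v n → (if isolated v then 1 else 0) +ℕ n) 0 (allFin nV)

allTrue : ∀ {n} → State n
allTrue _ = true

-- genus zero (every component is a sphere with holes): v - e + ∂ = 2k
Planar : ∀ {nV nE} → RG nV nE → Set
Planar {nV} {nE} F = nV +ℕ bdSt F allTrue ≡ 2 *ℕ kSt F allTrue +ℕ nE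

module _ {c ℓ : Level} (R : CommutativeRing c ℓ) where
  open CommutativeRing R

  pow : Carrier → ℕ → Carrier
  pow x zero = 1#
  pow x (suc n) = x * pow x n

  prodFin : ∀ {n} → (Fin n → Carrier) → Carrier
  prodFin {n} g = foldr (λ e r → g e * r) 1# (allFin n)

  sumL : {A : Set} → (A → Carrier) → List A → Carrier
  sumL g xs = foldr (λ x r → g x + r) 0# xs

  Zx : ∀ {nV nE} → RG nV nE → Carrier → (Fin nE → Carrier) → Carrier → Carrier
  Zx {nV} {nE} F a x cc =
    sumL (λ s → pow a (kSt F s) * (prodFin (λ e → if s e then x e else 1#) * pow cc (bdSt F s)))
         (allStates nE)

  Z : ∀ {nV nE} → RG nV nE → Carrier → Carrier → Carrier → Carrier
  Z F a b cc = Zx F a (λ _ → b) cc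

dropEdge : ∀ {n} → Fin (suc n) → List (HE (suc n)) → List (HE n)
dropEdge i [] = []
dropEdge i ((j , b) ∷ hs) with i ≟ j
... | yes _ = dropEdge i hs
... | no i≢j = (punchOut i≢j , b) ∷ dropEdge i hs

deleteEdge : ∀ {nV nE} → RG nV (suc nE) → Fin (suc nE) → RG nV nE
deleteEdge F i = record
  { end = λ j b → end F (punchIn i j) b
  ; rot = λ v → dropEdge i (rot F v) }

NonLoop : ∀ {nV nE} → RG nV nE → Fin nE → Set
NonLoop F e = end F e false ≢ end F e true

module _ {nV nE : ℕ} (F : RG (suc nV) (suc nE)) (i : Fin (suc nE)) (nl : NonLoop F i) where
  private
    u w : Fin (suc nV)
    u = end F i false
    w = end F i true

    w≢u : w ≢ u
    w≢u p = nl (Relation.Binary.PropositionalEquality.sym p)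

    newV : Fin (suc nV) → Fin nV
    newV x with w ≟ x
    ... | yes _ = punchOut w≢u
    ... | no w≢x = punchOut w≢x

  contract : RG nV nE
  contract = record
    { end = λ j b → newV (end F (punchIn i j) b)
    ; rot = λ v → rotC (punchIn w v) }
    where
      rotC : Fin (suc nV) → List (HE nE)
      rotC x with u ≟ x
      ... | yes _ = dropEdge i (after (i , false) (rot F u) ++ after (i , true) (rot F w))
      ... | no _ = dropEdge i (rot F x)

CycEq : {A : Set} → List A → List A → Set
CycEq L L' = Σ ℕ (λ k → drop k L ++ take k L ≡ L')

-- Data of the ribbon graphs A_e: A e has vertices Fin (suc (pA e)), edges
-- Fin (suc (mA e)) and distinguished edge d e; H_e = A_e \ e.
module TwoSum {nV nE nV̂ nÊ : ℕ} (G : RG nV nE) (Ĝ : RG nV̂ nÊ)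
              (pA mA : Fin nE → ℕ)
              (A : (e : Fin nE) → RG (suc (pA e)) (suc (mA e)))
              (d : (e : Fin nE) → Fin (suc (mA e))) where

  H : (e : Fin nE) → RG (suc (pA e)) (mA e)
  H e = deleteEdge (A e) (d e)

  uA wA : (e : Fin nE) → Fin (suc (pA e))
  uA e = end (A e) (d e) false
  wA e = end (A e) (d e) true

  Inner : (e : Fin nE) → Fin (suc (pA e)) → Set
  Inner e v = False (v ≟ uA e) × False (v ≟ wA e)

  InnerV : Set
  InnerV = Σ (Fin nE) (λ e → Σ (Fin (suc (pA e))) (λ v → Inner e v))

  EdgesH : Set
  EdgesH = Σ (Fin nE) (λ e → Fin (mA e))

  -- Ĝ is the 2-sum of G with every A_e along e (end b of e in G is
  -- identified with end b of d e in A_e), via the given identifications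
  -- of vertices and edges.
  record IsTwoSum (vmap : (Fin nV ⊎ InnerV) ↔ Fin nV̂) (emap : EdgesH ↔ Fin nÊ) : Set where
    ιV : Fin nV → Fin nV̂
    ιV v = Inverse.to vmap (inj₁ v)

    ιE : (e : Fin nE) → HE (mA e) → HE nÊ
    ιE e (f , b) = (Inverse.to emap (e , f) , b)

    -- the block of half-edges of H_e replacing the half-edge (e , b) of G
    block : (e : Fin nE) → Bool → List (HE nÊ)
    block e b = map (ιE e) (dropEdge (d e) (after (d e , b) (rot (A e) (end (A e) (d e) b))))

    field
      rotG : ∀ v → CycEq (rot Ĝ (ιV v)) (concatMap (λ h → block (proj₁ h) (proj₂ h)) (rot G v))
      rotH : ∀ e v (p : Inner e v) →
               CycEq (rot Ĝ (Inverse.to vmap (inj₂ (e , v , p)))) (map (ιE e) (rot (H e) v))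

  TwoDecomposition : Set
  TwoDecomposition =
    Σ ((Fin nV ⊎ InnerV) ↔ Fin nV̂) (λ vmap → Σ (EdgesH ↔ Fin nÊ) (λ emap → IsTwoSum vmap emap))

{-# OPTIONS --safe #-}
-- A state of Ĝ is a family of states t_e of the H_e. Put e in the state s of G
-- exactly when t_e connects u_e to w_e. Then
--   k(Ĝ) + Σ δ_e = k(G, s) + Σ k(H_e, t_e)  and  ∂(Ĝ) + Σ δ_e = ∂(G, s) + Σ ∂(H_e, t_e),
-- where δ_e is 1 if e ∈ s and 2 otherwise. So the weight of a state of Ĝ is a
-- product over e, and summing over the t_e with given s turns each e into f_e / (ac)
-- if e ∈ s and g_e / (ac) if not, where f_e is the sum of the weights of the connecting
-- states of H_e and ac g_e that of the other ones: these solve the given linear system.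
--
-- Boundary components are the orbits of a permutation φ of the corners of the discs,
-- and adding an edge to a state multiplies φ by a transposition. Hence the genus never
-- decreases when edges are added, and in the planar A_e the two sides of the edge e lie
-- on one boundary component of t_e exactly when t_e connects u_e to w_e. So if e is added
-- to t_e in this case, its two sides always lie on different boundary components, and the
-- boundary walk of Ĝ is obtained from those of G and the A_e by splicing along these sides,
-- each splice joining two orbits.
--
-- The same two formulas give Z(H_e) and Z(A_e / e), because H_e and A_e / e are the 2-sums
-- of A_e with a single edge and with a single loop.
module Submission where

open import Defs
open import Level using (Level; 0ℓ)
open import Algebra.Bundles using (CommutativeRing; CommutativeMonoid)
open import Data.Nat using (ℕ; zero; suc; _≤_; _<_; z≤n; s≤s; _∸_) renaming (_+_ to _+ℕ_; _*_ to _*ℕ_)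
open import Data.Nat.Induction using (<-wellFounded)
open import Data.Nat.Properties using (≤-refl; ≤-reflexive; ≤-trans; ≤-antisym; <⇒≤; ≮⇒≥; _<?_; n≤1+n; m<n⇒m<1+n; m≤n⇒m<n∨m≡n; suc-injective; +-suc; +-cancelˡ-≡; +-cancelʳ-≡; +-monoˡ-≤; *-suc; *-cancelˡ-≡; m∸n+n≡m; m+[n∸m]≡n; ∸-monoʳ-<)
import Data.Nat.Properties as ℕ
import Algebra.Properties.CommutativeSemigroup ℕ.+-commutativeSemigroup as +ℕ
open import Data.Bool using (Bool; true; false; not; if_then_else_; T; T?)
open import Data.Bool.ListAction using (any; or)
open import Data.Bool.Properties using (T-∧; T-∨; T-irrelevant; not-involutive) renaming (_≟_ to _≟B_)
open import Data.Empty using (⊥; ⊥-elim)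
open import Data.Fin using (Fin; zero; suc; toℕ; _≟_; combine; join; splitAt; punchIn; punchOut)
open import Data.Fin.Properties using (injective⇒≤; pigeonhole; toℕ≤pred[n]; combine-injective; splitAt-join; join-splitAt; punchIn-injective; punchInᵢ≢i; punchIn-punchOut; punchOut-injective; punchOut-cong; punchOut-punchIn)
open import Data.List using (List; []; _∷_; _++_; map; length; lookup; concatMap; filter; filterᵇ; foldr; tabulate; allFin; upTo; drop; take)
open import Data.List.Properties using (∷-injective; ++-assoc; ++-identityʳ; length-++; length-map; map-++; map-cong; map-id; foldr-cong; concatMap-++; filter-++; filter-accept; filter-reject; filter-none; take++drop≡id)
open import Data.List.Membership.Propositional using (_∈_; _∉_; lose; find)
open import Data.List.Membership.Propositional.Properties using (∈-allFin; ∈-upTo⁺; ∈-lookup; ∈-∃++; ∈-filter⁺; ∈-filter⁻; ∈-++⁺ˡ; ∈-++⁺ʳ; ∈-++⁻; ∈-map⁺; ∈-map⁻; ∈-concatMap⁺)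
open import Data.List.Membership.Propositional.Properties.WithK using (unique∧set⇒bag)
open import Data.List.Relation.Binary.BagAndSetEquality using (∼bag⇒↭)
open import Data.List.Relation.Binary.Permutation.Propositional as Perm using (_↭_; ↭-sym; ↭⇒↭ₛ)
open import Data.List.Relation.Binary.Permutation.Propositional.Properties using (∈-resp-↭; Any-resp-↭; ++-comm)
import Data.List.Relation.Binary.Permutation.Setoid.Properties as Permₛ
open import Data.List.Relation.Unary.All as All using (All; []; _∷_)
import Data.List.Relation.Unary.All.Properties as All
open import Data.List.Relation.Unary.All.Properties using (all-filter)
open import Data.List.Relation.Unary.Any as Any using (Any; here; there)
import Data.List.Relation.Unary.Any.Properties as Any
open import Data.List.Relation.Unary.Any.Properties using (any⁺; any⁻; lookup-index)
open import Data.List.Relation.Unary.AllPairs as AllPairs using (AllPairs; []; _∷_)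
import Data.List.Relation.Unary.AllPairs.Properties as AllPairs
open import Data.List.Relation.Unary.Unique.Propositional using (Unique)
import Data.List.Relation.Unary.Unique.Propositional.Properties as Unique
open import Data.Product using (Σ; ∃; ∃₂; _×_; _,_; proj₁; proj₂)
import Data.Product.Properties as Product
open import Data.Product.Properties.WithK using (,-injectiveʳ)
open import Data.Sum using (_⊎_; inj₁; inj₂) renaming (map to map-⊎)
import Data.Sum.Properties as Sum
open import Data.Unit using (⊤; tt)
open import Data.Vec as Vec using (Vec)
open import Data.Vec.Properties using (lookup∘tabulate; tabulate∘lookup; tabulate-cong)
open import Function using (_∘_; id)
open import Function.Bundles using (_↔_; Inverse; Equivalence; mk⇔; mk↔ₛ′)
open import Induction.WellFounded using (Acc; acc)
open import Relation.Nullary using (Dec; yes; no; ¬_; contradiction)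
open import Relation.Nullary.Decidable using (toWitness; fromWitness; toWitnessFalse; fromWitnessFalse)
open import Relation.Binary using (Rel; IsEquivalence; DecidableEquality)
open import Relation.Binary.PropositionalEquality as ≡ using (_≡_; _≢_; refl; sym; trans; cong; cong₂; subst; subst₂)
import Relation.Binary.Construct.On as On
open import Relation.Binary.Construct.Closure.Equivalence as Eqv using (EqClosure)
open import Relation.Binary.Construct.Closure.ReflexiveTransitive as Star using (Star; _◅_; _◅◅_)
open import Relation.Binary.Construct.Closure.Symmetric using (SymClosure; fwd; bwd)
open Equivalence using (to; from)

-- The numbers in the statement are produced by bounded searches through lists, which makes two
-- graphs hard to compare. Each number is therefore characterised once as the number of classes of a
-- generated equivalence relation. After that an equation between numbers is a map between
-- quotients, because the size of a finite quotient is unique. The permutation `face` acts only on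
-- the half-edges of present ribbons and misses isolated discs. On corners, where absent ribbons are
-- passed by and every disc has a marked corner, all states act on one and the same finite set, and
-- an isolated disc is an orbit like any other. Only in this form can the walks of two states differ
-- by a transposition. Planarity decides how many unknowns an edge needs. In positive genus, t_e
-- could connect u_e to w_e while the sides of e lie on two boundary components. The states of H_e
-- would then fall into three types instead of two, and f_e and g_e could not record them all.

private
  variable
    X Y V K : Set
    nV nE nV̂ nÊ n : ℕ

-- Quotients by generated equivalence relations

eq-sym : {R : Rel X 0ℓ} {x y : X} → EqClosure R x y → EqClosure R y x
eq-sym = Eqv.symmetric _

eq-trans : {R : Rel X 0ℓ} {x y z : X} → EqClosure R x y → EqClosure R y z → EqClosure R x z
eq-trans = Eqv.transitive _

eq-refl : {R : Rel X 0ℓ} {x : X} → EqClosure R x x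
eq-refl = Eqv.reflexive _

eq-reflexive : {R : Rel X 0ℓ} {x y : X} → x ≡ y → EqClosure R x y
eq-reflexive refl = eq-refl

eq-gen : {R : Rel X 0ℓ} {x y : X} → R x y → EqClosure R x y
eq-gen = Eqv.return

eq-map : {R : Rel X 0ℓ} {S : Rel Y 0ℓ} (g : X → Y) → (∀ {x y} → R x y → EqClosure S (g x) (g y)) →
         ∀ {x y} → EqClosure R x y → EqClosure S (g x) (g y)
eq-map {S = S} g = Eqv.gfold (Eqv.isEquivalence S) g

-- The quotient of X by the equivalence relation generated by R is K.
record Classes {X : Set} (R : Rel X 0ℓ) (K : Set) : Set where
  field
    cls     : X → K
    rep     : K → X
    cls-rep : ∀ k → cls (rep k) ≡ k
    sound   : ∀ {x y} → R x y → cls x ≡ cls y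
    exact   : ∀ {x y} → cls x ≡ cls y → EqClosure R x y

  sound* : ∀ {x y} → EqClosure R x y → cls x ≡ cls y
  sound* = Eqv.gfold ≡.isEquivalence cls sound

open Classes

-- The three hypotheses say that `g` is well defined, injective and surjective on classes, so both
-- relations have the same quotient `K`. Comparisons of counts reduce to finding such a `g`.
Classes-pull : {R : Rel X 0ℓ} {S : Rel Y 0ℓ} (g : X → Y) →
  (∀ {x x'} → R x x' → EqClosure S (g x) (g x')) →
  (∀ {x x'} → EqClosure S (g x) (g x') → EqClosure R x x') →
  (∀ y → ∃ λ x → EqClosure S y (g x)) →
  Classes S K → Classes R K
Classes-pull g pres refl' surj C = record
  { cls = λ x → cls C (g x)
  ; rep = λ k → proj₁ (surj (rep C k))
  ; cls-rep = λ k → trans (sym (sound* C (proj₂ (surj (rep C k))))) (cls-rep C k)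
  ; sound = λ r → sound* C (pres r)
  ; exact = λ p → refl' (exact C p) }

Classes-change : {R S : Rel X 0ℓ} → (∀ {x y} → R x y → EqClosure S x y) →
  (∀ {x y} → S x y → EqClosure R x y) → Classes S K → Classes R K
Classes-change p q = Classes-pull id p (eq-map id q) (λ y → y , eq-refl)

Classes-map : {L : Set} {R : Rel X 0ℓ} (f : K → L) (g : L → K) → (∀ k → g (f k) ≡ k) → (∀ l → f (g l) ≡ l) →
  Classes R K → Classes R L
Classes-map f g gf fg C = record
  { cls = λ x → f (cls C x)
  ; rep = λ l → rep C (g l)
  ; cls-rep = λ l → trans (cong f (cls-rep C (g l))) (fg l)
  ; sound = λ r → cong f (sound C r)
  ; exact = λ p → exact C (trans (sym (gf _)) (trans (cong g p) (gf _))) }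

private
  Classes-≤ : {R : Rel X 0ℓ} {m n : ℕ} → Classes R (Fin m) → Classes R (Fin n) → m ≤ n
  Classes-≤ C D = injective⇒≤ {f = λ i → cls D (rep C i)}
    λ {i} {j} p → trans (sym (cls-rep C i)) (trans (sound* C (exact D p)) (cls-rep C j))

-- This turns two descriptions of one quotient into an equation between numbers.
Classes-unique : {R : Rel X 0ℓ} {m n : ℕ} → Classes R (Fin m) → Classes R (Fin n) → m ≡ n
Classes-unique C D = ≤-antisym (Classes-≤ C D) (Classes-≤ D C)

Classes-dec : {R : Rel X 0ℓ} {n : ℕ} → Classes R (Fin n) → ∀ x y → Dec (EqClosure R x y)
Classes-dec C x y with cls C x ≟ cls C y
... | yes p = yes (exact C p)
... | no ¬p = no (λ q → ¬p (sound* C q))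

data Join {X : Set} (R : Rel X 0ℓ) (x y : X) : Rel X 0ℓ where
  old : ∀ {u v} → R u v → Join R x y u v
  new : Join R x y x y

join-old : {R : Rel X 0ℓ} {x y u v : X} → EqClosure R u v → EqClosure (Join R x y) u v
join-old = eq-map id (eq-gen ∘ old)

-- The number of the class of `y` is removed by `punchOut`, and its elements are counted with `x`.
-- The two classes being different, exactly one number disappears.
Classes-join : {R : Rel X 0ℓ} {n : ℕ} {x y : X} → Classes R (Fin n) → ¬ EqClosure R x y →
  ∃ λ m → n ≡ suc m × Classes (Join R x y) (Fin m)
Classes-join {n = zero} {x = x} C _ with cls C x
... | ()
Classes-join {X = X} {R = R} {n = suc m} {x = x} {y = y} C x≁y = m , refl , record
  { cls = λ u → squash (cls C u)
  ; rep = λ k → rep C (punchIn cy k)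
  ; cls-rep = λ k → trans (cong squash (cls-rep C (punchIn cy k))) (squash-punchIn k)
  ; sound = sound'
  ; exact = λ {u} {v} p → eq-trans (toSplit u) (eq-trans (join-old (exact C (exact' u v p))) (eq-sym (toSplit v))) }
  where
  cx = cls C x
  cy = cls C y

  cy≢cx : cy ≢ cx
  cy≢cx p = x≁y (exact C (sym p))

  squash : Fin (suc m) → Fin m
  squash k with cy ≟ k
  ... | yes _ = punchOut cy≢cx
  ... | no p = punchOut p

  squash-punchIn : ∀ k → squash (punchIn cy k) ≡ k
  squash-punchIn k with cy ≟ punchIn cy k
  ... | yes p = contradiction (sym p) (punchInᵢ≢i cy k)
  ... | no p = trans (punchOut-cong cy refl) (punchOut-punchIn cy)

  sound' : ∀ {u v} → Join R x y u v → squash (cls C u) ≡ squash (cls C v)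
  sound' (old r) = cong squash (sound C r)
  sound' new with cy ≟ cx | cy ≟ cy
  ... | yes p | _ = contradiction p cy≢cx
  ... | no _ | yes _ = punchOut-cong cy refl
  ... | no _ | no p = contradiction refl p

  -- Moving the whole class of `y` to `x` along the new pair undoes the identification made by
  -- `squash`: picked points with equal squashed classes have equal classes.
  pick : X → X
  pick u with cy ≟ cls C u
  ... | yes _ = x
  ... | no _ = u

  toSplit : ∀ u → EqClosure (Join R x y) u (pick u)
  toSplit u with cy ≟ cls C u
  ... | yes p = eq-trans (join-old (exact C (sym p))) (eq-sym (eq-gen new))
  ... | no _ = eq-refl

  exact' : ∀ u v → squash (cls C u) ≡ squash (cls C v) → cls C (pick u) ≡ cls C (pick v)
  exact' u v p with cy ≟ cls C u | cy ≟ cls C v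
  ... | yes _ | yes _ = refl
  ... | yes _ | no q = punchOut-injective cy≢cx q p
  ... | no q | yes _ = punchOut-injective q cy≢cx p
  ... | no q | no q' = punchOut-injective q q' p

lookup-injective : {_~_ : Rel X 0ℓ} → (∀ {x y} → x ~ y → y ~ x) → ∀ {xs} → AllPairs (λ x y → ¬ (x ~ y)) xs →
  ∀ i j → lookup xs i ~ lookup xs j → i ≡ j
lookup-injective ~-sym (p ∷ ps) zero zero r = refl
lookup-injective ~-sym {xs = x ∷ xs} (p ∷ ps) zero (suc j) r = contradiction r (All.lookup p (∈-lookup j))
lookup-injective ~-sym {xs = x ∷ xs} (p ∷ ps) (suc i) zero r = contradiction (~-sym r) (All.lookup p (∈-lookup i))
lookup-injective ~-sym (p ∷ ps) (suc i) (suc j) r = cong suc (lookup-injective ~-sym ps i j r)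

Classes-transversal : {R : Rel X 0ℓ} (xs : List X) → AllPairs (λ x y → ¬ EqClosure R x y) xs →
  (∀ x → Any (EqClosure R x) xs) → Classes R (Fin (length xs))
Classes-transversal {R = R} xs distinct complete = record
  { cls = λ x → Any.index (complete x)
  ; rep = lookup xs
  ; cls-rep = λ k → same (eq-sym (lookup-index (complete (lookup xs k))))
  ; sound = λ {x} {y} r → same (eq-trans (eq-sym (lookup-index (complete x)))
                                 (eq-trans (eq-gen r) (lookup-index (complete y))))
  ; exact = λ {x} {y} p → eq-trans (lookup-index (complete x))
      (subst (λ i → EqClosure R (lookup xs i) y) (sym p) (eq-sym (lookup-index (complete y)))) }
  where
  same : ∀ {i j} → EqClosure R (lookup xs i) (lookup xs j) → i ≡ j
  same = lookup-injective eq-sym distinct _ _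

-- Representatives chosen by the counting algorithm

newReps : {A : Set} → (A → A → Bool) → List A → List A → List A
newReps r prev [] = []
newReps r prev (x ∷ xs) =
  if any (λ y → r y x) prev then newReps r (x ∷ prev) xs else x ∷ newReps r (x ∷ prev) xs

length-newReps : {A : Set} (r : A → A → Bool) (prev xs : List A) →
  length (newReps r prev xs) ≡ countNew r prev xs
length-newReps r prev [] = refl
length-newReps r prev (x ∷ xs) with any (λ y → r y x) prev
... | true = length-newReps r (x ∷ prev) xs
... | false = cong suc (length-newReps r (x ∷ prev) xs)

module _ {A : Set} {r : A → A → Bool} {_~_ : Rel A 0ℓ} {P : A → Set} (~-equiv : IsEquivalence _~_)
  (r⇒~ : ∀ {x y} → P x → P y → T (r x y) → x ~ y) (~⇒r : ∀ {x y} → P x → P y → x ~ y → T (r x y)) where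

  open IsEquivalence ~-equiv renaming (refl to ~-refl; sym to ~-sym; trans to ~-trans)

  private
    Any-~ : ∀ {x y xs} → x ~ y → Any (y ~_) xs → Any (x ~_) xs
    Any-~ p = Any.map (~-trans p)

    related : ∀ {x prev} → P x → All P prev → T (any (λ y → r y x) prev) → Any (x ~_) prev
    related {x} {prev} px ps t = go ps (any⁻ _ prev t)
      where
      go : ∀ {ys} → All P ys → Any (λ y → T (r y x)) ys → Any (x ~_) ys
      go (p ∷ ps) (here t) = here (~-sym (r⇒~ p px t))
      go (p ∷ ps) (there t) = there (go ps t)

    unrelated : ∀ {x prev} → P x → All P prev → ¬ T (any (λ y → r y x) prev) → All (λ y → ¬ (y ~ x)) prev
    unrelated px [] nt = []
    unrelated {x} {y ∷ ys} px (p ∷ ps) nt =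
      (λ q → nt (any⁺ {xs = y ∷ ys} (λ y → r y x) (here (~⇒r p px q))))
      ∷ unrelated px ps (λ t → nt (any⁺ {xs = y ∷ ys} (λ y → r y x) (there (any⁻ _ ys t))))

  -- `countNew` compares an element with all earlier ones, chosen or not. The alternative `prev`
  -- carries this through the induction: what is related to a skipped element is related to
  -- something still earlier. With `prev` empty only representatives remain. `P` restricts to the
  -- elements on which `r` decides the relation, such as the half-edges of present ribbons.
  newReps-complete : ∀ {prev xs} → All P prev → All P xs → ∀ {x} → x ∈ xs →
    Any (x ~_) prev ⊎ Any (x ~_) (newReps r prev xs)
  newReps-complete {prev} {x ∷ xs} ps (px ∷ pxs) (here refl) with any (λ y → r y x) prev in eq
  ... | true = inj₁ (related px ps (subst T (sym eq) _))
  ... | false = inj₂ (here ~-refl)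
  newReps-complete {prev} {x ∷ xs} ps (px ∷ pxs) (there m)
    with any (λ y → r y x) prev in eq | newReps-complete (px ∷ ps) pxs m
  ... | true  | inj₁ (here p) = inj₁ (Any-~ p (related px ps (subst T (sym eq) _)))
  ... | true  | inj₁ (there p) = inj₁ p
  ... | true  | inj₂ p = inj₂ p
  ... | false | inj₁ (here p) = inj₂ (here p)
  ... | false | inj₁ (there p) = inj₁ p
  ... | false | inj₂ p = inj₂ (there p)

  newReps-fresh : ∀ {prev xs} → All P prev → All P xs →
    All (λ x → All (λ y → ¬ (y ~ x)) prev) (newReps r prev xs)
  newReps-fresh {prev} {[]} ps [] = []
  newReps-fresh {prev} {x ∷ xs} ps (px ∷ pxs) with any (λ y → r y x) prev in eq
  ... | true = All.map All.tail (newReps-fresh (px ∷ ps) pxs)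
  ... | false = unrelated px ps (subst T eq) ∷ All.map All.tail (newReps-fresh (px ∷ ps) pxs)

  newReps-distinct : ∀ {prev xs} → All P prev → All P xs →
    AllPairs (λ x y → ¬ (x ~ y)) (newReps r prev xs)
  newReps-distinct {prev} {[]} ps [] = []
  newReps-distinct {prev} {x ∷ xs} ps (px ∷ pxs) with any (λ y → r y x) prev
  ... | true = newReps-distinct (px ∷ ps) pxs
  ... | false = All.map All.head (newReps-fresh (px ∷ ps) pxs) ∷ newReps-distinct (px ∷ ps) pxs

newReps-⊆ : {A : Set} {P : A → Set} (r : A → A → Bool) (prev : List A) {xs : List A} → All P xs → All P (newReps r prev xs)
newReps-⊆ r prev [] = []
newReps-⊆ r prev {x ∷ xs} (p ∷ ps) with any (λ y → r y x) prev
... | true = newReps-⊆ r (x ∷ prev) ps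
... | false = p ∷ newReps-⊆ r (x ∷ prev) ps

-- Walks of given length and their shortening

data Walk {X : Set} (R : Rel X 0ℓ) : ℕ → X → X → Set where
  []  : ∀ {x} → Walk R 0 x x
  _∷_ : ∀ {n x y z} → R x y → Walk R n y z → Walk R (suc n) x z

Walk-++ : {R : Rel X 0ℓ} {m n : ℕ} {x y z : X} → Walk R m x y → Walk R n y z → Walk R (m +ℕ n) x z
Walk-++ [] w' = w'
Walk-++ (r ∷ w) w' = r ∷ Walk-++ w w'

Walk-unsnoc : {R : Rel X 0ℓ} {n : ℕ} {x z : X} → Walk R (suc n) x z → ∃ λ y → Walk R n x y × R y z
Walk-unsnoc (r ∷ []) = _ , [] , r
Walk-unsnoc (r ∷ w@(_ ∷ _)) with Walk-unsnoc w
... | y , w' , r' = y , r ∷ w' , r'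

Walk-snoc : {R : Rel X 0ℓ} {n : ℕ} {x y z : X} → Walk R n x y → R y z → Walk R (suc n) x z
Walk-snoc [] r = r ∷ []
Walk-snoc (r' ∷ w) r = r' ∷ Walk-snoc w r

Star⇒Walk : {R : Rel X 0ℓ} {x y : X} → Star R x y → ∃ λ n → Walk R n x y
Star⇒Walk Star.ε = 0 , []
Star⇒Walk (r ◅ rs) = _ , r ∷ proj₂ (Star⇒Walk rs)

private
  vertex : {R : Rel X 0ℓ} {n : ℕ} {x y : X} → Walk R n x y → Fin (suc n) → X
  vertex {x = x} w zero = x
  vertex (r ∷ w) (suc i) = vertex w i

  prefix : {R : Rel X 0ℓ} {n : ℕ} {x y : X} (w : Walk R n x y) (i : Fin (suc n)) → Walk R (toℕ i) x (vertex w i)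
  prefix w zero = []
  prefix (r ∷ w) (suc i) = r ∷ prefix w i

  suffix : {R : Rel X 0ℓ} {n : ℕ} {x y : X} (w : Walk R n x y) (i : Fin (suc n)) → Walk R (n ∸ toℕ i) (vertex w i) y
  suffix w zero = w
  suffix (r ∷ w) (suc i) = suffix w i

-- The part of a walk between two visits of the same vertex can be cut out.
Walk-shorten : {R : Rel X 0ℓ} {N : ℕ} (code : X → Fin N) → (∀ {x y} → code x ≡ code y → x ≡ y) →
  ∀ {n x y} → Walk R n x y → ∃ λ m → m < N × Walk R m x y
Walk-shorten {R = R} {N} code code-inj {n} w = go n (<-wellFounded n) w
  where
  go : ∀ n → Acc _<_ n → ∀ {x y} → Walk R n x y → ∃ λ m → m < N × Walk R m x y
  go n (acc rec) {x} {y} w with n <? N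
  ... | yes n<N = n , n<N , w
  -- A walk of length `n` has `n + 1` vertices, which is more than the `N` codes.
  ... | no n≮N with pigeonhole (s≤s (≮⇒≥ n≮N)) (λ i → code (vertex w i))
  ... | i , j , i<j , p = go _ (rec shorter) (Walk-++ (prefix w i) rest)
    where
    rest : Walk R (n ∸ toℕ j) (vertex w i) y
    rest = subst (λ z → Walk R (n ∸ toℕ j) z y) (sym (code-inj p)) (suffix w j)

    shorter : toℕ i +ℕ (n ∸ toℕ j) < n
    shorter = ≤-trans (+-monoˡ-≤ (n ∸ toℕ j) i<j) (≤-reflexive (m+[n∸m]≡n (toℕ≤pred[n] j)))

-- Connected components

T-injective : ∀ {a b} → (T a → T b) → (T b → T a) → a ≡ b
T-injective {false} {false} _ _ = refl
T-injective {false} {true} _ q = contradiction (q _) id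
T-injective {true} {false} p _ = contradiction (p _) id
T-injective {true} {true} _ _ = refl

eqFin⇒≡ : ∀ {n} {i j : Fin n} → T (eqFin i j) → i ≡ j
eqFin⇒≡ = toWitness

≡⇒eqFin : ∀ {n} {i j : Fin n} → i ≡ j → T (eqFin i j)
≡⇒eqFin = fromWitness

Adj : ∀ {nV nE} → RG nV nE → State nE → Rel (Fin nV) 0ℓ
Adj F s u w = ∃ λ e → T (s e) × end F e false ≡ u × end F e true ≡ w

module _ {nV nE : ℕ} (F : RG nV nE) (s : State nE) where

  adj⇒Adj : ∀ {u w} → T (adj F s u w) → SymClosure (Adj F s) u w
  adj⇒Adj t with find (any⁻ _ (allFin nE) t)
  ... | e , _ , te with to (T-∧ {s e}) te
  ... | se , te' with to T-∨ te'
  ... | inj₁ p = let p₁ , p₂ = to T-∧ p in fwd (e , se , eqFin⇒≡ p₁ , eqFin⇒≡ p₂)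
  ... | inj₂ p = let p₁ , p₂ = to T-∧ p in bwd (e , se , eqFin⇒≡ p₂ , eqFin⇒≡ p₁)

  Adj⇒adj : ∀ {u w} → SymClosure (Adj F s) u w → T (adj F s u w)
  Adj⇒adj (fwd (e , se , p , q)) = any⁺ _ (lose (∈-allFin e)
    (from (T-∧ {s e}) (se , from T-∨ (inj₁ (from T-∧ (≡⇒eqFin p , ≡⇒eqFin q))))))
  Adj⇒adj (bwd (e , se , p , q)) = any⁺ _ (lose (∈-allFin e)
    (from (T-∧ {s e}) (se , from T-∨ (inj₂ (from T-∧ (≡⇒eqFin q , ≡⇒eqFin p))))))

  reachIn⇒Star : ∀ t {u w} → T (reachIn F s t u w) → EqClosure (Adj F s) u w
  reachIn⇒Star zero p = eq-reflexive (eqFin⇒≡ p)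
  reachIn⇒Star (suc t) {u} {w} p with to (T-∨ {reachIn F s t u w}) p
  ... | inj₁ q = reachIn⇒Star t q
  ... | inj₂ q with find (any⁻ _ (allFin nV) q)
  ... | x , _ , q' = let p₁ , p₂ = to (T-∧ {reachIn F s t u x}) q' in reachIn⇒Star t p₁ ◅◅ (adj⇒Adj p₂ ◅ Star.ε)

  reachIn-suc : ∀ t {u w} → T (reachIn F s t u w) → T (reachIn F s (suc t) u w)
  reachIn-suc t p = from T-∨ (inj₁ p)

  Walk⇒reachIn : ∀ t {n u w} → n ≤ t → Walk (SymClosure (Adj F s)) n u w → T (reachIn F s t u w)
  Walk⇒reachIn zero z≤n [] = ≡⇒eqFin refl
  Walk⇒reachIn (suc t) {zero} z≤n w = reachIn-suc t (Walk⇒reachIn t z≤n w)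
  Walk⇒reachIn (suc t) {suc n} {u} {w} (s≤s n≤t) w' with Walk-unsnoc w'
  ... | y , w'' , r = from (T-∨ {reachIn F s t u w})
      (inj₂ (any⁺ _ (lose (∈-allFin y) (from (T-∧ {reachIn F s t u y}) (Walk⇒reachIn t n≤t w'' , Adj⇒adj r)))))

  reach⇒Adj : ∀ {u w} → T (reach F s u w) → EqClosure (Adj F s) u w
  reach⇒Adj = reachIn⇒Star nV

  -- A walk between two discs can be cut down to fewer than `nV` steps, and `reach` searches `nV`
  -- rounds.
  Adj⇒reach : ∀ {u w} → EqClosure (Adj F s) u w → T (reach F s u w)
  Adj⇒reach p with Walk-shorten id id (proj₂ (Star⇒Walk p))
  ... | m , m<nV , w = Walk⇒reachIn nV (<⇒≤ m<nV) w

  kSt-classes : Classes (Adj F s) (Fin (kSt F s))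
  kSt-classes = subst (λ n → Classes (Adj F s) (Fin n)) (length-newReps (reach F s) [] (allFin nV))
    (Classes-transversal (newReps (reach F s) [] (allFin nV))
      (newReps-distinct {P = λ _ → ⊤} eqv (λ _ _ → reach⇒Adj) (λ _ _ → Adj⇒reach) [] (all⊤ (allFin nV)))
      (λ x → complete x (newReps-complete {P = λ _ → ⊤} eqv (λ _ _ → reach⇒Adj) (λ _ _ → Adj⇒reach) [] (all⊤ (allFin nV)) (∈-allFin x))))
    where
    eqv = Eqv.isEquivalence (Adj F s)

    all⊤ : ∀ {A : Set} (xs : List A) → All (λ _ → ⊤) xs
    all⊤ = All.universal (λ _ → tt)

    complete : ∀ {P Q : Fin nV → Set} x {ys : List (Fin nV)} → Any P [] ⊎ Any Q ys → Any Q ys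
    complete x (inj₂ p) = p

-- Orbits of maps

Step : (X → X) → Rel X 0ℓ
Step f x y = f x ≡ y

iter-+ : (f : X → X) (m n : ℕ) (x : X) → iter f (m +ℕ n) x ≡ iter f m (iter f n x)
iter-+ f zero n x = refl
iter-+ f (suc m) n x = cong f (iter-+ f m n x)

iter-injective : {f : X → X} → (∀ {x y} → f x ≡ f y → x ≡ y) → ∀ n {x y} → iter f n x ≡ iter f n y → x ≡ y
iter-injective inj zero p = p
iter-injective inj (suc n) p = iter-injective inj n (inj p)

step-eq : (f : X → X) (x : X) → EqClosure (Step f) x (f x)
step-eq f x = eq-gen refl

iter-eq : (f : X → X) (n : ℕ) (x : X) → EqClosure (Step f) x (iter f n x)
iter-eq f zero x = eq-refl
iter-eq f (suc n) x = eq-trans (iter-eq f n x) (step-eq f _)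

-- Having a common iterate is already an equivalence relation, for any map: two meeting points on
-- the path of the middle element are brought together by iterating further, since iterates of `f`
-- commute.
iter-confluent : {f : X → X} {x y : X} → EqClosure (Step f) x y → ∃₂ λ m n → iter f m x ≡ iter f n y
iter-confluent {f = f} = Eqv.fold eqv (λ {x} p → 1 , 0 , p)
  where
  _≈_ : Rel _ 0ℓ
  x ≈ y = ∃₂ λ m n → iter f m x ≡ iter f n y
  eqv : IsEquivalence _≈_
  eqv = record
    { refl = 0 , 0 , refl
    ; sym = λ (m , n , p) → n , m , sym p
    ; trans = λ { {x} {y} {z} (m , n , p) (m' , n' , p') → m' +ℕ m , n +ℕ n' ,
        trans (iter-+ f m' m x) (trans (cong (iter f m') p)
          (trans (sym (iter-+ f m' n y)) (trans (cong (λ k → iter f k y) (ℕ.+-comm m' n))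
            (trans (iter-+ f n m' y) (trans (cong (iter f n) p') (sym (iter-+ f n n' z))))))) } }

record Finitary (X : Set) : Set where
  field
    size : ℕ
    code : X → Fin size
    code-injective : ∀ {x y} → code x ≡ code y → x ≡ y

module _ (fin : Finitary X) {f : X → X} (f-injective : ∀ {x y} → f x ≡ f y → x ≡ y) where
  open Finitary fin

  -- Among `size + 1` iterates two coincide, and injectivity cancels the steps that they share.
  iter-periodic : ∀ x → ∃ λ p → iter f (suc p) x ≡ x
  iter-periodic x with pigeonhole ≤-refl (λ i → code (iter f (toℕ {suc size} i) x))
  ... | i , j , i<j , p = toℕ j ∸ suc (toℕ i) , iter-injective f-injective (toℕ i)
    (trans (sym (iter-+ f (toℕ i) (suc d) x)) (trans (cong (λ k → iter f k x) eq) (sym (code-injective p))))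
    where
    d = toℕ j ∸ suc (toℕ i)
    eq : toℕ i +ℕ suc d ≡ toℕ j
    eq = trans (+-suc (toℕ i) d) (trans (ℕ.+-comm (suc (toℕ i)) d) (m∸n+n≡m i<j))

  -- If `p + 1` is a period of `x`, then `n * p` further steps complete `n` periods.
  iter-return : ∀ n x → ∃ λ m → iter f m (iter f n x) ≡ x
  iter-return n x with iter-periodic x
  ... | p , eq = n *ℕ p , trans (sym (iter-+ f (n *ℕ p) n x))
      (trans (cong (λ k → iter f k x) (trans (ℕ.+-comm (n *ℕ p) n) (sym (*-suc n p)))) (multiple n))
    where
    multiple : ∀ n → iter f (n *ℕ suc p) x ≡ x
    multiple zero = refl
    multiple (suc n) = trans (iter-+ f (suc p) (n *ℕ suc p) x) (trans (cong (iter f (suc p)) (multiple n)) eq)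

  iter-forward : ∀ {x y} → EqClosure (Step f) x y → ∃ λ n → iter f n x ≡ y
  iter-forward {x} {y} p with iter-confluent p
  ... | m , n , q with iter-return n y
  ... | k , r = k +ℕ m , trans (iter-+ f k m x) (trans (cong (iter f k) q) r)

-- First-return maps

data Visit {X : Set} (Stop : X → Set) (f : X → X) : X → X → Set where
  arrived : ∀ {x} → Stop x → Visit Stop f x x
  pass    : ∀ {x y} → ¬ Stop x → Visit Stop f (f x) y → Visit Stop f x y

module _ {Stop : X → Set} {f : X → X} where

  Visit-deterministic : ∀ {x y z} → Visit Stop f x y → Visit Stop f x z → y ≡ z
  Visit-deterministic (arrived _) (arrived _) = refl
  Visit-deterministic (arrived s) (pass n _) = contradiction s n
  Visit-deterministic (pass n _) (arrived s) = contradiction s n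
  Visit-deterministic (pass _ v) (pass _ v') = Visit-deterministic v v'

  Visit⇒eq : ∀ {x y} → Visit Stop f x y → EqClosure (Step f) x y
  Visit⇒eq (arrived _) = eq-refl
  Visit⇒eq (pass _ v) = eq-trans (step-eq f _) (Visit⇒eq v)

  Visit-step : ∀ {x y} → Visit Stop f x y → x ≡ y ⊎ Visit Stop f (f x) y
  Visit-step (arrived _) = inj₁ refl
  Visit-step (pass _ v) = inj₂ v

  -- Here `h` is the first-return map of `f` on the points `g y`. Each step of `f` either continues
  -- the current excursion, whose end is unchanged, or starts the next one, which is one more step
  -- of `h`.
  Visit-track : {g : Y → X} {h : Y → Y} {P : Y → Set} →
    (∀ {y} → P y → Stop (g y)) → (∀ {y} → P y → P (h y)) →
    (∀ {y} → P y → Visit Stop f (f (g y)) (g (h y))) →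
    ∀ {y} → P y → ∀ n → ∃ λ t → P (iter h t y) × Visit Stop f (iter f n (g y)) (g (iter h t y))
  Visit-track gs Ph v py zero = 0 , py , arrived (gs py)
  Visit-track {g = g} {h = h} {P} gs Ph v {y} py (suc n) with Visit-track {g = g} {h} {P} gs Ph v {y} py n
  ... | t , pt , w with Visit-step w
  ... | inj₁ p = suc t , Ph pt , subst (λ z → Visit Stop f (f z) (g (h (iter h t y)))) (sym p) (v pt)
  ... | inj₂ w' = t , pt , w'

-- Related points have a common `f`-iterate, and the first stop after it is unique, so the tracked
-- `h`-paths meet there. The last hypothesis on `f` ensures that every class contains a stop.
Classes-firstReturn : {K : Set} {g : X → V} {h : X → X} {f : V → V} → (∀ {x y} → g x ≡ g y → x ≡ y) →
  (∀ x → Visit (λ w → ∃ λ x → g x ≡ w) f (f (g x)) (g (h x))) →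
  (∀ w → ∃ λ x → Visit (λ w → ∃ λ x → g x ≡ w) f w (g x)) →
  Classes (Step f) K → Classes (Step h) K
Classes-firstReturn {V = V} {g = g} {h = h} {f = f} g-inj ret ess = Classes-pull g preserve reflect
  (λ w → proj₁ (ess w) , Visit⇒eq (proj₂ (ess w)))
  where
  preserve : ∀ {x x'} → Step h x x' → EqClosure (Step f) (g x) (g x')
  preserve {x} refl = eq-trans (step-eq f (g x)) (Visit⇒eq (ret x))

  track : ∀ x n → ∃ λ t → ⊤ × Visit (λ w → ∃ λ x → g x ≡ w) f (iter f n (g x)) (g (iter h t x))
  track x n = Visit-track {g = g} {h = h} {P = λ _ → ⊤} (λ {y} _ → y , refl) (λ _ → tt) (λ {y} _ → ret y) tt n

  reflect : ∀ {x x'} → EqClosure (Step f) (g x) (g x') → EqClosure (Step h) x x'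
  reflect {x} {x'} p with iter-confluent p
  ... | m , n , q with track x m | track x' n
  ... | t , _ , v | t' , _ , v' = eq-trans (iter-eq h t x) (eq-trans
      (eq-reflexive (g-inj (Visit-deterministic v (subst (λ w → Visit _ f w _) (sym q) v'))))
      (eq-sym (iter-eq h t' x')))

-- Multiplying a permutation by a transposition

-- Ψ follows the f-orbit of y until it comes back to y.
orbit-closes : Finitary X → {f : X → X} → (∀ {x y} → f x ≡ f y → x ≡ y) →
  (ι : X → V) (Ψ : V → V) (y : X) →
  (∀ z → EqClosure (Step f) y z → z ≡ y ⊎ Ψ (ι z) ≡ ι (f z)) →
  EqClosure (Step Ψ) (ι (f y)) (ι y)
orbit-closes fin {f} f-inj ι Ψ y agree with iter-periodic fin f-inj y
... | p , eq = subst (λ z → EqClosure (Step Ψ) (ι (f y)) (ι z)) eq (along p)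
  where
  along : ∀ n → EqClosure (Step Ψ) (ι (f y)) (ι (iter f (suc n) y))
  along zero = eq-refl
  along (suc n) with agree (iter f (suc n) y) (iter-eq f (suc n) y)
  -- An early return to `y` puts the next point back at `f y`, where the path starts afresh.
  ... | inj₁ q = eq-reflexive (cong (ι ∘ f) (sym q))
  ... | inj₂ q = eq-trans (along n) (eq-gen q)

-- `f'` is `f` composed with the transposition of `x` and `y`, which acts first.
record Swapped {X : Set} (f f' : X → X) (x y : X) : Set where
  field
    at-x : f' x ≡ f y
    at-y : f' y ≡ f x
    else : ∀ {z} → z ≢ x → z ≢ y → f' z ≡ f z

least : {P : ℕ → Set} → (∀ n → Dec (P n)) → ∀ {n} → P n → ∃ λ m → P m × (∀ {i} → i < m → ¬ P i)
least P? {n} pn with P? 0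
... | yes p0 = 0 , p0 , λ ()
least P? {zero} pn | no ¬p0 = contradiction pn ¬p0
least {P} P? {suc n} pn | no ¬p0 with least {P ∘ suc} (P? ∘ suc) pn
... | m , pm , min = suc m , pm , λ { {zero} _ → ¬p0 ; {suc i} (s≤s i<m) → min i<m }

module Transposition (fin : Finitary X) (_≟_ : DecidableEquality X) {f f' : X → X} {x y : X}
  (f-inj : ∀ {u v} → f u ≡ f v → u ≡ v) (f'-inj : ∀ {u v} → f' u ≡ f' v → u ≡ v)
  (sw : Swapped f f' x y) where
  open Swapped sw

  -- `f'` sends `x` to `f y` and then runs along the `f`-orbit of `y`, which does not contain `x`,
  -- until it reaches `y`.
  joined : ¬ EqClosure (Step f) x y → EqClosure (Step f') x y
  joined x≁y = eq-trans (eq-gen at-x) (orbit-closes fin f-inj id f' y agree)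
    where
    agree : ∀ z → EqClosure (Step f) y z → z ≡ y ⊎ f' z ≡ f z
    agree z r with z ≟ y
    ... | yes q = inj₁ q
    ... | no q = inj₂ (else (λ { refl → x≁y (eq-sym r) }) q)

  -- Once `x` and `y` share an `f'`-orbit, exchanging their images has no effect on classes: `f'`
  -- generates the same equivalence as `f` together with the pair of `x` and `y`.
  Classes-joined : {n : ℕ} → ¬ EqClosure (Step f) x y → Classes (Step f) (Fin n) →
    ∃ λ m → n ≡ suc m × Classes (Step f') (Fin m)
  Classes-joined x≁y C with Classes-join C x≁y
  ... | m , p , D = m , p , Classes-change step⇒join join⇒step D
    where
    step⇒join : ∀ {u v} → Step f' u v → EqClosure (Join (Step f) x y) u v
    step⇒join {u} refl with u ≟ x | u ≟ y
    ... | yes refl | _ = eq-trans (eq-gen new) (eq-gen (old (sym at-x)))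
    ... | no _ | yes refl = eq-trans (eq-sym (eq-gen new)) (eq-gen (old (sym at-y)))
    ... | no p | no q = eq-gen (old (sym (else p q)))

    join⇒step : ∀ {u v} → Join (Step f) x y u v → EqClosure (Step f') u v
    join⇒step new = joined x≁y
    join⇒step {u} (old refl) with u ≟ x | u ≟ y
    ... | yes refl | _ = eq-trans (joined x≁y) (eq-gen at-y)
    ... | no _ | yes refl = eq-trans (eq-sym (joined x≁y)) (eq-gen at-x)
    ... | no p | no q = eq-gen (else p q)

  private
    -- The f'-orbit of x is the segment of the f-orbit from f y up to x.
    module Segment (x≢y : x ≢ y) (m : ℕ) (end-x : iter f m (f y) ≡ x)
      (before-x : ∀ {i} → i < m → iter f i (f y) ≢ x) where

      y∉ : ∀ {i} → i ≤ m → iter f i (f y) ≢ y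
      y∉ {i} i≤m r with m≤n⇒m<n∨m≡n i≤m
      ... | inj₂ refl = x≢y (trans (sym end-x) r)
      -- If the segment met `y` after `i` steps, its remaining `m - (i + 1)` steps would lead from
      -- `f y` to `x`, against the minimality of `m`.
      ... | inj₁ i<m = before-x (∸-monoʳ-< {m} {suc i} {0} (s≤s z≤n) i<m)
            (trans (cong (iter f (m ∸ suc i)) (cong f (sym r)))
              (trans (sym (iter-+ f (m ∸ suc i) (suc i) (f y)))
                (trans (cong (λ j → iter f j (f y)) (m∸n+n≡m i<m)) end-x)))

      contains : ∀ k → ∃ λ i → i ≤ m × iter f' k x ≡ iter f i (f y)
      contains zero = m , ≤-refl , sym end-x
      contains (suc k) with contains k
      ... | i , i≤m , r with m≤n⇒m<n∨m≡n i≤m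
      ... | inj₂ refl = 0 , z≤n , trans (cong f' (trans r end-x)) at-x
      ... | inj₁ i<m = suc i , i<m ,
            trans (cong f' r) (else (before-x i<m) (y∉ i≤m))

  separated : x ≢ y → EqClosure (Step f) x y → ¬ EqClosure (Step f') x y
  separated x≢y x~y x~'y
    with n , p ← iter-forward fin f-inj (eq-trans (eq-sym (step-eq f y)) (eq-sym x~y))
    with m , end-x , before-x ← least (λ k → iter f k (f y) ≟ x) {n} p
    with k , q ← iter-forward fin f'-inj x~'y
    with i , i≤m , r ← Segment.contains x≢y m end-x before-x k
    = Segment.y∉ x≢y m end-x before-x i≤m (trans (sym r) q)

Swapped-sym : {f f' : X → X} {x y : X} → Swapped f f' x y → Swapped f' f x y
Swapped-sym sw = record { at-x = sym at-y ; at-y = sym at-x ; else = λ p q → sym (else p q) }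
  where open Swapped sw

module _ (fin : Finitary X) (_≟_ : DecidableEquality X) {f f' : X → X} {x y : X}
  (f-inj : ∀ {u v} → f u ≡ f v → u ≡ v) (f'-inj : ∀ {u v} → f' u ≡ f' v → u ≡ v)
  (sw : Swapped f f' x y) {n n' : ℕ} (C : Classes (Step f) (Fin n)) (C' : Classes (Step f') (Fin n')) where

  transposition-joins : ¬ EqClosure (Step f) x y → n ≡ suc n'
  transposition-joins x≁y with Transposition.Classes-joined fin _≟_ f-inj f'-inj sw x≁y C
  ... | m , p , D = trans p (cong suc (Classes-unique D C'))

module _ (fin : Finitary X) (_≟_ : DecidableEquality X) {f f' : X → X} {x y : X}
  (f-inj : ∀ {u v} → f u ≡ f v → u ≡ v) (f'-inj : ∀ {u v} → f' u ≡ f' v → u ≡ v)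
  (sw : Swapped f f' x y) {n n' : ℕ} (C : Classes (Step f) (Fin n)) (C' : Classes (Step f') (Fin n')) where

  -- The same transposition leads from `f'` back to `f`, so this is the joining case with the roles
  -- exchanged; `separated` supplies its hypothesis.
  transposition-splits : x ≢ y → EqClosure (Step f) x y → n' ≡ suc n
  transposition-splits x≢y x~y = transposition-joins fin _≟_ f'-inj f-inj (Swapped-sym sw) C' C
    (Transposition.separated fin _≟_ f-inj f'-inj sw x≢y x~y)

-- Boundary walks on the corners of a ribbon graph

_≟H_ : DecidableEquality (HE n)
_≟H_ = Product.≡-dec _≟_ _≟B_

eqBool⇒≡ : ∀ {b b'} → T (eqBool b b') → b ≡ b'
eqBool⇒≡ {false} {false} _ = refl
eqBool⇒≡ {true} {true} _ = refl

eqBool-refl : ∀ b → T (eqBool b b)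
eqBool-refl false = _
eqBool-refl true = _

eqHE⇒≡ : {h h' : HE n} → T (eqHE h h') → h ≡ h'
eqHE⇒≡ {h = e , b} {e' , b'} t = let p , q = to (T-∧ {eqFin e e'}) t in cong₂ _,_ (eqFin⇒≡ p) (eqBool⇒≡ q)

eqHE-refl : (h : HE n) → T (eqHE h h)
eqHE-refl (e , b) = from (T-∧ {eqFin e e}) (≡⇒eqFin refl , eqBool-refl b)

endOf : RG nV nE → HE nE → Fin nV
endOf F (e , b) = end F e b

-- The form in which `WellFormed` is used: every half-edge occurs exactly once, at its own disc. It
-- is easier to carry over to rotated lists, deletions and contractions than a permutation of a
-- filtered list.
record Regular {nV nE : ℕ} (F : RG nV nE) : Set where
  field
    present : ∀ h → h ∈ rot F (endOf F h)
    owner   : ∀ {v h} → h ∈ rot F v → endOf F h ≡ v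
    unique  : ∀ v → Unique (rot F v)

open Regular

∈-allHE : (h : HE n) → h ∈ allHE n
∈-allHE {n} (e , b) = go b (∈-allFin e)
  where
  go : ∀ b {es : List (Fin n)} → e ∈ es → (e , b) ∈ concatMap (λ e → (e , false) ∷ (e , true) ∷ []) es
  go false (here refl) = here refl
  go true (here refl) = there (here refl)
  go b (there m) = there (there (go b m))

allHE-unique : ∀ n → Unique (allHE n)
allHE-unique n = go (Unique.allFin⁺ n)
  where
  fresh : ∀ {e : Fin n} {b es} → All (e ≢_) es → All ((e , b) ≢_) (concatMap (λ e → (e , false) ∷ (e , true) ∷ []) es)
  fresh [] = []
  fresh (p ∷ ps) = (λ q → p (cong proj₁ q)) ∷ (λ q → p (cong proj₁ q)) ∷ fresh ps
  go : {es : List (Fin n)} → Unique es → Unique (concatMap (λ e → (e , false) ∷ (e , true) ∷ []) es)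
  go [] = []
  go (p ∷ ps) = ((λ ()) ∷ fresh p) ∷ fresh p ∷ go ps

Unique-resp-↭ : {xs ys : List X} → xs ↭ ys → Unique xs → Unique ys
Unique-resp-↭ p = Permₛ.Unique-resp-↭ (≡.setoid _) (↭⇒↭ₛ p)

WellFormed⇒Regular : {F : RG nV nE} → WellFormed F → Regular F
WellFormed⇒Regular {F = F} wf = record
  { present = λ h → ∈-resp-↭ (↭-sym (wf _)) (∈-filter⁺ (λ h' → endOf F h' ≟ endOf F h) (∈-allHE h) refl)
  ; owner = λ {v} m → proj₂ (∈-filter⁻ (λ h' → endOf F h' ≟ v) {xs = allHE _} (∈-resp-↭ (wf v) m))
  ; unique = λ v → Unique-resp-↭ (↭-sym (wf v)) (Unique.filter⁺ (λ h' → endOf F h' ≟ v) (allHE-unique _)) }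

split-unique : {y : X} (a : List X) {b : List X} (a' : List X) {b' : List X} → Unique (a ++ y ∷ b) →
  a ++ y ∷ b ≡ a' ++ y ∷ b' → a ≡ a' × b ≡ b'
split-unique [] [] u eq = refl , proj₂ (∷-injective eq)
split-unique [] (z ∷ a') (p ∷ _) eq with ∷-injective eq
... | refl , refl = contradiction refl (All.lookup p (∈-++⁺ʳ a' (here refl)))
split-unique (x ∷ a) [] (p ∷ _) eq with ∷-injective eq
... | refl , refl = contradiction refl (All.lookup p (∈-++⁺ʳ a (here refl)))
split-unique (x ∷ a) (z ∷ a') (_ ∷ u) eq with ∷-injective eq
... | refl , eq' with split-unique a a' u eq'
... | refl , refl = refl , refl

-- The corners of the discs: the corner preceding a half-edge, and one marked
-- corner per disc, at which the cyclic order of the half-edges is cut open.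
Corner : ℕ → ℕ → Set
Corner nV nE = HE nE ⊎ Fin nV

_≟C_ : DecidableEquality (Corner nV nE)
_≟C_ = Sum.≡-dec _≟H_ _≟_

codeHE : HE n → Fin (2 *ℕ n)
codeHE (e , b) = combine {2} (if b then suc zero else zero) e

codeHE-injective : {h h' : HE n} → codeHE h ≡ codeHE h' → h ≡ h'
codeHE-injective {h = e , b} {e' , b'} p with combine-injective {2} (if b then suc zero else zero) e (if b' then suc zero else zero) e' p
codeHE-injective {h = e , false} {e' , false} p | _ , q = cong (_, false) q
codeHE-injective {h = e , true} {e' , true} p | _ , q = cong (_, true) q

Corner-finitary : Finitary (Corner nV nE)
Corner-finitary {nV} {nE} = record
  { size = 2 *ℕ nE +ℕ nV
  ; code = λ x → join (2 *ℕ nE) nV (coded x)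
  ; code-injective = λ {x} {y} p → coded-injective (trans (sym (splitAt-join (2 *ℕ nE) nV (coded x)))
      (trans (cong (splitAt (2 *ℕ nE)) p) (splitAt-join (2 *ℕ nE) nV (coded y)))) }
  where
  coded : Corner nV nE → Fin (2 *ℕ nE) ⊎ Fin nV
  coded (inj₁ h) = inj₁ (codeHE h)
  coded (inj₂ v) = inj₂ v

  coded-injective : ∀ {x y} → coded x ≡ coded y → x ≡ y
  coded-injective {inj₁ h} {inj₁ h'} p = cong inj₁ (codeHE-injective (Sum.inj₁-injective p))
  coded-injective {inj₂ v} {inj₂ w} p = cong inj₂ (Sum.inj₂-injective p)

first : Fin nV → List (HE nE) → Corner nV nE
first v [] = inj₂ v
first v (h ∷ _) = inj₁ h

following : HE n → List (HE n) → List (HE n)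
following h [] = []
following h (x ∷ xs) with x ≟H h
... | yes _ = xs
... | no _ = following h xs

following-split : {h : HE n} (p : List (HE n)) {q : List (HE n)} → Unique (p ++ h ∷ q) → following h (p ++ h ∷ q) ≡ q
following-split {h = h} [] u with h ≟H h
... | yes _ = refl
... | no ¬p = contradiction refl ¬p
following-split {h = h} (x ∷ p) (px ∷ u) with x ≟H h
... | yes refl = contradiction refl (All.lookup px (∈-++⁺ʳ p (here refl)))
... | no _ = following-split p u

cornerAt : RG nV nE → Corner nV nE → Fin nV
cornerAt F (inj₁ h) = endOf F h
cornerAt F (inj₂ v) = v

-- For a regular graph this is one cycle per disc, through the marked corner and the corners of all
-- its half-edges.
σ : RG nV nE → Corner nV nE → Corner nV nE
σ F (inj₁ h) = first (endOf F h) (following h (rot F (endOf F h)))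
σ F (inj₂ v) = first v (rot F v)

cross : State n → HE n → HE n
cross s (e , b) = e , (if s e then not b else b)

-- The boundary walk of a state, passing by the half-edges of absent ribbons.
φ : RG nV nE → State nE → Corner nV nE → Corner nV nE
φ F s (inj₁ h) = σ F (inj₁ (cross s h))
φ F s (inj₂ v) = σ F (inj₂ v)

cross-involutive : (s : State n) (h : HE n) → cross s (cross s h) ≡ h
cross-involutive s (e , b) with s e
... | true = cong (e ,_) (not-involutive b)
... | false = refl

module _ {F : RG nV nE} (reg : Regular F) where

  rot-split : ∀ h → ∃₂ λ p q → rot F (endOf F h) ≡ p ++ h ∷ q
  rot-split h = ∈-∃++ (present reg h)

  σ-at : ∀ {v h} p {q} → rot F v ≡ p ++ h ∷ q → σ F (inj₁ h) ≡ first v q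
  σ-at {v} {h} p {q} eq with owner reg (subst (h ∈_) (sym eq) (∈-++⁺ʳ p (here refl)))
  ... | refl = cong (first v) (trans (cong (following h) eq) (following-split p (subst Unique eq (unique reg v))))

  cornerAt-first : ∀ {v} p {q} → rot F v ≡ p ++ q → cornerAt F (first v q) ≡ v
  cornerAt-first p {[]} eq = refl
  cornerAt-first {v} p {h ∷ q} eq = owner reg (subst (h ∈_) (sym eq) (∈-++⁺ʳ p (here refl)))

  cornerAt-σ : ∀ x → cornerAt F (σ F x) ≡ cornerAt F x
  cornerAt-σ (inj₂ v) = cornerAt-first [] refl
  cornerAt-σ (inj₁ h) with rot-split h
  ... | p , q , eq = trans (cong (cornerAt F) (σ-at p eq))
                      (cornerAt-first (p ++ h ∷ []) (trans eq (sym (++-assoc p (h ∷ []) q))))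

  private
    first-injective : ∀ {v} p {q} p' {q'} → rot F v ≡ p ++ q → rot F v ≡ p' ++ q' → first v q ≡ first v q' → p ≡ p'
    first-injective p {[]} p' {[]} eq eq' _ = trans (sym (++-identityʳ p)) (trans (trans (sym eq) eq') (++-identityʳ p'))
    first-injective {v} p {h ∷ q} p' {_ ∷ q'} eq eq' refl =
      proj₁ (split-unique p p' (subst Unique eq (unique reg v)) (trans (sym eq) eq'))

    lastCorner : Corner nV nE → List (HE nE) → Corner nV nE
    lastCorner x [] = x
    lastCorner x (h ∷ p) = lastCorner (inj₁ h) p

    lastCorner-snoc : ∀ x p {h} → lastCorner x (p ++ h ∷ []) ≡ inj₁ h
    lastCorner-snoc x [] = refl
    lastCorner-snoc x (h ∷ p) = lastCorner-snoc (inj₁ h) p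

    σ-cut : ∀ x → ∃₂ λ p q → rot F (cornerAt F x) ≡ p ++ q × σ F x ≡ first (cornerAt F x) q
                            × lastCorner (inj₂ (cornerAt F x)) p ≡ x
    σ-cut (inj₂ v) = [] , rot F v , refl , refl , refl
    σ-cut (inj₁ h) with rot-split h
    ... | p , q , eq = p ++ h ∷ [] , q , trans eq (sym (++-assoc p (h ∷ []) q)) , σ-at p eq , lastCorner-snoc _ p

  -- A corner corresponds to a cut of the list at its disc: it ends the left part, and its image
  -- under `σ` begins the right part. Since no half-edge is repeated, the right end of the cut
  -- determines the cut, and hence the corner.
  σ-injective : ∀ {x y} → σ F x ≡ σ F y → x ≡ y
  σ-injective {x} {y} eq with trans (sym (cornerAt-σ x)) (trans (cong (cornerAt F) eq) (cornerAt-σ y))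
  ... | v≡w with σ-cut x | σ-cut y
  ... | p , q , r , s , l | p' , q' , r' , s' , l' with cornerAt F x | cornerAt F y
  σ-injective eq | refl | p , q , r , s , l | p' , q' , r' , s' , l' | v | _ =
    trans (sym l) (trans (cong (lastCorner (inj₂ v)) (first-injective p p' r r' (trans (sym s) (trans eq s')))) l')

  φ-injective : ∀ s {x y} → φ F s x ≡ φ F s y → x ≡ y
  φ-injective s {inj₁ h} {inj₁ h'} eq = cong inj₁ (trans (sym (cross-involutive s h))
    (trans (cong (cross s) (Sum.inj₁-injective (σ-injective {inj₁ (cross s h)} {inj₁ (cross s h')} eq))) (cross-involutive s h')))
  φ-injective s {inj₁ h} {inj₂ w} eq with σ-injective {inj₁ (cross s h)} {inj₂ w} eq
  ... | ()
  φ-injective s {inj₂ v} {inj₁ h} eq with σ-injective {inj₂ v} {inj₁ (cross s h)} eq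
  ... | ()
  φ-injective s {inj₂ v} {inj₂ w} eq = σ-injective {inj₂ v} {inj₂ w} eq

headOr : HE n → List (HE n) → HE n
headOr h [] = h
headOr h (x ∷ _) = x

eqHE-≢ : {h h' : HE n} → h ≢ h' → eqHE h h' ≡ false
eqHE-≢ {h = h} {h'} p with eqHE h h' in eq
... | true = contradiction (eqHE⇒≡ (subst T (sym eq) _)) p
... | false = refl

eqHE-same : (h : HE n) → eqHE h h ≡ true
eqHE-same h with eqHE h h | eqHE-refl h
... | true | _ = refl

private
  succCycAux-split : (f h : HE n) (p : List (HE n)) (q : List (HE n)) → h ∉ p → succCycAux f h (p ++ h ∷ q) ≡ headOr f q
  succCycAux-split f h [] [] h∉p rewrite eqHE-same h = refl
  succCycAux-split f h [] (y ∷ q) h∉p rewrite eqHE-same h = refl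
  succCycAux-split f h (x ∷ []) q h∉p rewrite eqHE-≢ {h = x} {h} (λ eq → h∉p (here (sym eq))) =
    succCycAux-split f h [] q λ ()
  succCycAux-split f h (x ∷ y ∷ p) q h∉p = trans
    (cong (λ c → if c then y else succCycAux f h (y ∷ p ++ h ∷ q)) (eqHE-≢ (λ eq → h∉p (here (sym eq)))))
    (succCycAux-split f h (y ∷ p) q (h∉p ∘ there))

succCyc-split : (h : HE n) (p q : List (HE n)) → h ∉ p → succCyc (p ++ h ∷ q) h ≡ headOr h (q ++ p)
succCyc-split h [] q h∉p = trans (succCycAux-split h h [] q h∉p) (cong (headOr h) (sym (++-identityʳ q)))
succCyc-split h (x ∷ p) q h∉p = trans (succCycAux-split x h (x ∷ p) q h∉p) (headOr-++ q)
  where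
  headOr-++ : ∀ q → headOr x q ≡ headOr h (q ++ x ∷ p)
  headOr-++ [] = refl
  headOr-++ (_ ∷ _) = refl

∉-split : {h : X} (p : List X) {q : List X} → Unique (p ++ h ∷ q) → h ∉ p
∉-split (x ∷ p) (px ∷ u) (here refl) = All.lookup px (∈-++⁺ʳ p (here refl)) refl
∉-split (x ∷ p) (_ ∷ u) (there m) = ∉-split p u m

-- Boundary components are orbits

module Boundary {F : RG nV nE} (reg : Regular F) (s : State nE) where

  private
    Stop : Corner nV nE → Set
    Stop (inj₁ h) = T (inS F s h)
    Stop (inj₂ v) = ⊥

    _~_ : Rel (Corner nV nE) 0ℓ
    _~_ = EqClosure (Step (φ F s))

    present? = T? ∘ inS F s

  φ-absent : ∀ {h} → ¬ T (s (proj₁ h)) → φ F s (inj₁ h) ≡ σ F (inj₁ h)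
  φ-absent {e , b} ¬t with s e
  ... | true = contradiction _ ¬t
  ... | false = refl

  φ-present : ∀ {e b} → T (s e) → φ F s (inj₁ (e , b)) ≡ σ F (inj₁ (e , not b))
  φ-present {e} t with s e
  ... | true = refl

  private
    -- The continuations separate the two ways in which the list can end. If only absent ribbons
    -- remain, the walk runs into the marked corner, which is not a stop; `none` tells how it goes
    -- on from there.
    scan : ∀ {v} p q {w} → rot F v ≡ p ++ q →
      (filter present? q ≡ [] → Visit Stop (φ F s) (inj₂ v) w) →
      (∀ {x xs} → filter present? q ≡ x ∷ xs → w ≡ inj₁ x) →
      Visit Stop (φ F s) (first v q) w
    scan p [] eq none some = none refl
    scan p (x ∷ q) eq none some with present? x
    ... | yes t with some (filter-accept present? t)
    ... | refl = arrived t
    scan {v} p (x ∷ q) eq none some | no ¬t = pass ¬t (subst (λ c → Visit Stop (φ F s) c _)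
      (sym (trans (φ-absent ¬t) (σ-at reg p eq)))
      (scan (p ++ x ∷ []) q (trans eq (sym (++-assoc p (x ∷ []) q)))
        (none ∘ trans (filter-reject present? ¬t)) (some ∘ trans (filter-reject present? ¬t))))

    scan-none : ∀ {v} p q → rot F v ≡ p ++ q → filter present? q ≡ [] → first v q ~ inj₂ v
    scan-none p [] eq _ = eq-refl
    scan-none {v} p (x ∷ q) eq none with present? x
    ... | yes t = contradiction (trans (sym (filter-accept present? {xs = q} t)) none) λ ()
    ... | no ¬t = eq-trans (eq-gen (trans (φ-absent ¬t) (σ-at reg p eq)))
            (scan-none (p ++ x ∷ []) q (trans eq (sym (++-assoc p (x ∷ []) q)))
              (trans (sym (filter-reject present? ¬t)) none))

    all-absent : (∀ h → ¬ T (inS F s h)) → ∀ c → c ~ inj₂ (cornerAt F c)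
    all-absent none (inj₂ v) = eq-refl
    all-absent none (inj₁ h) with rot-split reg h
    ... | p , q , eq = scan-none p (h ∷ q) eq (filter-none present? (All.universal none (h ∷ q)))

    disc : ∀ {v h hs} → filter present? (rot F v) ≡ h ∷ hs → Visit Stop (φ F s) (inj₂ v) (inj₁ h)
    disc {v} eq = pass id (scan [] (rot F v) refl
      (λ none → contradiction (trans (sym eq) none) λ ())
      (λ some → cong inj₁ (proj₁ (∷-injective (trans (sym eq) some)))))

  -- `face` is the first-return map of `φ` to the present half-edges. After the crossing, the walk
  -- looks through the rest of the list and, if that fails, wraps around once at the marked corner;
  -- the half-edge just reached is itself present, so the search ends there at the latest.
  face-visit : ∀ {h} → T (inS F s h) → Visit Stop (φ F s) (φ F s (inj₁ h)) (inj₁ (face F s h))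
  face-visit {h@(e , b)} t with rot-split reg (e , not b)
  ... | p , q , eq = subst (λ c → Visit Stop (φ F s) c (inj₁ (face F s h)))
      (sym (trans (φ-present t) (σ-at reg p eq)))
      (scan (p ++ h' ∷ []) q (trans eq (sym (++-assoc p (h' ∷ []) q)))
        (λ none → subst (λ x → Visit Stop (φ F s) (inj₂ v) (inj₁ x)) (sym (face≡ none)) (disc' (filter present? p) refl))
        (λ some → cong inj₁ (trans faceEq (cong (λ l → headOr h' (l ++ filter present? p)) some))))
    where
    h' = e , not b
    v = end F e (not b)

    filtered : filter present? (rot F v) ≡ filter present? p ++ h' ∷ filter present? q
    filtered = trans (cong (filter present?) eq) (trans (filter-++ present? p (h' ∷ q))
      (cong (filter present? p ++_) (filter-accept present? t)))

    faceEq : face F s h ≡ headOr h' (filter present? q ++ filter present? p)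
    faceEq = trans (cong (λ l → succCyc l h') filtered) (succCyc-split h' (filter present? p) (filter present? q)
      (∉-split (filter present? p) (subst Unique filtered (Unique.filter⁺ present? (unique reg v)))))

    face≡ : filter present? q ≡ [] → face F s h ≡ headOr h' (filter present? p)
    face≡ none = trans faceEq (cong (λ l → headOr h' (l ++ filter present? p)) none)

    disc' : ∀ l → filter present? p ≡ l → Visit Stop (φ F s) (inj₂ v) (inj₁ (headOr h' l))
    disc' [] r = disc (trans filtered (cong (_++ h' ∷ filter present? q) r))
    disc' (x ∷ l) r = disc (trans filtered (cong (_++ h' ∷ filter present? q) r))

  face-present : ∀ {h} → T (inS F s h) → T (inS F s (face F s h))
  face-present t = target (face-visit t)
    where
    target : ∀ {c h} → Visit Stop (φ F s) c (inj₁ h) → T (inS F s h)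
    target (arrived t) = t
    target (pass _ v) = target v

  sameFace⇒~ : ∀ {h h'} → T (inS F s h) → T (sameFace F s h h') → inj₁ h ~ inj₁ h'
  sameFace⇒~ {h} {h'} th t with find (any⁻ _ (upTo (suc (2 *ℕ nE))) t)
  ... | k , _ , eq = subst (λ x → inj₁ h ~ inj₁ x) (eqHE⇒≡ eq) (proj₂ (go k))
    where
    go : ∀ k → T (inS F s (iter (face F s) k h)) × inj₁ h ~ inj₁ (iter (face F s) k h)
    go zero = th , eq-refl
    go (suc k) with go k
    ... | t , p = face-present t , eq-trans p (eq-trans (step-eq (φ F s) _) (Visit⇒eq (face-visit t)))

  private
    iter-walk : ∀ k h → Walk (Step (face F s)) k h (iter (face F s) k h)
    iter-walk zero h = []
    iter-walk (suc k) h = Walk-snoc (iter-walk k h) refl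

    walk-end : ∀ {m x y} → Walk (Step (face F s)) m x y → iter (face F s) m x ≡ y
    walk-end [] = refl
    walk-end (_∷_ {n = m} {x} refl w) = trans (iter-suc m x) (walk-end w)
      where
      iter-suc : ∀ m x → iter (face F s) (suc m) x ≡ iter (face F s) m (face F s x)
      iter-suc zero x = refl
      iter-suc (suc m) x = cong (face F s) (iter-suc m x)

    -- Half-edges have codes below `2 * nE`, so a walk of any length can be shortened into the range
    -- that `sameFace` searches.
    iter-face⇒sameFace : ∀ {h h'} k → iter (face F s) k h ≡ h' → T (sameFace F s h h')
    iter-face⇒sameFace {h} k refl = found (Walk-shorten codeHE codeHE-injective (iter-walk k h))
      where
      found : ∀ {h'} → (∃ λ m → m < 2 *ℕ nE × Walk (Step (face F s)) m h h') → T (sameFace F s h h')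
      found {h'} (m , m<2n , w) = any⁺ (λ t → eqHE (iter (face F s) t h) h') (lose (∈-upTo⁺ (m<n⇒m<1+n m<2n))
        (subst (λ x → T (eqHE x h')) (sym (walk-end w)) (eqHE-refl h')))

    φ-forward⇒sameFace : ∀ {h h'} → T (inS F s h) → T (inS F s h') →
      (∃ λ n → iter (φ F s) n (inj₁ h) ≡ inj₁ h') → T (sameFace F s h h')
    φ-forward⇒sameFace {h} {h'} th th' (n , q) =
      found (Visit-track {g = inj₁} {h = face F s} {P = T ∘ inS F s} id face-present face-visit th n)
      where
      found : (∃ λ k → T (inS F s (iter (face F s) k h)) × Visit Stop (φ F s) (iter (φ F s) n (inj₁ h)) (inj₁ (iter (face F s) k h))) →
        T (sameFace F s h h')
      found (k , _ , v) = iter-face⇒sameFace k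
        (Sum.inj₁-injective (Visit-deterministic (subst (λ c → Visit Stop (φ F s) c _) q v) (arrived th')))

  ~⇒sameFace : ∀ {h h'} → T (inS F s h) → T (inS F s h') → inj₁ h ~ inj₁ h' → T (sameFace F s h h')
  ~⇒sameFace th th' p = φ-forward⇒sameFace th th' (iter-forward Corner-finitary (φ-injective reg s) p)

  private
    isolated⇒absent : ∀ {v} → T (isolated F s v) → ∀ {h} → endOf F h ≡ v → ¬ T (inS F s h)
    isolated⇒absent {v} iso {h} refl t with any (inS F s) (rot F v) | any⁺ (inS F s) (lose (present reg h) t)
    ... | true | _ = iso

    stays : ∀ {v} → T (isolated F s v) → ∀ n → cornerAt F (iter (φ F s) n (inj₂ v)) ≡ v
    stays iso zero = refl
    stays {v} iso (suc n) with iter (φ F s) n (inj₂ v) | stays iso n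
    ... | inj₁ h | p = trans (cong (cornerAt F) (φ-absent (isolated⇒absent iso p))) (trans (cornerAt-σ reg (inj₁ h)) p)
    ... | inj₂ w | p = trans (cornerAt-σ reg (inj₂ w)) p

    -- Without a present ribbon at the disc there is nothing to cross, and the walk circles around
    -- the disc.
    isolated-orbit : ∀ {v c} → T (isolated F s v) → inj₂ v ~ c → cornerAt F c ≡ v
    isolated-orbit {v} iso p with iter-forward Corner-finitary (φ-injective reg s) p
    ... | n , refl = stays iso n

    faces : List (HE nE)
    faces = newReps (sameFace F s) [] (darts F s)

    isolatedDiscs : List (Fin nV)
    isolatedDiscs = filter (T? ∘ isolated F s) (allFin nV)

    count-isolated : ∀ vs → length (filter (T? ∘ isolated F s) vs) ≡ foldr (λ v n → (if isolated F s v then 1 else 0) +ℕ n) 0 vs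
    count-isolated [] = refl
    count-isolated (v ∷ vs) with isolated F s v
    ... | true = cong suc (count-isolated vs)
    ... | false = count-isolated vs

    ~-equiv : IsEquivalence (λ h h' → inj₁ h ~ inj₁ h')
    ~-equiv = On.isEquivalence inj₁ (Eqv.isEquivalence _)

    darts-present : All (T ∘ inS F s) (darts F s)
    darts-present = all-filter present? (allHE nE)

    dart∈ : ∀ {h} → T (inS F s h) → h ∈ darts F s
    dart∈ t = ∈-filter⁺ present? (∈-allHE _) t

    distinct : AllPairs (λ c c' → ¬ (c ~ c')) (map inj₁ faces ++ map inj₂ isolatedDiscs)
    distinct = AllPairs.++⁺
      (AllPairs.map⁺ (newReps-distinct {P = T ∘ inS F s} ~-equiv (λ t _ → sameFace⇒~ t) ~⇒sameFace [] darts-present))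
      (AllPairs.map⁺ (isos (all-filter (T? ∘ isolated F s) (allFin nV)) (Unique.filter⁺ (T? ∘ isolated F s) (Unique.allFin⁺ nV))))
      (All.map⁺ (All.map (λ t → All.map⁺ (All.map (λ iso p → isolated⇒absent iso (isolated-orbit iso (eq-sym p)) t)
         (all-filter (T? ∘ isolated F s) (allFin nV)))) (newReps-⊆ (sameFace F s) [] darts-present)))
      where
      isos : ∀ {vs} → All (T ∘ isolated F s) vs → Unique vs → AllPairs (λ v w → ¬ (inj₂ v ~ inj₂ w)) vs
      isos [] [] = []
      isos (iso ∷ is) (p ∷ u) = All.map (λ v≢w q → v≢w (sym (isolated-orbit iso q))) p ∷ isos is u

    face-rep : ∀ {h} → T (inS F s h) → Any (inj₁ h ~_) (map inj₁ faces ++ map inj₂ isolatedDiscs)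
    face-rep {h} t with newReps-complete {P = T ∘ inS F s} ~-equiv (λ t _ → sameFace⇒~ t) ~⇒sameFace [] darts-present (dart∈ t)
    ... | inj₂ p = Any.++⁺ˡ (Any.map⁺ p)

    disc-rep : ∀ v → Any (inj₂ v ~_) (map inj₁ faces ++ map inj₂ isolatedDiscs)
    disc-rep v with filter present? (rot F v) in eq
    ... | h ∷ hs = Any.map (eq-trans (Visit⇒eq (disc eq))) (face-rep (All.head (subst (All (T ∘ inS F s)) eq (all-filter present? (rot F v)))))
    ... | [] = Any.++⁺ʳ (map inj₁ faces) (Any.map⁺ (lose (∈-filter⁺ (T? ∘ isolated F s) (∈-allFin v) iso) eq-refl))
      where
      iso : T (isolated F s v)
      iso with any (inS F s) (rot F v) in eq'
      ... | false = _
      ... | true with find (any⁻ (inS F s) (rot F v) (subst T (sym eq') _))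
      ... | h , m , t with subst (h ∈_) eq (∈-filter⁺ present? m t)
      ... | ()

    complete : ∀ c → Any (c ~_) (map inj₁ faces ++ map inj₂ isolatedDiscs)
    complete (inj₂ v) = disc-rep v
    complete (inj₁ h) with present? h
    ... | yes t = face-rep t
    ... | no ¬t with rot-split reg h
    ... | p , q , eq with filter present? q in none
    ... | [] = Any.map (eq-trans (eq-trans (eq-gen (trans (φ-absent ¬t) (σ-at reg p eq)))
                 (scan-none (p ++ h ∷ []) q (trans eq (sym (++-assoc p (h ∷ []) q))) none))) (disc-rep _)
    ... | x ∷ xs = Any.map (eq-trans (eq-trans (eq-gen (trans (φ-absent ¬t) (σ-at reg p eq)))
                 (Visit⇒eq (scan (p ++ h ∷ []) q (trans eq (sym (++-assoc p (h ∷ []) q)))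
                    (λ r → contradiction (trans (sym none) r) λ ())
                    (λ r → cong inj₁ (proj₁ (∷-injective (trans (sym none) r))))))))
                 (face-rep (All.head (subst (All (T ∘ inS F s)) none (all-filter present? q))))

  -- The two summands of `bdSt` are two kinds of orbits: those through a present half-edge,
  -- represented by the chosen darts, and those which circle around an isolated disc, represented by
  -- its marked corner.
  bdSt-classes : Classes (Step (φ F s)) (Fin (bdSt F s))
  bdSt-classes = subst (λ n → Classes (Step (φ F s)) (Fin n)) count (Classes-transversal _ distinct complete)
    where
    count : length (map inj₁ faces ++ map inj₂ isolatedDiscs) ≡ bdSt F s
    count = trans (length-++ (map inj₁ faces)) (cong₂ _+ℕ_
      (trans (length-map inj₁ faces) (length-newReps (sameFace F s) [] (darts F s)))
      (trans (length-map inj₂ isolatedDiscs) (count-isolated (allFin nV))))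

  bdSt-empty-classes : (∀ h → ¬ T (inS F s h)) → Classes (Step (φ F s)) (Fin nV)
  bdSt-empty-classes none = record
    { cls = cornerAt F
    ; rep = inj₂
    ; cls-rep = λ _ → refl
    ; sound = λ { {inj₁ h} refl → sym (trans (cong (cornerAt F) (φ-absent (none h))) (cornerAt-σ reg (inj₁ h)))
                ; {inj₂ v} refl → sym (cornerAt-σ reg (inj₂ v)) }
    ; exact = λ {c} {c'} p → eq-trans (all-absent none c)
        (eq-trans (eq-reflexive (cong inj₂ p)) (eq-sym (all-absent none c'))) }

-- Adding an edge to a state

record AddEdge (s : State n) (e : Fin n) (s' : State n) : Set where
  field
    absent  : s e ≡ false
    added   : s' e ≡ true
    other   : ∀ {i} → i ≢ e → s' i ≡ s i

Adj-resp : (F : RG nV nE) {s s' : State nE} → (∀ e → s e ≡ s' e) → ∀ {u w} → Adj F s u w → Adj F s' u w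
Adj-resp F s≗s' (e , t , p , q) = e , subst T (s≗s' e) t , p , q

kSt-cong : (F : RG nV nE) {s s' : State nE} → (∀ e → s e ≡ s' e) → kSt F s ≡ kSt F s'
kSt-cong F {s} {s'} s≗s' = Classes-unique (kSt-classes F s)
  (Classes-change (eq-gen ∘ Adj-resp F s≗s') (eq-gen ∘ Adj-resp F (sym ∘ s≗s')) (kSt-classes F s'))

φ-cong : (F : RG nV nE) {s s' : State nE} → (∀ e → s e ≡ s' e) → ∀ c → φ F s c ≡ φ F s' c
φ-cong F s≗s' (inj₁ (e , b)) = cong (λ t → σ F (inj₁ (e , (if t then not b else b)))) (s≗s' e)
φ-cong F s≗s' (inj₂ v) = refl

bdSt-cong : {F : RG nV nE} → Regular F → {s s' : State nE} → (∀ e → s e ≡ s' e) → bdSt F s ≡ bdSt F s'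
bdSt-cong {F = F} reg {s} {s'} s≗s' = Classes-unique (Boundary.bdSt-classes reg s)
  (Classes-change (λ {c} p → eq-gen (trans (sym (φ-cong F s≗s' c)) p)) (λ {c} p → eq-gen (trans (φ-cong F s≗s' c) p))
    (Boundary.bdSt-classes reg s'))

φ-connected : {F : RG nV nE} → Regular F → (s : State nE) → ∀ {c c'} → EqClosure (Step (φ F s)) c c' →
  EqClosure (Adj F s) (cornerAt F c) (cornerAt F c')
φ-connected {F = F} reg s = eq-map (cornerAt F) (λ {c} {c'} → step {c} {c'})
  where
  crossing : ∀ h → EqClosure (Adj F s) (endOf F h) (endOf F (cross s h))
  crossing (e , b) with s e in eq
  crossing (e , b) | false = eq-refl
  crossing (e , false) | true = eq-gen (e , subst T (sym eq) _ , refl , refl)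
  crossing (e , true) | true = eq-sym (eq-gen (e , subst T (sym eq) _ , refl , refl))
  step : ∀ {c c'} → Step (φ F s) c c' → EqClosure (Adj F s) (cornerAt F c) (cornerAt F c')
  step {inj₁ h} refl = eq-trans (crossing h) (eq-reflexive (sym (cornerAt-σ reg (inj₁ (cross s h)))))
  step {inj₂ v} refl = eq-reflexive (sym (cornerAt-σ reg (inj₂ v)))

module EdgeAddition {F : RG nV nE} (reg : Regular F) {s s' : State nE} {e : Fin nE} (ae : AddEdge s e s') where
  open AddEdge ae

  Connected SameFace : Set
  Connected = EqClosure (Adj F s) (end F e false) (end F e true)
  SameFace = EqClosure (Step (φ F s)) (inj₁ (e , false)) (inj₁ (e , true))

  -- While `e` is absent both of its ends are passed by. Once it is present, the walk arriving at
  -- one end continues as it did at the other.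
  φ-swapped : Swapped (φ F s) (φ F s') (inj₁ (e , false)) (inj₁ (e , true))
  φ-swapped = record
    { at-x = trans (cong (λ t → σ F (inj₁ (e , (if t then true else false)))) added)
               (sym (cong (λ t → σ F (inj₁ (e , (if t then false else true)))) absent))
    ; at-y = trans (cong (λ t → σ F (inj₁ (e , (if t then false else true)))) added)
               (sym (cong (λ t → σ F (inj₁ (e , (if t then true else false)))) absent))
    ; else = λ { {inj₁ (i , b)} p q → cong (λ t → σ F (inj₁ (i , (if t then not b else b)))) (other λ { refl → neither b p q })
               ; {inj₂ v} p q → refl } }
    where
    neither : ∀ b → inj₁ (e , b) ≢ inj₁ (e , false) → ¬ (inj₁ (e , b) ≢ inj₁ (e , true))
    neither false p q = p refl
    neither true p q = q refl

  sides-separated : SameFace → ¬ EqClosure (Step (φ F s')) (inj₁ (e , false)) (inj₁ (e , true))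
  sides-separated = Transposition.separated Corner-finitary _≟C_ (φ-injective reg s) (φ-injective reg s') φ-swapped (λ ())

  bdSt-split : SameFace → bdSt F s' ≡ suc (bdSt F s)
  bdSt-split = transposition-splits Corner-finitary _≟C_ (φ-injective reg s) (φ-injective reg s') φ-swapped
    (Boundary.bdSt-classes reg s) (Boundary.bdSt-classes reg s') (λ ())

  bdSt-join : ¬ SameFace → bdSt F s ≡ suc (bdSt F s')
  bdSt-join = transposition-joins Corner-finitary _≟C_ (φ-injective reg s) (φ-injective reg s') φ-swapped
    (Boundary.bdSt-classes reg s) (Boundary.bdSt-classes reg s')

  private
    Adj-old : ∀ {u w} → Adj F s u w → Adj F s' u w
    Adj-old (i , t , p) with i ≟ e
    ... | yes refl = contradiction (subst T absent t) λ ()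
    ... | no i≢e = i , subst T (sym (other i≢e)) t , p

    Adj-new : ∀ {u w} → Adj F s' u w → Join (Adj F s) (end F e false) (end F e true) u w
    Adj-new (i , t , p , q) with i ≟ e
    Adj-new (i , t , refl , refl) | yes refl = new
    ... | no i≢e = old (i , subst T (other i≢e) t , p , q)

    edge : Adj F s' (end F e false) (end F e true)
    edge = e , subst T (sym added) _ , refl , refl

  kSt-join : ¬ Connected → kSt F s ≡ suc (kSt F s')
  kSt-join ¬c with Classes-join (kSt-classes F s) ¬c
  ... | m , p , C = trans p (cong suc (Classes-unique (Classes-change (eq-gen ∘ Adj-new)
        (λ { (old a) → eq-gen (Adj-old a) ; new → eq-gen edge }) C) (kSt-classes F s')))

  kSt-same : Connected → kSt F s' ≡ kSt F s
  kSt-same c = Classes-unique (kSt-classes F s') (Classes-change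
    (λ a → case-new (Adj-new a)) (eq-gen ∘ Adj-old) (kSt-classes F s))
    where
    case-new : ∀ {u w} → Join (Adj F s) (end F e false) (end F e true) u w → EqClosure (Adj F s) u w
    case-new (old a) = eq-gen a
    case-new new = c

  SameFace⇒Connected : SameFace → Connected
  SameFace⇒Connected = φ-connected reg s

  sameFace? : Dec SameFace
  sameFace? = Classes-dec (Boundary.bdSt-classes reg s) _ _

  connected? : Dec Connected
  connected? = Classes-dec (kSt-classes F s) _ _

-- Euler's formula and the genus of a state

edges : State n → ℕ
edges {zero} s = 0
edges {suc n} s = (if s zero then 1 else 0) +ℕ edges (s ∘ suc)

edges-cong : {s s' : State n} → (∀ e → s e ≡ s' e) → edges s ≡ edges s'
edges-cong {zero} p = refl
edges-cong {suc n} p = cong₂ (λ b k → (if b then 1 else 0) +ℕ k) (p zero) (edges-cong (p ∘ suc))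

edges-add : {s s' : State n} {e : Fin n} → AddEdge s e s' → edges s' ≡ suc (edges s)
edges-add {suc n} {s} {s'} {zero} ae = trans
  (cong₂ (λ b k → (if b then 1 else 0) +ℕ k) added (edges-cong {s = s' ∘ suc} {s ∘ suc} (λ i → other λ ())))
  (cong (λ b → suc ((if b then 1 else 0) +ℕ edges (s ∘ suc))) (sym absent))
  where open AddEdge ae
edges-add {suc n} {s} {s'} {suc e} ae = trans
  (cong₂ (λ b k → (if b then 1 else 0) +ℕ k) (other λ ())
    (edges-add {s = s ∘ suc} {s' ∘ suc} (record { absent = absent ; added = added ; other = λ p → other (p ∘ suc-inj) })))
  (+-suc _ (edges (s ∘ suc)))
  where
  open AddEdge ae
  suc-inj : ∀ {i} → Fin.suc i ≡ suc e → i ≡ e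
  suc-inj refl = refl

edges-none : (n : ℕ) → edges {n} (λ _ → false) ≡ 0
edges-none zero = refl
edges-none (suc n) = edges-none n

edges-all : (n : ℕ) → edges {n} allTrue ≡ n
edges-all zero = refl
edges-all (suc n) = cong suc (edges-all n)

-- Euler's formula: γ is the sum of the genera of the components of s.
Genus : (F : RG nV nE) → State nE → ℕ → Set
Genus {nV} F s γ = (nV +ℕ bdSt F s) +ℕ 2 *ℕ γ ≡ 2 *ℕ kSt F s +ℕ edges s

module _ {F : RG nV nE} (reg : Regular F) where

  Genus-empty : Genus F (λ _ → false) 0
  Genus-empty = trans (ℕ.+-identityʳ _) (trans (cong₂ _+ℕ_ nV≡k (trans bd≡nV nV≡k)) (sym (trans (cong (2 *ℕ k +ℕ_) (edges-none nE))
      (trans (ℕ.+-identityʳ (2 *ℕ k)) (cong (k +ℕ_) (ℕ.+-identityʳ k))))))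
    where
    k = kSt F (λ _ → false)
    bd≡nV : bdSt F (λ _ → false) ≡ nV
    bd≡nV = Classes-unique (Boundary.bdSt-classes reg _) (Boundary.bdSt-empty-classes reg _ (λ _ ()))
    nV≡k : nV ≡ kSt F (λ _ → false)
    nV≡k = Classes-unique discrete (kSt-classes F _)
      where
      discrete : Classes (Adj F (λ _ → false)) (Fin nV)
      discrete = record { cls = id ; rep = id ; cls-rep = λ _ → refl ; sound = λ { (_ , () , _) } ; exact = eq-reflexive }

  module _ {s s' : State nE} {e : Fin nE} (ae : AddEdge s e s') where
    open EdgeAddition reg ae

    Genus-same : SameFace → ∀ {γ} → Genus F s γ → Genus F s' γ
    Genus-same sf {γ} g = trans (cong (λ b → (nV +ℕ b) +ℕ 2 *ℕ γ) (bdSt-split sf))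
      (trans (cong (_+ℕ 2 *ℕ γ) (+-suc nV (bdSt F s))) (trans (cong suc g)
        (trans (sym (+-suc (2 *ℕ kSt F s) (edges s)))
          (cong₂ (λ k m → 2 *ℕ k +ℕ m) (sym (kSt-same (SameFace⇒Connected sf))) (sym (edges-add ae))))))

    private
      shift : ¬ SameFace → ∀ {γ} → Genus F s γ → suc ((nV +ℕ bdSt F s') +ℕ 2 *ℕ γ) ≡ 2 *ℕ kSt F s +ℕ edges s
      shift nf {γ} g = trans (cong (_+ℕ 2 *ℕ γ) (trans (sym (+-suc nV (bdSt F s'))) (cong (nV +ℕ_) (sym (bdSt-join nf))))) g

    -- Ends in different components lie on different faces, so components and boundary components
    -- both decrease by one; the new edge restores the balance.
    Genus-bridge : ¬ Connected → ∀ {γ} → Genus F s γ → Genus F s' γ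
    Genus-bridge nc {γ} g = suc-injective (trans (shift (nc ∘ SameFace⇒Connected) {γ} g)
      (trans (cong (λ k → 2 *ℕ k +ℕ edges s) (kSt-join nc))
        (trans (cong (_+ℕ edges s) (*-suc 2 (kSt F s')))
          (cong suc (trans (sym (+-suc (2 *ℕ kSt F s') (edges s))) (cong (2 *ℕ kSt F s' +ℕ_) (sym (edges-add ae))))))))

    -- One boundary component less and one edge more, with the components unchanged, leave a defect
    -- of 2, which is one unit of genus.
    Genus-handle : Connected → ¬ SameFace → ∀ {γ} → Genus F s γ → Genus F s' (suc γ)
    Genus-handle c nf {γ} g = trans (cong ((nV +ℕ bdSt F s') +ℕ_) (*-suc 2 γ))
      (trans (+-suc _ (suc (2 *ℕ γ))) (trans (cong suc (+-suc _ (2 *ℕ γ))) (trans (cong suc (shift nf {γ} g))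
        (trans (sym (+-suc (2 *ℕ kSt F s) (edges s)))
          (cong₂ (λ k m → 2 *ℕ k +ℕ m) (sym (kSt-same c)) (sym (edges-add ae)))))))

    Genus-step : ∀ {γ} → Genus F s γ → ∃ λ γ' → γ ≤ γ' × Genus F s' γ'
    Genus-step {γ} g = cases connected? sameFace?
      where
      cases : Dec Connected → Dec SameFace → ∃ λ γ' → γ ≤ γ' × Genus F s' γ'
      cases (no nc) _ = γ , ≤-refl , Genus-bridge nc {γ} g
      cases (yes _) (yes sf) = γ , ≤-refl , Genus-same sf {γ} g
      cases (yes c) (no nf) = suc γ , n≤1+n γ , Genus-handle c nf {γ} g

  Genus-cong : {s s' : State nE} → (∀ e → s e ≡ s' e) → ∀ {γ} → Genus F s γ → Genus F s' γ
  Genus-cong p {γ} g = trans (cong (λ b → (nV +ℕ b) +ℕ 2 *ℕ γ) (sym (bdSt-cong reg p)))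
    (trans g (cong₂ (λ k m → 2 *ℕ k +ℕ m) (kSt-cong F p) (edges-cong p)))

  Genus-unique : {s : State nE} → ∀ {γ γ'} → Genus F s γ → Genus F s γ' → γ ≡ γ'
  Genus-unique {s} g g' = *-cancelˡ-≡ _ _ 2 (+-cancelˡ-≡ (nV +ℕ bdSt F s) _ _ (trans g (sym g')))

insert : Fin n → State n → State n
insert e s i with i ≟ e
... | yes _ = true
... | no _ = s i

insert-add : {s : State n} {e : Fin n} → s e ≡ false → AddEdge s e (insert e s)
insert-add {s = s} {e} p = record { absent = p ; added = added ; other = other }
  where
  added : insert e s e ≡ true
  added with e ≟ e
  ... | yes _ = refl
  ... | no ¬q = contradiction refl ¬q
  other : ∀ {i} → i ≢ e → insert e s i ≡ s i
  other {i} i≢e with i ≟ e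
  ... | yes q = contradiction q i≢e
  ... | no _ = refl

-- The missing edges are added one at a time. The list in `go` contains every edge still missing, so
-- when it is empty the two states agree.
Genus-mono : {F : RG nV nE} → Regular F → {s s' : State nE} → (∀ e → T (s e) → T (s' e)) →
  ∀ {γ} → Genus F s γ → ∃ λ γ' → γ ≤ γ' × Genus F s' γ'
Genus-mono {nE = nE} {F = F} reg {s₀} {s'} sub₀ = go (allFin nE) sub₀ (λ e _ → inj₂ (∈-allFin e))
  where
  go : ∀ es {s} → (∀ e → T (s e) → T (s' e)) → (∀ e → T (s' e) → T (s e) ⊎ e ∈ es) →
    ∀ {γ} → Genus F s γ → ∃ λ γ' → γ ≤ γ' × Genus F s' γ'
  go [] {s} sub rest {γ} g = γ , ≤-refl , Genus-cong reg (λ e → T-injective (sub e) (λ t → none (rest e t))) {γ} g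
    where
    none : ∀ {e} → T (s e) ⊎ e ∈ [] → T (s e)
    none (inj₁ t) = t
  go (e ∷ es) {s} sub rest {γ} g with s e in eq | s' e in eq'
  ... | true | _ = go es sub rest' {γ} g
    where
    rest' : ∀ i → T (s' i) → T (s i) ⊎ i ∈ es
    rest' i t with rest i t
    ... | inj₁ t' = inj₁ t'
    ... | inj₂ (here refl) = inj₁ (subst T (sym eq) _)
    ... | inj₂ (there m) = inj₂ m
  ... | false | false = go es sub rest' {γ} g
    where
    rest' : ∀ i → T (s' i) → T (s i) ⊎ i ∈ es
    rest' i t with rest i t
    ... | inj₁ t' = inj₁ t'
    ... | inj₂ (here refl) = contradiction (subst T eq' t) id
    ... | inj₂ (there m) = inj₂ m
  ... | false | true = compose (Genus-step reg (insert-add eq) {γ} g)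
    where
    open AddEdge (insert-add {s = s} {e} eq)
    sub' : ∀ i → T (insert e s i) → T (s' i)
    sub' i t with i ≟ e
    ... | yes refl = subst T (sym eq') _
    ... | no _ = sub i t

    rest' : ∀ i → T (s' i) → T (insert e s i) ⊎ i ∈ es
    rest' i t with i ≟ e
    ... | yes _ = inj₁ _
    ... | no i≢e with rest i t
    ... | inj₁ t' = inj₁ t'
    ... | inj₂ (here q) = contradiction q i≢e
    ... | inj₂ (there m) = inj₂ m

    compose : (∃ λ γ' → _ ≤ γ' × Genus F (insert e s) γ') → ∃ λ γ' → _ ≤ γ' × Genus F s' γ'
    compose (γ' , le , g') with go es sub' rest' {γ'} g'
    ... | γ'' , le' , g'' = γ'' , ≤-trans le le' , g''

-- In a planar ribbon graph, an edge with connected ends never joins two faces: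
-- this would create a handle, which the remaining edges could not remove.
planar-sameFace : {F : RG nV nE} → Regular F → Planar F → {s s' : State nE} {e : Fin nE} → AddEdge s e s' →
  EqClosure (Adj F s) (end F e false) (end F e true) →
  EqClosure (Step (φ F s)) (inj₁ (e , false)) (inj₁ (e , true))
planar-sameFace {nV} {nE} {F} reg planar {s} {s'} {e} ae conn = cases (EdgeAddition.sameFace? reg ae)
  where
  open EdgeAddition reg ae

  full : Genus F allTrue 0
  full = trans (ℕ.+-identityʳ _) (trans planar (cong (2 *ℕ kSt F allTrue +ℕ_) (sym (edges-all nE))))

  no-handle : (∃ λ γ → 0 ≤ γ × Genus F s γ) → ¬ SameFace → ⊥
  no-handle (γ , _ , g) nf = impossible (Genus-mono reg {s'} {allTrue} (λ _ _ → _) {suc γ} (Genus-handle reg ae conn nf {γ} g))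
    where
    impossible : (∃ λ γ' → suc γ ≤ γ' × Genus F allTrue γ') → ⊥
    impossible (γ' , lt , g') = contradiction (subst (suc γ ≤_) (Genus-unique reg {allTrue} {γ'} {0} g' full) lt) λ ()

  cases : Dec SameFace → SameFace
  cases (yes sf) = sf
  -- `Genus` is a relation; that `s` has a genus at all follows by adding its edges to the empty
  -- state.
  cases (no nf) = ⊥-elim (no-handle (Genus-mono reg {λ _ → false} {s} (λ _ ()) {0} (Genus-empty reg)) nf)

-- Gluing quotients along pairs of points

sumFin : ∀ {n} → (Fin n → ℕ) → ℕ
sumFin {zero} f = 0
sumFin {suc n} f = f zero +ℕ sumFin (f ∘ suc)

sumFin-cong : ∀ {n} {f g : Fin n → ℕ} → (∀ i → f i ≡ g i) → sumFin f ≡ sumFin g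
sumFin-cong {zero} p = refl
sumFin-cong {suc n} p = cong₂ _+ℕ_ (p zero) (sumFin-cong (p ∘ suc))

sumFin-+ : ∀ {n} (f g : Fin n → ℕ) → sumFin f +ℕ sumFin g ≡ sumFin (λ i → f i +ℕ g i)
sumFin-+ {zero} f g = refl
sumFin-+ {suc n} f g = trans (+ℕ.interchange (f zero) _ (g zero) _) (cong (f zero +ℕ g zero +ℕ_) (sumFin-+ (f ∘ suc) (g ∘ suc)))

module _ where
  private
    peel : ∀ {n} {M : Fin (suc n) → ℕ} → Σ (Fin (suc n)) (Fin ∘ M) → Fin (M zero) ⊎ Σ (Fin n) (Fin ∘ M ∘ suc)
    peel (zero , i) = inj₁ i
    peel (suc e , i) = inj₂ (e , i)

    unpeel : ∀ {n} {M : Fin (suc n) → ℕ} → Fin (M zero) ⊎ Σ (Fin n) (Fin ∘ M ∘ suc) → Σ (Fin (suc n)) (Fin ∘ M)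
    unpeel (inj₁ i) = zero , i
    unpeel (inj₂ (e , i)) = suc e , i

    unpeel-peel : ∀ {n} {M : Fin (suc n) → ℕ} (x : Σ (Fin (suc n)) (Fin ∘ M)) → unpeel {M = M} (peel x) ≡ x
    unpeel-peel (zero , i) = refl
    unpeel-peel (suc e , i) = refl

    peel-unpeel : ∀ {n} {M : Fin (suc n) → ℕ} x → peel {M = M} (unpeel x) ≡ x
    peel-unpeel (inj₁ _) = refl
    peel-unpeel (inj₂ _) = refl

  Σ⇒sum : ∀ {n} (M : Fin n → ℕ) → Σ (Fin n) (Fin ∘ M) → Fin (sumFin M)
  Σ⇒sum {suc n} M x = join (M zero) _ (map-⊎ id (Σ⇒sum (M ∘ suc)) (peel x))

  sum⇒Σ : ∀ {n} (M : Fin n → ℕ) → Fin (sumFin M) → Σ (Fin n) (Fin ∘ M)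
  sum⇒Σ {suc n} M i = unpeel (map-⊎ id (sum⇒Σ (M ∘ suc)) (splitAt (M zero) i))

  sum⇒Σ⇒sum : ∀ {n} (M : Fin n → ℕ) i → Σ⇒sum M (sum⇒Σ M i) ≡ i
  sum⇒Σ⇒sum {suc n} M i = trans (cong (join (M zero) _ ∘ map-⊎ id (Σ⇒sum (M ∘ suc))) (peel-unpeel {M = M} (map-⊎ id (sum⇒Σ (M ∘ suc)) (splitAt (M zero) i))))
    (trans (cong (join (M zero) _) (cancel (splitAt (M zero) i))) (join-splitAt (M zero) _ i))
    where
    cancel : ∀ x → map-⊎ id (Σ⇒sum (M ∘ suc)) (map-⊎ id (sum⇒Σ (M ∘ suc)) x) ≡ x
    cancel (inj₁ _) = refl
    cancel (inj₂ j) = cong inj₂ (sum⇒Σ⇒sum (M ∘ suc) j)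

  Σ⇒sum⇒Σ : ∀ {n} (M : Fin n → ℕ) x → sum⇒Σ M (Σ⇒sum M x) ≡ x
  Σ⇒sum⇒Σ {suc n} M x = trans (cong (unpeel ∘ map-⊎ id (sum⇒Σ (M ∘ suc))) (splitAt-join (M zero) _ (map-⊎ id (Σ⇒sum (M ∘ suc)) (peel x))))
    (trans (cong unpeel (cancel (peel x))) (unpeel-peel x))
    where
    cancel : ∀ y → map-⊎ id (sum⇒Σ (M ∘ suc)) (map-⊎ id (Σ⇒sum (M ∘ suc)) y) ≡ y
    cancel (inj₁ _) = refl
    cancel (inj₂ y) = cong inj₂ (Σ⇒sum⇒Σ (M ∘ suc) y)

data Glue {Y : Set} {n : ℕ} {Z : Fin n → Set} (R : Rel Y 0ℓ) (S : ∀ e → Rel (Z e) 0ℓ)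
          (q : Fin n → Bool → Y) (p : ∀ e → Bool → Z e) : Rel (Y ⊎ Σ (Fin n) Z) 0ℓ where
  base : ∀ {y y'} → R y y' → Glue R S q p (inj₁ y) (inj₁ y')
  part : ∀ {e z z'} → S e z z' → Glue R S q p (inj₂ (e , z)) (inj₂ (e , z'))
  seam : ∀ e b → Glue R S q p (inj₁ (q e b)) (inj₂ (e , p e b))

-- Gluing p to q at both ends makes δ classes disappear.
data Attached {Y Z : Set} (R : Rel Y 0ℓ) (S : Rel Z 0ℓ) (q : Bool → Y) (p : Bool → Z) : ℕ → Set where
  once  : EqClosure S (p false) (p true) → EqClosure R (q false) (q true) → Attached R S q p 1
  twice : ¬ EqClosure S (p false) (p true) → Attached R S q p 2

-- The classes of S, those of p false and p true being set aside.
record Remaining {Y Z : Set} (R : Rel Y 0ℓ) {S : Rel Z 0ℓ} (q : Bool → Y) (p : Bool → Z) {M : ℕ}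
                 (C : Classes S (Fin M)) (M' : ℕ) : Set where
  field
    sort    : Fin M → Bool ⊎ Fin M'
    seam-at : ∀ b → ∃ λ b' → sort (cls C (p b)) ≡ inj₁ b' × EqClosure R (q b) (q b')
    left    : ∀ {k b} → sort k ≡ inj₁ b → k ≡ cls C (p b)
    back    : Fin M' → Fin M
    sort-back : ∀ i → sort (back i) ≡ inj₂ i
    right   : ∀ {k i} → sort k ≡ inj₂ i → k ≡ back i

private
  without : ∀ {n} → Fin (suc n) → Fin (suc n) → Bool ⊎ Fin n
  without i k with i ≟ k
  ... | yes _ = inj₁ false
  ... | no p = inj₂ (punchOut p)

  without-same : ∀ {n} (i : Fin (suc n)) → without i i ≡ inj₁ false
  without-same i with i ≟ i
  ... | yes _ = refl
  ... | no p = contradiction refl p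

  without-punchIn : ∀ {n} (i : Fin (suc n)) j → without i (punchIn i j) ≡ inj₂ j
  without-punchIn i j with i ≟ punchIn i j
  ... | yes p = contradiction (sym p) (punchInᵢ≢i i j)
  ... | no p = cong inj₂ (trans (punchOut-cong i refl) (punchOut-punchIn i))

  without-left : ∀ {n} {i k : Fin (suc n)} {b} → without i k ≡ inj₁ b → k ≡ i × b ≡ false
  without-left {i = i} {k} eq with i ≟ k
  without-left refl | yes refl = refl , refl

  without-right : ∀ {n} {i k : Fin (suc n)} {j} → without i k ≡ inj₂ j → k ≡ punchIn i j
  without-right {i = i} {k} eq with i ≟ k
  without-right refl | no p = sym (punchIn-punchOut p)

remaining : {Y Z : Set} {R : Rel Y 0ℓ} {S : Rel Z 0ℓ} {q : Bool → Y} {p : Bool → Z} {M δ : ℕ}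
  (C : Classes S (Fin M)) → Attached R S q p δ → ∃ λ M' → M' +ℕ δ ≡ M × Remaining R q p C M'
remaining {p = p} {M = zero} C _ with cls C (p false)
... | ()
remaining {R = R} {q = q} {p = p} {M = suc M'} C (once p~p q~q) = M' , ℕ.+-comm M' 1 , record
  { sort = without k₀
  ; seam-at = λ { false → false , without-same k₀ , eq-refl
                ; true → false , trans (cong (without k₀) (sym (sound* C p~p))) (without-same k₀) , eq-sym q~q }
  ; left = λ eq → left (without-left eq)
  ; back = punchIn k₀
  ; sort-back = without-punchIn k₀
  ; right = without-right }
  where
  k₀ = cls C (p false)
  left : ∀ {k b} → k ≡ k₀ × b ≡ false → k ≡ cls C (p b)
  left (refl , refl) = refl
remaining {p = p} {M = suc zero} C (twice p≁p) = contradiction (exact C (only _ _)) p≁p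
  where
  only : (i j : Fin 1) → i ≡ j
  only zero zero = refl
remaining {p = p} {M = suc (suc M')} C (twice p≁p) = M' , ℕ.+-comm M' 2 , record
  { sort = sort
  ; seam-at = λ { false → false , cong second (without-same k₀) , eq-refl
                ; true → true , trans (cong second k₁-sorted) (cong toggle (without-same j₁)) , eq-refl }
  ; left = λ {k} → left k
  ; back = punchIn k₀ ∘ punchIn j₁
  ; sort-back = λ i → trans (cong second (without-punchIn k₀ (punchIn j₁ i))) (cong toggle (without-punchIn j₁ i))
  ; right = λ {k} → right k }
  where
  k₀ k₁ : Fin (suc (suc M'))
  k₀ = cls C (p false)
  k₁ = cls C (p true)
  k₀≢k₁ : k₀ ≢ k₁
  k₀≢k₁ eq = p≁p (exact C eq)
  j₁ = punchOut k₀≢k₁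

  toggle : Bool ⊎ Fin M' → Bool ⊎ Fin M'
  toggle (inj₁ _) = inj₁ true
  toggle (inj₂ i) = inj₂ i

  second : Bool ⊎ Fin (suc M') → Bool ⊎ Fin M'
  second (inj₁ b) = inj₁ b
  second (inj₂ j) = toggle (without j₁ j)

  sort : Fin (suc (suc M')) → Bool ⊎ Fin M'
  sort k = second (without k₀ k)

  k₁-sorted : without k₀ k₁ ≡ inj₂ j₁
  k₁-sorted = trans (cong (without k₀) (sym (punchIn-punchOut k₀≢k₁))) (without-punchIn k₀ j₁)

  left : ∀ k {b} → sort k ≡ inj₁ b → k ≡ cls C (p b)
  left k eq with without k₀ k in eq₀
  left k eq | inj₁ b with without-left {i = k₀} eq₀
  left k refl | inj₁ b | refl , refl = refl
  left k eq | inj₂ j with without j₁ j in eq₁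
  left k refl | inj₂ j | inj₁ b = trans (without-right {i = k₀} eq₀)
    (trans (cong (punchIn k₀) (proj₁ (without-left {i = j₁} eq₁))) (punchIn-punchOut k₀≢k₁))

  right : ∀ k {i} → sort k ≡ inj₂ i → k ≡ punchIn k₀ (punchIn j₁ i)
  right k eq with without k₀ k in eq₀
  right k eq | inj₂ j with without j₁ j in eq₁
  right k refl | inj₂ j | inj₂ i = trans (without-right {i = k₀} eq₀) (cong (punchIn k₀) (without-right {i = j₁} eq₁))

module _ {Y : Set} {n : ℕ} {Z : Fin n → Set} {R : Rel Y 0ℓ} {S : ∀ e → Rel (Z e) 0ℓ}
         {q : Fin n → Bool → Y} {p : ∀ e → Bool → Z e} {N : ℕ} {M δ : Fin n → ℕ}
         (CY : Classes R (Fin N)) (CZ : ∀ e → Classes (S e) (Fin (M e)))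
         (att : ∀ e → Attached R (S e) (q e) (p e) (δ e)) where

  private
    M' : Fin n → ℕ
    M' e = proj₁ (remaining (CZ e) (att e))

    module Rem e = Remaining (proj₂ (proj₂ (remaining (CZ e) (att e))))

    ~base : ∀ {y y'} → EqClosure R y y' → EqClosure (Glue R S q p) (inj₁ y) (inj₁ y')
    ~base = eq-map inj₁ (eq-gen ∘ base)

    ~part : ∀ {e z z'} → EqClosure (S e) z z' → EqClosure (Glue R S q p) (inj₂ (e , z)) (inj₂ (e , z'))
    ~part {e} = eq-map (λ z → inj₂ (e , z)) (eq-gen ∘ part)

    place : ∀ e → Bool ⊎ Fin (M' e) → Fin N ⊎ Σ (Fin n) (Fin ∘ M')
    place e (inj₁ b) = inj₁ (cls CY (q e b))
    place e (inj₂ i) = inj₂ (e , i)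

    class : Y ⊎ Σ (Fin n) Z → Fin N ⊎ Σ (Fin n) (Fin ∘ M')
    class (inj₁ y) = inj₁ (cls CY y)
    class (inj₂ (e , z)) = place e (Rem.sort e (cls (CZ e) z))

    repr : Fin N ⊎ Σ (Fin n) (Fin ∘ M') → Y ⊎ Σ (Fin n) Z
    repr (inj₁ k) = inj₁ (rep CY k)
    repr (inj₂ (e , i)) = inj₂ (e , rep (CZ e) (Rem.back e i))

    class-repr : ∀ k → class (repr k) ≡ k
    class-repr (inj₁ k) = cong inj₁ (cls-rep CY k)
    class-repr (inj₂ (e , i)) = cong (place e) (trans (cong (Rem.sort e) (cls-rep (CZ e) _)) (Rem.sort-back e i))

    class-sound : ∀ {x y} → Glue R S q p x y → class x ≡ class y
    class-sound (base r) = cong inj₁ (sound CY r)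
    class-sound (part {e} r) = cong (place e ∘ Rem.sort e) (sound (CZ e) r)
    class-sound (seam e b) with Rem.seam-at e b
    ... | b' , eq , q~q = trans (cong inj₁ (sound* CY q~q)) (sym (cong (place e) eq))

    ~repr : ∀ x → EqClosure (Glue R S q p) x (repr (class x))
    ~repr (inj₁ y) = ~base (exact CY (sym (cls-rep CY _)))
    ~repr (inj₂ (e , z)) with Rem.sort e (cls (CZ e) z) in eq
    ... | inj₁ b = eq-trans (~part (exact (CZ e) (Rem.left e eq))) (eq-trans (eq-sym (eq-gen (seam e b)))
                     (~base (exact CY (sym (cls-rep CY _)))))
    ... | inj₂ i = ~part (exact (CZ e) (trans (Rem.right e eq) (sym (cls-rep (CZ e) _))))

  -- No seam merges two classes of the base: either the two ends of a part lie in different classes,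
  -- each absorbed by one class of the base, or they lie in one class and their partners in the base
  -- are already related. So the quotient consists of the base classes and, for each part, the
  -- classes that contain no end.
  Classes-glue : ∃ λ N' → N' +ℕ sumFin δ ≡ N +ℕ sumFin M × Classes (Glue R S q p) (Fin N')
  Classes-glue = N +ℕ sumFin M' ,
    trans (ℕ.+-assoc N _ _) (cong (N +ℕ_) (trans (sumFin-+ M' δ) (sumFin-cong (λ e → proj₁ (proj₂ (remaining (CZ e) (att e))))))) ,
    Classes-map enum denum denum-enum enum-denum record
      { cls = class ; rep = repr ; cls-rep = class-repr ; sound = class-sound
      ; exact = λ {x} {y} eq → eq-trans (~repr x) (eq-trans (eq-reflexive (cong repr eq)) (eq-sym (~repr y))) }
    where
    enum : Fin N ⊎ Σ (Fin n) (Fin ∘ M') → Fin (N +ℕ sumFin M')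
    enum x = join N _ (map-⊎ id (Σ⇒sum M') x)
    denum : Fin (N +ℕ sumFin M') → Fin N ⊎ Σ (Fin n) (Fin ∘ M')
    denum i = map-⊎ id (sum⇒Σ M') (splitAt N i)
    denum-enum : ∀ x → denum (enum x) ≡ x
    denum-enum (inj₁ k) = cong (map-⊎ id (sum⇒Σ M')) (splitAt-join N _ (inj₁ k))
    denum-enum (inj₂ x) = trans (cong (map-⊎ id (sum⇒Σ M')) (splitAt-join N _ (inj₂ (Σ⇒sum M' x)))) (cong inj₂ (Σ⇒sum⇒Σ M' x))
    enum-denum : ∀ i → enum (denum i) ≡ i
    enum-denum i = trans (cong (join N _) (cancel (splitAt N i))) (join-splitAt N _ i)
      where
      cancel : ∀ x → map-⊎ id (Σ⇒sum M') (map-⊎ id (sum⇒Σ M') x) ≡ x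
      cancel (inj₁ _) = refl
      cancel (inj₂ j) = cong inj₂ (sum⇒Σ⇒sum M' j)

-- Cyclic orders

CycEq-split : {L L' : List X} → CycEq L L' → ∃₂ λ a b → L ≡ a ++ b × L' ≡ b ++ a
CycEq-split {L = L} (k , eq) = take k L , drop k L , sym (take++drop≡id k L) , sym eq

CycEq⇒↭ : {L L' : List X} → CycEq L L' → L ↭ L'
CycEq⇒↭ c with CycEq-split c
... | a , b , refl , refl = ++-comm a b

drop-++ : (xs : List X) {ys : List X} → drop (length xs) (xs ++ ys) ≡ ys
drop-++ [] = refl
drop-++ (_ ∷ xs) = drop-++ xs

take-++ : (xs : List X) {ys : List X} → take (length xs) (xs ++ ys) ≡ xs
take-++ [] = refl
take-++ (x ∷ xs) = cong (x ∷_) (take-++ xs)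

-- Used to cut the cyclic orders open at other places, which moves the marked corners.
recut : (F : RG nV nE) → (Fin nV → List (HE nE)) → RG nV nE
recut F r = record { end = end F ; rot = r }

private
  succCyc-rotate : ∀ (a b : List (HE n)) {h} → h ∈ a → Unique (a ++ b) → Unique (b ++ a) → succCyc (a ++ b) h ≡ succCyc (b ++ a) h
  succCyc-rotate a b {h} h∈a u u' with ∈-∃++ h∈a
  ... | p , q , refl = trans (cong (λ l → succCyc l h) (++-assoc p (h ∷ q) b))
      (trans (succCyc-split h p (q ++ b) (∉-split p (subst Unique (++-assoc p (h ∷ q) b) u)))
        (trans (cong (headOr h) (++-assoc q b p))
          (trans (sym (succCyc-split h (b ++ p) q (∉-split (b ++ p) (subst Unique (sym (++-assoc b p (h ∷ q))) u'))))
            (cong (λ l → succCyc l h) (++-assoc b p (h ∷ q))))))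

  succCyc-CycEq : ∀ {L L' : List (HE n)} {h} → CycEq L L' → Unique L → h ∈ L → succCyc L h ≡ succCyc L' h
  succCyc-CycEq {h = h} c u m with CycEq-split c
  ... | a , b , refl , refl with ∈-++⁻ a m
  ... | inj₁ h∈a = succCyc-rotate a b h∈a u (Unique-resp-↭ (++-comm a b) u)
  ... | inj₂ h∈b = sym (succCyc-rotate b a h∈b (Unique-resp-↭ (++-comm a b) u) u)

  filter-CycEq : ∀ {p : X → Bool} {L L' : List X} → CycEq L L' → CycEq (filterᵇ p L) (filterᵇ p L')
  filter-CycEq {p = p} {L} (k , refl) = length (filterᵇ p (take k L)) ,
    trans (cong (λ l → drop (length x) l ++ take (length x) l) (trans (cong (filterᵇ p) (sym (take++drop≡id k L))) (filter-++ (T? ∘ p) (take k L) (drop k L))))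
      (trans (cong₂ _++_ (drop-++ x) (take-++ x)) (sym (filter-++ (T? ∘ p) (drop k L) (take k L))))
    where
    x = filterᵇ p (take k L)

  succCycAux-absent : ∀ (f h : HE n) L → h ∉ L → succCycAux f h L ≡ h
  succCycAux-absent f h [] _ = refl
  succCycAux-absent f h (x ∷ []) h∉L rewrite eqHE-≢ {h = x} {h} (λ eq → h∉L (here (sym eq))) = refl
  succCycAux-absent f h (x ∷ y ∷ L) h∉L = trans
    (cong (λ c → if c then y else succCycAux f h (y ∷ L)) (eqHE-≢ (λ eq → h∉L (here (sym eq)))))
    (succCycAux-absent f h (y ∷ L) (h∉L ∘ there))

  succCyc-absent : ∀ (h : HE n) L → h ∉ L → succCyc L h ≡ h
  succCyc-absent h [] _ = refl
  succCyc-absent h (x ∷ L) h∉L = succCycAux-absent x h (x ∷ L) h∉L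

  countNew-cong : {r r' : X → X → Bool} → (∀ x y → r x y ≡ r' x y) → ∀ prev xs → countNew r prev xs ≡ countNew r' prev xs
  countNew-cong p prev [] = refl
  countNew-cong p prev (x ∷ xs) = cong₂ (λ c m → (if c then 0 else 1) +ℕ m)
    (cong or (map-cong (λ y → p y x) prev)) (countNew-cong p (x ∷ prev) xs)

  any-↭ : ∀ (p : X → Bool) {xs ys} → xs ↭ ys → any p xs ≡ any p ys
  any-↭ p {xs} {ys} perm = T-injective
    (λ t → any⁺ p (Any-resp-↭ perm (any⁻ p xs t))) (λ t → any⁺ p (Any-resp-↭ (↭-sym perm) (any⁻ p ys t)))

module _ {F : RG nV nE} {r : Fin nV → List (HE nE)} (cyc : ∀ v → CycEq (rot F v) (r v)) where

  recut-regular : Regular F → Regular (recut F r)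
  recut-regular reg = record
    { present = λ h → ∈-resp-↭ (CycEq⇒↭ (cyc _)) (present reg h)
    ; owner = λ {v} m → owner reg (∈-resp-↭ (↭-sym (CycEq⇒↭ (cyc v))) m)
    ; unique = λ v → Unique-resp-↭ (CycEq⇒↭ (cyc v)) (unique reg v) }

  private
    F' = recut F r

  module _ (reg : Regular F) (s : State nE) where

    private
      face-recut : ∀ h → face F s h ≡ face F' s h
      face-recut (e , b) with T? (s e)
      ... | yes t = succCyc-CycEq (filter-CycEq (cyc v)) (Unique.filter⁺ (T? ∘ inS F s) (unique reg v))
                      (∈-filter⁺ (T? ∘ inS F s) (present reg (e , not b)) t)
        where v = end F e (not b)
      -- The comparison of the counts asks for equality at every half-edge. At an absent one,
      -- `succCyc` returns its argument for both lists.
      ... | no ¬t = trans (succCyc-absent (e , not b) (rotS F s v) (λ m → ¬t (proj₂ (∈-filter⁻ (T? ∘ inS F s) {xs = rot F v} m))))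
                (sym (succCyc-absent (e , not b) (rotS F' s v) (λ m → ¬t (proj₂ (∈-filter⁻ (T? ∘ inS F s) {xs = r v} m)))))
        where v = end F e (not b)

      iter-face-recut : ∀ k h → iter (face F s) k h ≡ iter (face F' s) k h
      iter-face-recut zero h = refl
      iter-face-recut (suc k) h = trans (face-recut _) (cong (face F' s) (iter-face-recut k h))

    -- The permutation `φ` does change with the marked corners, but `face` depends only on the
    -- cyclic orders, so the equality is read off from the definition of `bdSt` and not from orbits.
    bdSt-recut : bdSt F s ≡ bdSt F' s
    bdSt-recut = cong₂ _+ℕ_
      (countNew-cong (λ h h' → cong or (map-cong (λ k → cong (λ x → eqHE x h') (iter-face-recut k h)) (upTo (suc (2 *ℕ nE))))) [] (darts F s))
      (foldr-cong (λ v m → cong (λ c → (if not c then 1 else 0) +ℕ m) (any-↭ (inS F s) (CycEq⇒↭ (cyc v)))) refl (allFin nV))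

-- Removing one edge from cyclic orders and from states

afterAux-split : (h : HE n) (pre p q : List (HE n)) → h ∉ p → afterAux h pre (p ++ h ∷ q) ≡ q ++ pre ++ p
afterAux-split h pre [] q h∉p rewrite eqHE-same h = cong (q ++_) (sym (++-identityʳ pre))
afterAux-split h pre (x ∷ p) q h∉p = trans
  (cong (λ c → if c then (p ++ h ∷ q) ++ pre else afterAux h (pre ++ x ∷ []) (p ++ h ∷ q)) (eqHE-≢ (λ eq → h∉p (here (sym eq)))))
  (trans (afterAux-split h (pre ++ x ∷ []) p q (h∉p ∘ there)) (cong (q ++_) (++-assoc pre (x ∷ []) p)))

after-split : (h : HE n) (p q : List (HE n)) → h ∉ p → after h (p ++ h ∷ q) ≡ q ++ p
after-split h = afterAux-split h []

module _ (i : Fin (suc n)) where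

  lift : HE n → HE (suc n)
  lift (f , b) = punchIn i f , b

  lift-injective : ∀ {h h'} → lift h ≡ lift h' → h ≡ h'
  lift-injective {f , b} {f' , b'} eq = cong₂ _,_ (punchIn-injective i f f' (cong proj₁ eq)) (cong proj₂ eq)

  lift≢ : ∀ h {b} → lift h ≢ (i , b)
  lift≢ (f , _) eq = punchInᵢ≢i i f (cong proj₁ eq)

  lift-surjective : ∀ {f b} → i ≢ f → ∃ λ h → lift h ≡ (f , b)
  lift-surjective {b = b} i≢f = (punchOut i≢f , b) , cong (_, b) (punchIn-punchOut i≢f)

  map-lift-dropEdge : ∀ {L} → (∀ {h} → h ∈ L → i ≢ proj₁ h) → map lift (dropEdge i L) ≡ L
  map-lift-dropEdge {[]} _ = refl
  map-lift-dropEdge {(j , b) ∷ L} i∉L with i ≟ j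
  ... | yes p = contradiction p (i∉L (here refl))
  ... | no p = cong₂ _∷_ (cong (_, b) (punchIn-punchOut p)) (map-lift-dropEdge (i∉L ∘ there))

  dropEdge-++ : ∀ L L' → dropEdge i (L ++ L') ≡ dropEdge i L ++ dropEdge i L'
  dropEdge-++ [] L' = refl
  dropEdge-++ ((j , b) ∷ L) L' with i ≟ j
  ... | yes _ = dropEdge-++ L L'
  ... | no _ = cong (_ ∷_) (dropEdge-++ L L')

  dropEdge-self : ∀ b L → dropEdge i ((i , b) ∷ L) ≡ dropEdge i L
  dropEdge-self b L with i ≟ i
  ... | yes _ = refl
  ... | no p = contradiction refl p

  extend : Bool → State n → State (suc n)
  extend c t j with i ≟ j
  ... | yes _ = c
  ... | no p = t (punchOut p)

  extend-at : ∀ c t → extend c t i ≡ c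
  extend-at c t with i ≟ i
  ... | yes _ = refl
  ... | no p = contradiction refl p

  extend-punchIn : ∀ c t f → extend c t (punchIn i f) ≡ t f
  extend-punchIn c t f with i ≟ punchIn i f
  ... | yes p = contradiction (sym p) (punchInᵢ≢i i f)
  ... | no p = cong t (trans (punchOut-cong i refl) (punchOut-punchIn i))

  extend-add : ∀ t → AddEdge (extend false t) i (extend true t)
  extend-add t = record { absent = extend-at false t ; added = extend-at true t ; other = other }
    where
    other : ∀ {j} → j ≢ i → extend true t j ≡ extend false t j
    other {j} j≢i with i ≟ j
    ... | yes p = contradiction (sym p) j≢i
    ... | no _ = refl

  cross-lift : ∀ c t h → cross (extend c t) (lift h) ≡ lift (cross t h)
  cross-lift c t (f , b) = cong (λ x → punchIn i f , (if x then not b else b)) (extend-punchIn c t f)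

  cross-at : ∀ c t b → cross (extend c t) (i , b) ≡ (i , (if c then not b else b))
  cross-at c t b = cong (λ x → i , (if x then not b else b)) (extend-at c t)

-- Boundary walks of a 2-sum

∉-split-right : {h : X} (p : List X) {q : List X} → Unique (p ++ h ∷ q) → h ∉ q
∉-split-right [] (px ∷ u) m = All.lookup px m refl
∉-split-right (x ∷ p) (_ ∷ u) m = ∉-split-right p u m

module _ {F : RG (suc nV) (suc nE)} (reg : Regular F) (i : Fin (suc nE)) where

  edge-free : ∀ {v} → (∀ b → v ≢ end F i b) → map (lift i) (dropEdge i (rot F v)) ≡ rot F v
  edge-free v≢ = map-lift-dropEdge i λ { {_ , b} m refl → v≢ b (sym (owner reg m)) }

  record EndSplit (b : Bool) : Set where
    field
      before behind : List (HE nE)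
      rot-eq   : rot F (end F i b) ≡ map (lift i) before ++ (i , b) ∷ map (lift i) behind
      after-eq : dropEdge i (after (i , b) (rot F (end F i b))) ≡ behind ++ before

  -- As `i` is not a loop, its other end is not in this list, so everything on either side of
  -- `(i , b)` is a lifted half-edge.
  end-split : NonLoop F i → ∀ b → EndSplit b
  end-split nl b with rot-split reg (i , b)
  ... | p , q , eq = record
    { before = dropEdge i p
    ; behind = dropEdge i q
    ; rot-eq = trans eq (cong₂ (λ x y → x ++ (i , b) ∷ y) (sym (map-lift-dropEdge i (free p (∈-++⁺ˡ) (∉-split p u))))
                 (sym (map-lift-dropEdge i (free q (∈-++⁺ʳ p ∘ there) (∉-split-right p u)))))
    ; after-eq = trans (cong (dropEdge i ∘ after (i , b)) eq)
                   (trans (cong (dropEdge i) (after-split (i , b) p q (∉-split p u))) (dropEdge-++ i q p)) }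
    where
    u : Unique (p ++ (i , b) ∷ q)
    u = subst Unique eq (unique reg (end F i b))

    ends≢ : ∀ b b' → b ≢ b' → end F i b' ≢ end F i b
    ends≢ false false p _ = p refl
    ends≢ false true p eq = nl (sym eq)
    ends≢ true false p eq = nl eq
    ends≢ true true p _ = p refl

    free : ∀ l → (∀ {h} → h ∈ l → h ∈ p ++ (i , b) ∷ q) → (i , b) ∉ l → ∀ {h} → h ∈ l → i ≢ proj₁ h
    free l sub ∉l {_ , b'} m refl with b ≟B b'
    ... | yes refl = ∉l m
    ... | no b≢b' = ends≢ b b' b≢b' (owner reg (subst ((i , b') ∈_) (sym eq) (sub m)))

module TwoSumStates {G : RG nV nE} {Ĝ : RG nV̂ nÊ} {pA mA : Fin nE → ℕ}
  {A : (e : Fin nE) → RG (suc (pA e)) (suc (mA e))} {d : (e : Fin nE) → Fin (suc (mA e))}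
  (regG : Regular G) (regĜ : Regular Ĝ) (regA : ∀ e → Regular (A e)) (nl : ∀ e → NonLoop (A e) (d e))
  (vmap : (Fin nV ⊎ TwoSum.InnerV G Ĝ pA mA A d) ↔ Fin nV̂) (emap : TwoSum.EdgesH G Ĝ pA mA A d ↔ Fin nÊ)
  (ts : TwoSum.IsTwoSum G Ĝ pA mA A d vmap emap) where

  open TwoSum G Ĝ pA mA A d
  open IsTwoSum ts

  toV = Inverse.to vmap
  fromV = Inverse.from vmap
  toE = Inverse.to emap
  fromE = Inverse.from emap

  fromV-toV : ∀ x → fromV (toV x) ≡ x
  fromV-toV = Inverse.strictlyInverseʳ vmap

  toV-fromV : ∀ x → toV (fromV x) ≡ x
  toV-fromV = Inverse.strictlyInverseˡ vmap

  fromE-toE : ∀ x → fromE (toE x) ≡ x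
  fromE-toE = Inverse.strictlyInverseʳ emap

  toE-fromE : ∀ x → toE (fromE x) ≡ x
  toE-fromE = Inverse.strictlyInverseˡ emap

  module End e b = EndSplit (end-split (regA e) (d e) (nl e) b)

  liftA : ∀ e → HE (mA e) → HE (suc (mA e))
  liftA e = lift (d e)

  blockH : HE nE → List (HE nÊ)
  blockH h = block (proj₁ h) (proj₂ h)

  block-eq : ∀ e b → block e b ≡ map (ιE e) (End.behind e b) ++ map (ιE e) (End.before e b)
  block-eq e b = trans (cong (map (ιE e)) (End.after-eq e b)) (map-++ (ιE e) (End.behind e b) (End.before e b))

  rotAt : Fin nV ⊎ InnerV → List (HE nÊ)
  rotAt (inj₁ v) = concatMap blockH (rot G v)
  rotAt (inj₂ (e , v , _)) = map (ιE e) (dropEdge (d e) (rot (A e) v))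

  cyc : ∀ v̂ → CycEq (rot Ĝ v̂) (rotAt (fromV v̂))
  cyc v̂ = subst (λ x → CycEq (rot Ĝ x) (rotAt (fromV v̂))) (toV-fromV v̂) (at (fromV v̂))
    where
    at : ∀ x → CycEq (rot Ĝ (toV x)) (rotAt x)
    at (inj₁ v) = rotG v
    at (inj₂ (e , v , p)) = rotH e v p

  -- Each disc is cut open where the corresponding disc of `G` or of some `A e` is. Its list is then
  -- literally a concatenation of blocks, or the list of an inner disc, and marked corners
  -- correspond to marked corners.
  G̃ : RG nV̂ nÊ
  G̃ = recut Ĝ (rotAt ∘ fromV)

  regG̃ : Regular G̃
  regG̃ = recut-regular cyc regĜ

  rot-G̃ : ∀ x → rot G̃ (toV x) ≡ rotAt x
  rot-G̃ x = cong rotAt (fromV-toV x)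

  Inner-≢ : ∀ {e v} → Inner e v → ∀ b → v ≢ end (A e) (d e) b
  Inner-≢ (p , q) false = toWitnessFalse p
  Inner-≢ (p , q) true = toWitnessFalse q

  data VertexView e : Fin (suc (pA e)) → Set where
    outer : ∀ b → VertexView e (end (A e) (d e) b)
    inner : ∀ {v} → Inner e v → VertexView e v

  vertexView : ∀ e v → VertexView e v
  vertexView e v with v ≟ uA e | v ≟ wA e
  ... | yes refl | _ = outer false
  ... | no _ | yes refl = outer true
  ... | no p | no q = inner (fromWitnessFalse p , fromWitnessFalse q)

  assemble : (∀ e → State (mA e)) → State nÊ
  assemble t ê = t (proj₁ (fromE ê)) (proj₂ (fromE ê))

  assemble-toE : ∀ t e f → assemble t (toE (e , f)) ≡ t e f
  assemble-toE t e f = cong (λ x → t (proj₁ x) (proj₂ x)) (fromE-toE (e , f))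

  module Faces (t : ∀ e → State (mA e)) (s : State nE) where

    t⁺ : ∀ e → State (suc (mA e))
    t⁺ e = extend (d e) (s e) (t e)

    W : Set
    W = Corner nV nE ⊎ Σ (Fin nE) (λ e → Corner (suc (pA e)) (suc (mA e)))

    route : ∀ e (h : HE (suc (mA e))) → Dec (d e ≡ proj₁ h) → W
    route e (f , b) (yes _) = inj₁ (σ G (inj₁ (e , b)))
    route e h (no _) = inj₂ (e , φ (A e) (t⁺ e) (inj₁ h))

    -- The boundary walk on G and all the A_e, with the two sides of each
    -- half-edge (e , b) of G attached to those of (d e , b) in A_e.
    Ψ : W → W
    Ψ (inj₁ (inj₁ (e , b))) = inj₂ (e , σ (A e) (inj₁ (d e , b)))
    Ψ (inj₁ (inj₂ v)) = inj₁ (σ G (inj₂ v))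
    Ψ (inj₂ (e , inj₁ h)) = route e h (d e ≟ proj₁ h)
    Ψ (inj₂ (e , inj₂ v)) = inj₂ (e , σ (A e) (inj₂ v))

    Ψ-d : ∀ e b → Ψ (inj₂ (e , inj₁ (d e , b))) ≡ inj₁ (σ G (inj₁ (e , b)))
    Ψ-d e b = route-yes (d e ≟ d e)
      where
      route-yes : ∀ x → route e (d e , b) x ≡ inj₁ (σ G (inj₁ (e , b)))
      route-yes (yes _) = refl
      route-yes (no p) = contradiction refl p

    Ψ-other : ∀ e {f b} → d e ≢ f → Ψ (inj₂ (e , inj₁ (f , b))) ≡ inj₂ (e , φ (A e) (t⁺ e) (inj₁ (f , b)))
    Ψ-other e {f} {b} d≢f = route-no (d e ≟ f)
      where
      route-no : ∀ x → route e (f , b) x ≡ inj₂ (e , φ (A e) (t⁺ e) (inj₁ (f , b)))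
      route-no (yes p) = contradiction p d≢f
      route-no (no _) = refl

    Ψ-lift : ∀ e h → Ψ (inj₂ (e , inj₁ (liftA e h))) ≡ inj₂ (e , σ (A e) (inj₁ (liftA e (cross (t e) h))))
    Ψ-lift e h@(f , b) = trans (Ψ-other e (λ p → punchInᵢ≢i (d e) f (sym p)))
      (cong (λ x → inj₂ (e , σ (A e) (inj₁ x))) (cross-lift (d e) (s e) (t e) h))

    embedV : Fin nV ⊎ InnerV → W
    embedV (inj₁ v) = inj₁ (inj₂ v)
    embedV (inj₂ (e , v , _)) = inj₂ (e , inj₂ v)

    embed : Corner nV̂ nÊ → W
    embed (inj₁ (ê , b)) = inj₂ (proj₁ (fromE ê) , inj₁ (liftA (proj₁ (fromE ê)) (proj₂ (fromE ê) , b)))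
    embed (inj₂ v̂) = embedV (fromV v̂)

    embed-ι : ∀ e h → embed (inj₁ (ιE e h)) ≡ inj₂ (e , inj₁ (liftA e h))
    embed-ι e (f , b) = cong (λ x → inj₂ (proj₁ x , inj₁ (liftA (proj₁ x) (proj₂ x , b)))) (fromE-toE (e , f))

    embed-toV : ∀ x → embed (inj₂ (toV x)) ≡ embedV x
    embed-toV x = cong embedV (fromV-toV x)

    Stop : W → Set
    Stop w = ∃ λ x → embed x ≡ w

    at : ∀ {w} x → w ≡ embed x → Visit Stop Ψ w (embed x)
    at x refl = arrived (x , refl)

    -- An explicit condition met by all corners coming from `Ĝ`. It excludes the auxiliary ones: the
    -- half-edges of `G`, those of `d e`, and the marked corners at the two ends of `d e`.
    Seen : W → Set
    Seen (inj₁ (inj₁ _)) = ⊥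
    Seen (inj₁ (inj₂ _)) = ⊤
    Seen (inj₂ (e , inj₁ (f , _))) = d e ≢ f
    Seen (inj₂ (e , inj₂ v)) = Inner e v

    embedV-seen : ∀ x → Seen (embedV x)
    embedV-seen (inj₁ v) = tt
    embedV-seen (inj₂ (e , v , p)) = p

    embed-seen : ∀ x → Seen (embed x)
    embed-seen (inj₁ (ê , b)) p = punchInᵢ≢i (d (proj₁ (fromE ê))) (proj₂ (fromE ê)) (sym p)
    embed-seen (inj₂ v̂) = embedV-seen (fromV v̂)

    unseen : ∀ {w} → ¬ Seen w → ¬ Stop w
    unseen n (x , refl) = n (embed-seen x)

    through : ∀ {w w' y} → ¬ Seen w → Ψ w ≡ w' → Visit Stop Ψ w' y → Visit Stop Ψ w y
    through n refl v = pass (unseen n) v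

    -- Inside the block of `(e , b)` the walk `Ψ` runs through `behind`, the marked corner of `u`,
    -- then `before`, and leaves at `(d e , b)` for the rest `L` of the disc of `G`. This is the
    -- order in which the 2-sum lists the block. `ih` is the continuation after leaving.
    module Block (v : Fin nV) (e : Fin nE) (b : Bool) (L : List (HE nE)) (σG : σ G (inj₁ (e , b)) ≡ first v L)
      (ih : Visit Stop Ψ (inj₁ (first v L)) (embed (first (ιV v) (concatMap blockH L)))) where

      u = end (A e) (d e) b

      visit-before : ∀ p → Visit Stop Ψ (inj₂ (e , first u (map (liftA e) p ++ (d e , b) ∷ map (liftA e) (End.behind e b))))
        (embed (first (ιV v) (map (ιE e) p ++ concatMap blockH L)))
      visit-before [] = through (λ n → n refl) (trans (Ψ-d e b) (cong inj₁ σG)) ih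
      visit-before (h ∷ p) = at (inj₁ (ιE e h)) (sym (embed-ι e h))

      visit-behind : ∀ q → Visit Stop Ψ (inj₂ (e , first u (map (liftA e) q)))
        (embed (first (ιV v) (map (ιE e) q ++ map (ιE e) (End.before e b) ++ concatMap blockH L)))
      visit-behind [] = through (λ n → Inner-≢ n b refl) (cong (λ l → inj₂ (e , first u l)) (End.rot-eq e b)) (visit-before (End.before e b))
      visit-behind (h ∷ q) = at (inj₁ (ιE e h)) (sym (embed-ι e h))

    block-++ : ∀ e b L → concatMap blockH ((e , b) ∷ L) ≡ map (ιE e) (End.behind e b) ++ map (ιE e) (End.before e b) ++ concatMap blockH L
    block-++ e b L = trans (cong (_++ concatMap blockH L) (block-eq e b))
      (++-assoc (map (ιE e) (End.behind e b)) (map (ιE e) (End.before e b)) (concatMap blockH L))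

    -- Empty blocks are run through one after another. The marked corner of `v` belongs to `Ĝ` and
    -- stops the walk at the latest, so an induction on `L` suffices.
    visit-G : ∀ v p L → rot G v ≡ p ++ L → Visit Stop Ψ (inj₁ (first v L)) (embed (first (ιV v) (concatMap blockH L)))
    visit-G v p [] eq = at (inj₂ (ιV v)) (sym (embed-toV (inj₁ v)))
    visit-G v p ((e , b) ∷ L) eq = through id (cong (λ c → inj₂ (e , c)) (σ-at (regA e) (map (liftA e) (End.before e b)) (End.rot-eq e b)))
      (subst (λ l → Visit Stop Ψ _ (embed (first (ιV v) l))) (sym (block-++ e b L)) (Block.visit-behind v e b L (σ-at regG p eq)
        (visit-G v (p ++ (e , b) ∷ []) L (trans eq (sym (++-assoc p ((e , b) ∷ []) L)))) (End.behind e b)))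

    record AtG (e : Fin nE) (b : Bool) : Set where
      field
        pre post : List (HE nE)
        rot-eq : rot G (end G e b) ≡ pre ++ (e , b) ∷ post

      v = end G e b
      open Block v e b post (σ-at regG pre rot-eq)
        (visit-G v (pre ++ (e , b) ∷ []) post (trans rot-eq (sym (++-assoc pre ((e , b) ∷ []) post)))) public

      rot-G̃-eq : rot G̃ (ιV v) ≡ concatMap blockH pre ++ map (ιE e) (End.behind e b) ++ map (ιE e) (End.before e b) ++ concatMap blockH post
      rot-G̃-eq = trans (rot-G̃ (inj₁ v)) (trans (cong (concatMap blockH) rot-eq)
        (trans (concatMap-++ blockH pre ((e , b) ∷ post)) (cong (concatMap blockH pre ++_) (block-++ e b post))))

    atG : ∀ e b → AtG e b
    atG e b with rot-split regG (e , b)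
    ... | p , q , eq = record { pre = p ; post = q ; rot-eq = eq }

    private
      map-mid : ∀ {X Y : Set} (f : X → Y) (a : List X) {x b} {l : List X} → l ≡ a ++ x ∷ b → map f l ≡ map f a ++ f x ∷ map f b
      map-mid f a {x} {b} refl = map-++ f a (x ∷ b)

      mid : ∀ {X : Set} (a b : List X) {x c r} {l : List X} → l ≡ b ++ x ∷ c → a ++ l ++ r ≡ (a ++ b) ++ x ∷ c ++ r
      mid a b {x} {c} {r} refl = trans (cong (a ++_) (++-assoc b (x ∷ c) r)) (sym (++-assoc a b (x ∷ c ++ r)))

    visit-behind-dart : ∀ e b h → h ∈ End.behind e b →
      Visit Stop Ψ (inj₂ (e , σ (A e) (inj₁ (liftA e h)))) (embed (σ G̃ (inj₁ (ιE e h))))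
    visit-behind-dart e b h m with ∈-∃++ m
    ... | q₁ , q₂ , eq = subst₂ (λ c c' → Visit Stop Ψ (inj₂ (e , c)) (embed c'))
      (sym (σ-at (regA e) (map (liftA e) (End.before e b) ++ (d e , b) ∷ map (liftA e) q₁)
        (trans (End.rot-eq e b) (trans (cong (λ l → map (liftA e) (End.before e b) ++ (d e , b) ∷ l) (map-mid (liftA e) q₁ eq))
          (sym (++-assoc (map (liftA e) (End.before e b)) ((d e , b) ∷ map (liftA e) q₁) _))))))
      (sym (σ-at regG̃ (concatMap blockH (AtG.pre (atG e b)) ++ map (ιE e) q₁)
        (trans (AtG.rot-G̃-eq (atG e b)) (mid (concatMap blockH (AtG.pre (atG e b))) (map (ιE e) q₁) (map-mid (ιE e) q₁ eq)))))
      (AtG.visit-behind (atG e b) q₂)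

    visit-before-dart : ∀ e b h → h ∈ End.before e b →
      Visit Stop Ψ (inj₂ (e , σ (A e) (inj₁ (liftA e h)))) (embed (σ G̃ (inj₁ (ιE e h))))
    visit-before-dart e b h m with ∈-∃++ m
    ... | p₁ , p₂ , eq = subst₂ (λ c c' → Visit Stop Ψ (inj₂ (e , c)) (embed c'))
      (sym (σ-at (regA e) (map (liftA e) p₁) (trans (End.rot-eq e b) (mid [] (map (liftA e) p₁) (map-mid (liftA e) p₁ eq)))))
      (sym (σ-at regG̃ ((pre' ++ behind') ++ map (ιE e) p₁)
        (trans (AtG.rot-G̃-eq (atG e b)) (trans (sym (++-assoc pre' behind' _))
          (mid (pre' ++ behind') (map (ιE e) p₁) (map-mid (ιE e) p₁ eq))))))
      (AtG.visit-before (atG e b) p₂)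
      where
      pre' = concatMap blockH (AtG.pre (atG e b))
      behind' = map (ιE e) (End.behind e b)

    visit-inner : ∀ e v (i : Inner e v) hs →
      Visit Stop Ψ (inj₂ (e , first v (map (liftA e) hs))) (embed (first (toV (inj₂ (e , v , i))) (map (ιE e) hs)))
    visit-inner e v i [] = at (inj₂ (toV (inj₂ (e , v , i)))) (sym (embed-toV (inj₂ (e , v , i))))
    visit-inner e v i (h ∷ hs) = at (inj₁ (ιE e h)) (sym (embed-ι e h))

    private
      map-∈⁻ : ∀ e {h hs} → liftA e h ∈ map (liftA e) hs → h ∈ hs
      map-∈⁻ e {h} {hs} m with ∈-map⁻ (liftA e) m
      ... | h' , m' , eq = subst (_∈ hs) (sym (lift-injective (d e) eq)) m'

    visit-dart-at : ∀ e h v → liftA e h ∈ rot (A e) v → VertexView e v →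
      Visit Stop Ψ (inj₂ (e , σ (A e) (inj₁ (liftA e h)))) (embed (σ G̃ (inj₁ (ιE e h))))
    visit-dart-at e h _ m (outer b) with ∈-++⁻ (map (liftA e) (End.before e b)) (subst (liftA e h ∈_) (End.rot-eq e b) m)
    ... | inj₁ m' = visit-before-dart e b h (map-∈⁻ e m')
    ... | inj₂ (here eq) = contradiction eq (lift≢ (d e) h)
    ... | inj₂ (there m') = visit-behind-dart e b h (map-∈⁻ e m')
    visit-dart-at e h v m (inner i) with ∈-∃++ (map-∈⁻ e (subst (liftA e h ∈_) (sym (edge-free (regA e) (d e) (Inner-≢ i))) m))
    ... | p , q , eq = subst₂ (λ c c' → Visit Stop Ψ (inj₂ (e , c)) (embed c'))
      (sym (σ-at (regA e) (map (liftA e) p) (trans (sym (edge-free (regA e) (d e) (Inner-≢ i))) (map-mid (liftA e) p eq))))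
      (sym (σ-at regG̃ (map (ιE e) p) (trans (rot-G̃ (inj₂ (e , v , i))) (map-mid (ιE e) p eq))))
      (visit-inner e v i q)

    visit-dart : ∀ e h → Visit Stop Ψ (inj₂ (e , σ (A e) (inj₁ (liftA e h)))) (embed (σ G̃ (inj₁ (ιE e h))))
    visit-dart e h = visit-dart-at e h _ (present (regA e) (liftA e h)) (vertexView e _)

    visit-disc : ∀ x → Visit Stop Ψ (Ψ (embedV x)) (embed (first (toV x) (rotAt x)))
    visit-disc (inj₁ v) = visit-G v [] (rot G v) refl
    visit-disc (inj₂ (e , v , i)) = subst (λ l → Visit Stop Ψ (inj₂ (e , first v l)) (embed (first (toV (inj₂ (e , v , i))) (rotAt (inj₂ (e , v , i))))))
      (edge-free (regA e) (d e) (Inner-≢ i)) (visit-inner e v i (dropEdge (d e) (rot (A e) v)))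

    -- Between two consecutive corners of `Ĝ` the walk `Ψ` meets only auxiliary corners, so the
    -- boundary walk of `Ĝ` is its first-return map.
    visit : ∀ x → Visit Stop Ψ (Ψ (embed x)) (embed (φ G̃ (assemble t) x))
    visit (inj₂ v̂) = subst (λ x → Visit Stop Ψ (Ψ (embedV (fromV v̂))) (embed (first x (rotAt (fromV v̂))))) (toV-fromV v̂) (visit-disc (fromV v̂))
    visit (inj₁ (ê , b)) = subst₂ (Visit Stop Ψ) (sym (Ψ-lift e (f , b)))
      (cong (λ x → embed (σ G̃ (inj₁ (x , proj₂ (cross (t e) (f , b)))))) (toE-fromE ê)) (visit-dart e (cross (t e) (f , b)))
      where
      e = proj₁ (fromE ê)
      f = proj₂ (fromE ê)

    essential : ∀ w → ∃ λ x → Visit Stop Ψ w (embed x)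
    essential (inj₁ (inj₁ (e , b))) with rot-split regG (e , b)
    ... | p , q , eq = first (ιV (end G e b)) (concatMap blockH ((e , b) ∷ q)) , visit-G (end G e b) p ((e , b) ∷ q) eq
    essential (inj₁ (inj₂ v)) = inj₂ (ιV v) , visit-G v (rot G v) [] (sym (++-identityʳ (rot G v)))
    essential (inj₂ (e , inj₁ (f , b))) with d e ≟ f
    ... | yes refl = first (ιV (end G e b)) (concatMap blockH (AtG.post (atG e b))) , AtG.visit-before (atG e b) []
    ... | no p with lift-surjective (d e) {b = b} p
    ... | h , refl = inj₁ (ιE e h) , at (inj₁ (ιE e h)) (sym (embed-ι e h))
    essential (inj₂ (e , inj₂ v)) with vertexView e v
    ... | outer b = first (ιV (end G e b)) (map (ιE e) (End.before e b) ++ concatMap blockH (AtG.post (atG e b))) , AtG.visit-behind (atG e b) []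
    ... | inner i = inj₂ (toV (inj₂ (e , v , i))) , visit-inner e v i []

    kind : W → Bool
    kind (inj₁ _) = false
    kind (inj₂ (_ , inj₁ _)) = true
    kind (inj₂ (_ , inj₂ _)) = false

    kind-embedV : ∀ x → kind (embedV x) ≡ false
    kind-embedV (inj₁ _) = refl
    kind-embedV (inj₂ _) = refl

    private
      dart-injective : ∀ {x y : EdgesH} {b b'} →
        _≡_ {A = W} (inj₂ (proj₁ x , inj₁ (liftA (proj₁ x) (proj₂ x , b)))) (inj₂ (proj₁ y , inj₁ (liftA (proj₁ y) (proj₂ y , b')))) →
        x ≡ y × b ≡ b'
      dart-injective {e , f} {e' , f'} eq with Sum.inj₂-injective eq
      ... | p with cong proj₁ p
      ... | refl with lift-injective (d e) (Sum.inj₁-injective (,-injectiveʳ p))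
      ... | refl = refl , refl

      embedV-injective : ∀ {x y} → embedV x ≡ embedV y → x ≡ y
      embedV-injective {inj₁ v} {inj₁ .v} refl = refl
      embedV-injective {inj₂ (e , v , p , q)} {inj₂ (_ , _ , p' , q')} refl =
        cong₂ (λ p q → inj₂ (e , v , p , q)) (T-irrelevant p p') (T-irrelevant q q')

    embed-injective : ∀ {x y} → embed x ≡ embed y → x ≡ y
    embed-injective {inj₁ (ê , b)} {inj₁ (ê' , b')} eq with dart-injective {fromE ê} {fromE ê'} eq
    ... | p , refl = cong (λ x → inj₁ (x , b)) (trans (sym (toE-fromE ê)) (trans (cong toE p) (toE-fromE ê')))
    embed-injective {inj₁ _} {inj₂ v̂} eq = contradiction (trans (cong kind eq) (kind-embedV (fromV v̂))) λ ()
    embed-injective {inj₂ v̂} {inj₁ _} eq = contradiction (trans (cong kind (sym eq)) (kind-embedV (fromV v̂))) λ ()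
    embed-injective {inj₂ v̂} {inj₂ v̂'} eq = cong inj₂ (trans (sym (toV-fromV v̂)) (trans (cong toV (embedV-injective eq)) (toV-fromV v̂')))

    Classes-Ψ : {K : Set} → Classes (Step Ψ) K → Classes (Step (φ G̃ (assemble t))) K
    Classes-Ψ = Classes-firstReturn embed-injective visit essential

-- Components and boundary components of a 2-sum

connects : RG nV (suc nE) → Fin (suc nE) → State nE → Bool
connects F i t = reach F (extend i false t) (end F i false) (end F i true)

drops : Bool → ℕ
drops c = if c then 1 else 2

module _ {nV} {F : RG nV (suc nE)} (reg : Regular F) (planar : Planar F) (i : Fin (suc nE)) (t : State nE) where

  private
    t⁻ = extend i false t
    c = connects F i t

    sameFace-connects : T c → EqClosure (Step (φ F t⁻)) (inj₁ (i , false)) (inj₁ (i , true))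
    sameFace-connects r = planar-sameFace reg planar (extend-add i t) (reach⇒Adj F t⁻ r)

  -- By planarity, adding i to the state exactly when its ends are already
  -- connected separates the faces on its two sides.
  sides-separated : ¬ EqClosure (Step (φ F (extend i c t))) (inj₁ (i , false)) (inj₁ (i , true))
  sides-separated = at c refl
    where
    at : ∀ b → connects F i t ≡ b → ¬ EqClosure (Step (φ F (extend i b t))) (inj₁ (i , false)) (inj₁ (i , true))
    at true eq = EdgeAddition.sides-separated reg (extend-add i t) (sameFace-connects (subst T (sym eq) _))
    at false eq p = subst T eq (Adj⇒reach F t⁻ (φ-connected reg t⁻ p))

  -- In the connecting case the edge splits a boundary component, and the gain of one makes up for
  -- `drops` being 1 instead of 2.
  bdSt-extend : bdSt F (extend i c t) +ℕ drops c ≡ bdSt F t⁻ +ℕ 2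
  bdSt-extend = at c refl
    where
    at : ∀ b → connects F i t ≡ b → bdSt F (extend i b t) +ℕ drops b ≡ bdSt F t⁻ +ℕ 2
    at false eq = refl
    at true eq = trans (cong (_+ℕ 1) (EdgeAddition.bdSt-split reg (extend-add i t) (sameFace-connects (subst T (sym eq) _))))
      (trans (cong suc (ℕ.+-comm (bdSt F t⁻) 1)) (ℕ.+-comm 2 (bdSt F t⁻)))

module TwoSumCount {G : RG nV nE} {Ĝ : RG nV̂ nÊ} {pA mA : Fin nE → ℕ}
  {A : (e : Fin nE) → RG (suc (pA e)) (suc (mA e))} {d : (e : Fin nE) → Fin (suc (mA e))}
  (regG : Regular G) (regĜ : Regular Ĝ) (regA : ∀ e → Regular (A e)) (nl : ∀ e → NonLoop (A e) (d e))
  (vmap : (Fin nV ⊎ TwoSum.InnerV G Ĝ pA mA A d) ↔ Fin nV̂) (emap : TwoSum.EdgesH G Ĝ pA mA A d ↔ Fin nÊ)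
  (ts : TwoSum.IsTwoSum G Ĝ pA mA A d vmap emap) (t : ∀ e → State (mA e))
  (s : State nE) (s≡connects : ∀ e → s e ≡ connects (A e) (d e) (t e)) where

  open TwoSum G Ĝ pA mA A d
  open IsTwoSum ts
  open TwoSumStates regG regĜ regA nl vmap emap ts

  module FaceCount (planar : ∀ e → Planar (A e)) where
    open Faces t s

    flip : Fin nE → Bool → Bool
    flip e b = if s e then not b else b

    flip-flip : ∀ e b → flip e (flip e b) ≡ b
    flip-flip e b = cong proj₂ (cross-involutive s (e , b))

    -- With this twist `Ψ` sends `(e , b)` where the walk of `A e` sends `side e b`, and `side e b`
    -- where the walk of `G` sends `(e , b)`. Thus `Ψ` is the disjoint union of the walks,
    -- multiplied by the transpositions of `(e , b)` and `side e b`.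
    side : ∀ e → Bool → Corner (suc (pA e)) (suc (mA e))
    side e b = inj₁ (d e , flip e b)

    Seamed : Rel W 0ℓ
    Seamed = Glue (Step (φ G s)) (λ e → Step (φ (A e) (t⁺ e))) (λ e b → inj₁ (e , b)) side

    φ-d : ∀ e b → φ (A e) (t⁺ e) (inj₁ (d e , b)) ≡ σ (A e) (inj₁ (d e , flip e b))
    φ-d e b = cong (λ h → σ (A e) (inj₁ h)) (cross-at (d e) (s e) (t e) b)

    φ-side : ∀ e b → φ (A e) (t⁺ e) (side e b) ≡ σ (A e) (inj₁ (d e , b))
    φ-side e b = trans (φ-d e (flip e b)) (cong (λ b' → σ (A e) (inj₁ (d e , b'))) (flip-flip e b))

    sides-separated⁺ : ∀ e → ¬ EqClosure (Step (φ (A e) (t⁺ e))) (inj₁ (d e , false)) (inj₁ (d e , true))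
    sides-separated⁺ e = subst (λ c → ¬ EqClosure (Step (φ (A e) (extend (d e) c (t e)))) (inj₁ (d e , false)) (inj₁ (d e , true)))
      (sym (s≡connects e)) (sides-separated (regA e) (planar e) (d e) (t e))

    sides-≁ : ∀ e b b' → b ≢ b' → ¬ EqClosure (Step (φ (A e) (t⁺ e))) (inj₁ (d e , b)) (inj₁ (d e , b'))
    sides-≁ e false false p _ = p refl
    sides-≁ e false true p r = sides-separated⁺ e r
    sides-≁ e true false p r = sides-separated⁺ e (eq-sym r)
    sides-≁ e true true p _ = p refl

    Ψ⇒Seamed : ∀ {w w'} → Step Ψ w w' → EqClosure Seamed w w'
    Ψ⇒Seamed {inj₁ (inj₁ (e , b))} refl = eq-trans (eq-gen (seam e b)) (eq-gen (part (φ-side e b)))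
    Ψ⇒Seamed {inj₁ (inj₂ v)} refl = eq-gen (base refl)
    Ψ⇒Seamed {inj₂ (e , inj₂ v)} refl = eq-gen (part refl)
    Ψ⇒Seamed {inj₂ (e , inj₁ h)} refl = routed e h (d e ≟ proj₁ h)
      where
      routed : ∀ e h x → EqClosure Seamed (inj₂ (e , inj₁ h)) (route e h x)
      routed e h (no _) = eq-gen (part refl)
      routed e (_ , b) (yes refl) = eq-trans
        (eq-reflexive (cong (λ b' → inj₂ (e , inj₁ (d e , b'))) (sym (flip-flip e b))))
        (eq-trans (eq-sym (eq-gen (seam e (flip e b))))
          (eq-gen (base (cong (λ b' → σ G (inj₁ (e , b'))) (flip-flip e b)))))

    -- Planarity enters here. From `(e , b)` the walk `Ψ` follows the orbit of `side e b` in `A e`.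
    -- It could leave this orbit early only at the other side of `d e`, which lies on a different
    -- orbit.
    seam-Ψ : ∀ e b → EqClosure (Step Ψ) (inj₁ (inj₁ (e , b))) (inj₂ (e , side e b))
    seam-Ψ e b = eq-trans (eq-gen (cong (λ c → inj₂ (e , c)) (sym (φ-side e b))))
      (orbit-closes Corner-finitary (φ-injective (regA e) (t⁺ e)) (λ c → inj₂ (e , c)) Ψ (side e b) agree)
      where
      agree : ∀ z → EqClosure (Step (φ (A e) (t⁺ e))) (side e b) z → z ≡ side e b ⊎ Ψ (inj₂ (e , z)) ≡ inj₂ (e , φ (A e) (t⁺ e) z)
      agree (inj₂ v) _ = inj₂ refl
      agree (inj₁ (f , c)) r = dart (d e ≟ f) (flip e b ≟B c) r
        where
        dart : ∀ {f c} → Dec (d e ≡ f) → Dec (flip e b ≡ c) → EqClosure (Step (φ (A e) (t⁺ e))) (side e b) (inj₁ (f , c)) →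
          inj₁ (f , c) ≡ side e b ⊎ Ψ (inj₂ (e , inj₁ (f , c))) ≡ inj₂ (e , φ (A e) (t⁺ e) (inj₁ (f , c)))
        dart (no p) _ _ = inj₂ (Ψ-other e p)
        dart (yes refl) (yes refl) _ = inj₁ refl
        dart (yes refl) (no p) r = contradiction r (sides-≁ e _ _ p)

    Seamed⇒Ψ : ∀ {w w'} → Seamed w w' → EqClosure (Step Ψ) w w'
    Seamed⇒Ψ (seam e b) = seam-Ψ e b
    Seamed⇒Ψ (base {inj₂ v} refl) = eq-gen refl
    Seamed⇒Ψ (base {inj₁ (e , b)} refl) = eq-trans (seam-Ψ e b) (eq-gen (Ψ-d e (flip e b)))
    Seamed⇒Ψ (part {e} {inj₂ v} refl) = eq-gen refl
    Seamed⇒Ψ (part {e} {inj₁ (f , b)} refl) = dart (d e ≟ f)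
      where
      dart : ∀ {f} → Dec (d e ≡ f) → EqClosure (Step Ψ) (inj₂ (e , inj₁ (f , b))) (inj₂ (e , φ (A e) (t⁺ e) (inj₁ (f , b))))
      dart (no p) = eq-gen (Ψ-other e p)
      dart (yes refl) = eq-trans (eq-trans (eq-reflexive (cong (λ b' → inj₂ (e , inj₁ (d e , b'))) (sym (flip-flip e b))))
        (eq-sym (seam-Ψ e (flip e b)))) (eq-gen (cong (λ c → inj₂ (e , c)) (sym (φ-d e b))))

    -- For boundary components the loss is 2 for every `e`. The dependence on `s e` appears only
    -- when `t⁺` is replaced by the state without `d e`.
    attached : ∀ e → Attached (Step (φ G s)) (Step (φ (A e) (t⁺ e))) (λ b → inj₁ (e , b)) (side e) 2
    attached e = twice (sides-≁ e _ _ λ p → contradiction (trans (sym (flip-flip e false)) (trans (cong (flip e) p) (flip-flip e true))) λ ())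

    bdSt-Ĝ : bdSt Ĝ (assemble t) +ℕ sumFin (λ e → drops (s e)) ≡ bdSt G s +ℕ sumFin (λ e → bdSt (A e) (extend (d e) false (t e)))
    bdSt-Ĝ = finish (Classes-glue (Boundary.bdSt-classes regG s) (λ e → Boundary.bdSt-classes (regA e) (t⁺ e)) attached)
      where
      δ = λ e → drops (s e)
      bd⁺ = λ e → bdSt (A e) (t⁺ e)
      bd⁻ = λ e → bdSt (A e) (extend (d e) false (t e))
      twos = λ (_ : Fin nE) → 2

      finish : (∃ λ N → N +ℕ sumFin twos ≡ bdSt G s +ℕ sumFin bd⁺ × Classes Seamed (Fin N)) →
        bdSt Ĝ (assemble t) +ℕ sumFin δ ≡ bdSt G s +ℕ sumFin bd⁻
      finish (N , eq , C) = trans (cong (_+ℕ sumFin δ) bd≡N)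
        -- Gluing gives the count with 2 for each edge and `bd⁺`; adding `δ` and applying
        -- `bdSt-extend` for every `e` trades `bd⁺` for `bd⁻`, after which the twos cancel.
        (+-cancelʳ-≡ (sumFin twos) _ _ (trans (exchange N (sumFin δ) (sumFin twos)) (trans (cong (_+ℕ sumFin δ) eq)
          (trans (ℕ.+-assoc (bdSt G s) _ _) (trans (cong (bdSt G s +ℕ_) sums) (sym (ℕ.+-assoc (bdSt G s) _ _)))))))
        where
        bd≡N : bdSt Ĝ (assemble t) ≡ N
        bd≡N = trans (bdSt-recut cyc regĜ (assemble t)) (Classes-unique (Boundary.bdSt-classes regG̃ (assemble t))
          (Classes-Ψ (Classes-change Ψ⇒Seamed Seamed⇒Ψ C)))

        exchange : ∀ a b c → a +ℕ b +ℕ c ≡ a +ℕ c +ℕ b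
        exchange a b c = trans (ℕ.+-assoc a b c) (trans (cong (a +ℕ_) (ℕ.+-comm b c)) (sym (ℕ.+-assoc a c b)))

        sums : sumFin bd⁺ +ℕ sumFin δ ≡ sumFin bd⁻ +ℕ sumFin twos
        sums = trans (sumFin-+ bd⁺ δ) (trans (sumFin-cong local) (sym (sumFin-+ bd⁻ twos)))
          where
          local : ∀ e → bd⁺ e +ℕ δ e ≡ bd⁻ e +ℕ 2
          local e = subst (λ c → bdSt (A e) (extend (d e) c (t e)) +ℕ drops c ≡ bd⁻ e +ℕ 2) (sym (s≡connects e))
            (bdSt-extend (regA e) (planar e) (d e) (t e))

  module ComponentCount where

    ŝ = assemble t

    t⁻ : ∀ e → State (suc (mA e))
    t⁻ e = extend (d e) false (t e)

    U : Set
    U = Fin nV ⊎ Σ (Fin nE) (λ e → Fin (suc (pA e)))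

    Seamed : Rel U 0ℓ
    Seamed = Glue (Adj G s) (λ e → Adj (A e) (t⁻ e)) (λ e b → end G e b) (λ e b → end (A e) (d e) b)

    embedV : Fin nV ⊎ InnerV → U
    embedV (inj₁ v) = inj₁ v
    embedV (inj₂ (e , v , _)) = inj₂ (e , v)

    viewed : ∀ {e v} → VertexView e v → Fin nV̂
    viewed {e} (outer b) = ιV (end G e b)
    viewed {e} {v} (inner i) = toV (inj₂ (e , v , i))

    project : U → Fin nV̂
    project (inj₁ v) = ιV v
    project (inj₂ (e , v)) = viewed (vertexView e v)

    connected : ∀ e → T (s e) → EqClosure (Adj (A e) (t⁻ e)) (end (A e) (d e) false) (end (A e) (d e) true)
    connected e se = reach⇒Adj (A e) (t⁻ e) (subst T (s≡connects e) se)

    viewed-outer : ∀ e b (x : VertexView e (end (A e) (d e) b)) → viewed x ≡ ιV (end G e b)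
    viewed-outer e b x = go x refl
      where
      go : ∀ {v} (x : VertexView e v) → v ≡ end (A e) (d e) b → viewed x ≡ ιV (end G e b)
      go (inner i) eq = contradiction eq (Inner-≢ i b)
      go (outer b') eq = cong (λ c → ιV (end G e c)) (ends b b' eq)
        where
        ends : ∀ b b' → end (A e) (d e) b' ≡ end (A e) (d e) b → b' ≡ b
        ends false false _ = refl
        ends false true eq = contradiction (sym eq) (nl e)
        ends true false eq = contradiction eq (nl e)
        ends true true _ = refl

    private
      ∈-G̃⇒end : ∀ {h x} → h ∈ rotAt x → endOf Ĝ h ≡ toV x
      ∈-G̃⇒end {h} {x} m = owner regG̃ (subst (h ∈_) (sym (rot-G̃ x)) m)

      ∈-block : ∀ e b {h} → h ∈ block e b → endOf Ĝ h ≡ ιV (end G e b)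
      ∈-block e b m = ∈-G̃⇒end {x = inj₁ (end G e b)} (∈-concatMap⁺ blockH (lose (present regG (e , b)) m))

    end-ι : ∀ e h {v} (x : VertexView e v) → liftA e h ∈ rot (A e) v → endOf Ĝ (ιE e h) ≡ viewed x
    end-ι e h {v} (inner i) m with ∈-map⁻ (liftA e) (subst (liftA e h ∈_) (sym (edge-free (regA e) (d e) (Inner-≢ i))) m)
    ... | h' , m' , eq = ∈-G̃⇒end {x = inj₂ (e , v , i)} (subst (λ x → ιE e x ∈ _) (sym (lift-injective (d e) eq)) (∈-map⁺ (ιE e) m'))
    end-ι e h (outer b) m with ∈-++⁻ (map (liftA e) (End.before e b)) (subst (liftA e h ∈_) (End.rot-eq e b) m)
    ... | inj₂ (here eq) = contradiction eq (lift≢ (d e) h)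
    ... | inj₁ m' with ∈-map⁻ (liftA e) m'
    ... | h' , m'' , eq = ∈-block e b (subst (ιE e h ∈_) (sym (block-eq e b))
            (∈-++⁺ʳ (map (ιE e) (End.behind e b)) (subst (λ x → ιE e x ∈ _) (sym (lift-injective (d e) eq)) (∈-map⁺ (ιE e) m''))))
    end-ι e h (outer b) m | inj₂ (there m') with ∈-map⁻ (liftA e) m'
    ... | h' , m'' , eq = ∈-block e b (subst (ιE e h ∈_) (sym (block-eq e b))
            (∈-++⁺ˡ (subst (λ x → ιE e x ∈ _) (sym (lift-injective (d e) eq)) (∈-map⁺ (ιE e) m''))))

    end-project : ∀ e h → endOf Ĝ (ιE e h) ≡ project (inj₂ (e , endOf (A e) (liftA e h)))
    end-project e h = end-ι e h (vertexView e _) (present (regA e) (liftA e h))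

    project-part : ∀ e {u v} → Adj (A e) (t⁻ e) u v → EqClosure (Adj Ĝ ŝ) (project (inj₂ (e , u))) (project (inj₂ (e , v)))
    project-part e (f , tf , refl , refl) = edge (d e ≟ f) tf
      where
      edge : ∀ {f} → Dec (d e ≡ f) → T (t⁻ e f) →
        EqClosure (Adj Ĝ ŝ) (project (inj₂ (e , end (A e) f false))) (project (inj₂ (e , end (A e) f true)))
      edge (yes refl) tf = contradiction (subst T (extend-at (d e) false (t e)) tf) id
      edge {f} (no p) tf with lift-surjective (d e) {b = false} p
      ... | (f' , _) , refl = eq-gen (toE (e , f') ,
              subst T (sym (assemble-toE t e f')) (subst T (extend-punchIn (d e) false (t e) f') tf) ,
              end-project e (f' , false) , end-project e (f' , true))

    project-seam : ∀ e b → project (inj₂ (e , end (A e) (d e) b)) ≡ ιV (end G e b)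
    project-seam e b = viewed-outer e b (vertexView e _)

    project-sound : ∀ {x y} → Seamed x y → EqClosure (Adj Ĝ ŝ) (project x) (project y)
    -- The ribbon `e` of `G` is not in `Ĝ`; it is replaced by the path in `A e` that put `e` into
    -- `s`.
    project-sound (base (e , se , refl , refl)) = eq-trans (eq-reflexive (sym (project-seam e false)))
      (eq-trans (eq-map (λ v → project (inj₂ (e , v))) (project-part e) (connected e se)) (eq-reflexive (project-seam e true)))
    project-sound (part {e} a) = project-part e a
    project-sound (seam e b) = eq-reflexive (sym (project-seam e b))

    embed-viewed : ∀ {e v} (x : VertexView e v) → EqClosure Seamed (embedV (fromV (viewed x))) (inj₂ (e , v))
    embed-viewed {e} (outer b) = eq-trans (eq-reflexive (cong embedV (fromV-toV (inj₁ (end G e b))))) (eq-gen (seam e b))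
    embed-viewed {e} {v} (inner i) = eq-reflexive (cong embedV (fromV-toV (inj₂ (e , v , i))))

    embed-project : ∀ x → EqClosure Seamed (embedV (fromV (project x))) x
    embed-project (inj₁ v) = eq-reflexive (cong embedV (fromV-toV (inj₁ v)))
    embed-project (inj₂ (e , v)) = embed-viewed (vertexView e v)

    embed-sound : ∀ {x y} → Adj Ĝ ŝ x y → EqClosure Seamed (embedV (fromV x)) (embedV (fromV y))
    embed-sound (ê , tê , refl , refl) = eq-trans (eq-sym (at false)) (eq-trans (eq-gen (part edge)) (at true))
      where
      e = proj₁ (fromE ê)
      f = proj₂ (fromE ê)
      edge : Adj (A e) (t⁻ e) (end (A e) (punchIn (d e) f) false) (end (A e) (punchIn (d e) f) true)
      edge = punchIn (d e) f , subst T (sym (extend-punchIn (d e) false (t e) f)) tê , refl , refl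
      at : ∀ b → EqClosure Seamed (inj₂ (e , end (A e) (punchIn (d e) f) b)) (embedV (fromV (end Ĝ ê b)))
      at b = eq-trans (eq-sym (embed-project (inj₂ (e , end (A e) (punchIn (d e) f) b))))
        (eq-reflexive (cong (embedV ∘ fromV) (trans (sym (end-project e (f , b))) (cong (λ x → end Ĝ x b) (toE-fromE ê)))))

    viewed-inner : ∀ e v i (x : VertexView e v) → viewed x ≡ toV (inj₂ (e , v , i))
    viewed-inner e _ i (outer b) = contradiction refl (Inner-≢ i b)
    viewed-inner e v (p , q) (inner (p' , q')) = cong₂ (λ p q → toV (inj₂ (e , v , p , q))) (T-irrelevant p' p) (T-irrelevant q' q)

    project-embedV : ∀ x → project (embedV x) ≡ toV x
    project-embedV (inj₁ v) = refl
    project-embedV (inj₂ (e , v , i)) = viewed-inner e v i (vertexView e v)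

    project-embed : ∀ v̂ → project (embedV (fromV v̂)) ≡ v̂
    project-embed v̂ = trans (project-embedV (fromV v̂)) (toV-fromV v̂)

    -- For `e` in `s` the ends are connected on both sides of the gluing: in `A e` by the choice of
    -- `s`, in `G` by the edge `e` itself.
    attached : ∀ e → Attached (Adj G s) (Adj (A e) (t⁻ e)) (end G e) (end (A e) (d e)) (drops (s e))
    attached e = at (s e) refl
      where
      at : ∀ c → s e ≡ c → Attached (Adj G s) (Adj (A e) (t⁻ e)) (end G e) (end (A e) (d e)) (drops c)
      at true eq = once (connected e (subst T (sym eq) _)) (eq-gen (e , subst T (sym eq) _ , refl , refl))
      at false eq = twice (λ r → subst T (trans (sym (s≡connects e)) eq) (Adj⇒reach (A e) (t⁻ e) r))

    kSt-Ĝ : kSt Ĝ ŝ +ℕ sumFin (λ e → drops (s e)) ≡ kSt G s +ℕ sumFin (λ e → kSt (A e) (t⁻ e))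
    kSt-Ĝ = finish (Classes-glue (kSt-classes G s) (λ e → kSt-classes (A e) (t⁻ e)) attached)
      where
      finish : (∃ λ N → N +ℕ sumFin (λ e → drops (s e)) ≡ kSt G s +ℕ sumFin (λ e → kSt (A e) (t⁻ e)) × Classes Seamed (Fin N)) →
        kSt Ĝ ŝ +ℕ sumFin (λ e → drops (s e)) ≡ kSt G s +ℕ sumFin (λ e → kSt (A e) (t⁻ e))
      finish (N , eq , C) = trans (cong (_+ℕ sumFin (λ e → drops (s e))) (Classes-unique (kSt-classes Ĝ ŝ) quotient)) eq
        where
        quotient : Classes (Adj Ĝ ŝ) (Fin N)
        quotient = Classes-pull (embedV ∘ fromV) embed-sound
          (λ {x} {y} r → eq-trans (eq-reflexive (sym (project-embed x))) (eq-trans (eq-map project project-sound r) (eq-reflexive (project-embed y))))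
          (λ u → project u , eq-sym (embed-project u)) C

-- Deletion and contraction as 2-sums

CycEq-swap : {L L' : List X} (a b : List X) → L ≡ a ++ b → L' ≡ b ++ a → CycEq L L'
CycEq-swap a b refl refl = length a , cong₂ _++_ (drop-++ a) (take-++ a)

CycEq-reflexive : {L L' : List X} → L ≡ L' → CycEq L L'
CycEq-reflexive {L = L} refl = 0 , ++-identityʳ L

module _ (i : Fin (suc n)) where

  ∈-dropEdge⁺ : ∀ {h L} → lift i h ∈ L → h ∈ dropEdge i L
  ∈-dropEdge⁺ {f , b} {(j , c) ∷ L} m with i ≟ j
  ∈-dropEdge⁺ {f , b} (here refl) | yes p = contradiction (sym p) (punchInᵢ≢i i f)
  ∈-dropEdge⁺ {f , b} (there m) | yes p = ∈-dropEdge⁺ m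
  ∈-dropEdge⁺ {f , b} (here refl) | no p = here (cong (_, b) (trans (sym (punchOut-punchIn i)) (punchOut-cong i refl)))
  ∈-dropEdge⁺ {f , b} (there m) | no p = there (∈-dropEdge⁺ m)

  ∈-dropEdge⁻ : ∀ {h L} → h ∈ dropEdge i L → lift i h ∈ L
  ∈-dropEdge⁻ {L = (j , c) ∷ L} m with i ≟ j
  ∈-dropEdge⁻ {L = (j , c) ∷ L} m | yes p = there (∈-dropEdge⁻ m)
  ∈-dropEdge⁻ {L = (j , c) ∷ L} (here refl) | no p = here (cong (_, c) (punchIn-punchOut p))
  ∈-dropEdge⁻ {L = (j , c) ∷ L} (there m) | no p = there (∈-dropEdge⁻ m)

  dropEdge-unique : ∀ {L} → Unique L → Unique (dropEdge i L)
  dropEdge-unique [] = []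
  dropEdge-unique {(j , c) ∷ L} (p ∷ u) with i ≟ j
  ... | yes _ = dropEdge-unique u
  ... | no i≢j = All.tabulate (λ { m refl → All.lookup p (∈-dropEdge⁻ m) (cong (_, c) (sym (punchIn-punchOut i≢j))) }) ∷ dropEdge-unique u

  dropEdge-lift : ∀ L → dropEdge i (map (lift i) L) ≡ L
  dropEdge-lift [] = refl
  dropEdge-lift ((f , b) ∷ L) with i ≟ punchIn i f
  ... | yes p = contradiction (sym p) (punchInᵢ≢i i f)
  ... | no p = cong₂ _∷_ (cong (_, b) (trans (punchOut-cong i refl) (punchOut-punchIn i))) (dropEdge-lift L)

edgeGraph : RG 2 1
edgeGraph = record
  { end = λ _ b → if b then suc zero else zero
  ; rot = λ { zero → (zero , false) ∷ [] ; (suc zero) → (zero , true) ∷ [] } }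

edgeGraph-regular : Regular edgeGraph
edgeGraph-regular = record
  { present = λ { (zero , false) → here refl ; (zero , true) → here refl }
  ; owner = λ { {zero} (here refl) → refl ; {suc zero} (here refl) → refl }
  ; unique = λ { zero → [] ∷ [] ; (suc zero) → [] ∷ [] } }

loopGraph : RG 1 1
loopGraph = record { end = λ _ _ → zero ; rot = λ _ → (zero , false) ∷ (zero , true) ∷ [] }

loopGraph-regular : Regular loopGraph
loopGraph-regular = record
  { present = λ { (zero , false) → here refl ; (zero , true) → there (here refl) }
  ; owner = λ { {zero} _ → refl }
  ; unique = λ _ → ((λ ()) ∷ []) ∷ [] ∷ [] }

kSt-edgeGraph : ∀ c → kSt edgeGraph (λ _ → c) ≡ drops c
kSt-edgeGraph false = refl
kSt-edgeGraph true = refl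

bdSt-edgeGraph : ∀ c → bdSt edgeGraph (λ _ → c) ≡ drops c
bdSt-edgeGraph false = refl
bdSt-edgeGraph true = refl

kSt-loopGraph : ∀ c → kSt loopGraph (λ _ → c) ≡ 1
kSt-loopGraph false = refl
kSt-loopGraph true = refl

bdSt-loopGraph : ∀ c → bdSt loopGraph (λ _ → c) ≡ (if c then 2 else 1)
bdSt-loopGraph false = refl
bdSt-loopGraph true = refl

module _ {F : RG (suc nV) (suc nE)} (reg : Regular F) (i : Fin (suc nE)) (nl : NonLoop F i) where

  private
    u = end F i false
    w = end F i true

  deleteEdge-regular : Regular (deleteEdge F i)
  deleteEdge-regular = record
    { present = λ h → ∈-dropEdge⁺ i (present reg (lift i h))
    ; owner = λ m → owner reg (∈-dropEdge⁻ i m)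
    ; unique = λ v → dropEdge-unique i (unique reg v) }

  private
    module End b = EndSplit (end-split reg i nl b)

    ends-eq : ∀ b → dropEdge i (rot F (end F i b)) ≡ End.before b ++ End.behind b
    ends-eq b = trans (cong (dropEdge i) (End.rot-eq b)) (trans (dropEdge-++ i (map (lift i) (End.before b)) _)
      (cong₂ _++_ (dropEdge-lift i (End.before b)) (trans (dropEdge-self i b _) (dropEdge-lift i (End.behind b)))))

    ends-cyc : ∀ b → CycEq (dropEdge i (rot F (end F i b))) (dropEdge i (after (i , b) (rot F (end F i b))))
    ends-cyc b = CycEq-swap (End.before b) (End.behind b) (ends-eq b) (End.after-eq b)

  -- F \ i is the 2-sum of F with a single edge.
  module Deletion where
    open TwoSum edgeGraph (deleteEdge F i) (λ _ → nV) (λ _ → nE) (λ _ → F) (λ _ → i)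

    toV : Fin 2 ⊎ InnerV → Fin (suc nV)
    toV (inj₁ zero) = u
    toV (inj₁ (suc zero)) = w
    toV (inj₂ (_ , v , _)) = v

    locate : ∀ v → Dec (v ≡ u) → Dec (v ≡ w) → Fin 2 ⊎ InnerV
    locate v (yes _) _ = inj₁ zero
    locate v (no _) (yes _) = inj₁ (suc zero)
    locate v (no p) (no q) = inj₂ (zero , v , fromWitnessFalse p , fromWitnessFalse q)

    fromV : Fin (suc nV) → Fin 2 ⊎ InnerV
    fromV v = locate v (v ≟ u) (v ≟ w)

    toV-locate : ∀ v x y → toV (locate v x y) ≡ v
    toV-locate v (yes p) _ = sym p
    toV-locate v (no _) (yes q) = sym q
    toV-locate v (no _) (no _) = refl

    locate-toV : ∀ x y z → locate (toV x) y z ≡ x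
    locate-toV (inj₁ zero) (yes _) _ = refl
    locate-toV (inj₁ zero) (no p) _ = contradiction refl p
    locate-toV (inj₁ (suc zero)) (yes p) _ = contradiction (sym p) nl
    locate-toV (inj₁ (suc zero)) (no _) (yes _) = refl
    locate-toV (inj₁ (suc zero)) (no _) (no p) = contradiction refl p
    locate-toV (inj₂ (_ , v , p , q)) (yes r) _ = contradiction r (toWitnessFalse p)
    locate-toV (inj₂ (_ , v , p , q)) (no _) (yes r) = contradiction r (toWitnessFalse q)
    locate-toV (inj₂ (zero , v , p , q)) (no _) (no _) = cong₂ (λ p q → inj₂ (zero , v , p , q)) (T-irrelevant _ p) (T-irrelevant _ q)

    vmap : (Fin 2 ⊎ InnerV) ↔ Fin (suc nV)
    vmap = mk↔ₛ′ toV fromV (λ v → toV-locate v (v ≟ u) (v ≟ w)) (λ x → locate-toV x (toV x ≟ u) (toV x ≟ w))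

    emap : EdgesH ↔ Fin nE
    emap = mk↔ₛ′ proj₂ (zero ,_) (λ _ → refl) (λ { (zero , _) → refl })

    isTwoSum : IsTwoSum vmap emap
    isTwoSum = record
      { rotG = λ { zero → subst (CycEq _) (sym (trans (++-identityʳ _) (map-id _))) (ends-cyc false)
                 ; (suc zero) → subst (CycEq _) (sym (trans (++-identityʳ _) (map-id _))) (ends-cyc true) }
      ; rotH = λ { zero v _ → CycEq-reflexive (sym (map-id _)) } }

    module Count t = TwoSumCount edgeGraph-regular deleteEdge-regular (λ _ → reg) (λ _ → nl) vmap emap isTwoSum
      (λ _ → t) (λ _ → connects F i t) (λ _ → refl)

  private
    cancel-drops : ∀ {a b c m} → m ≡ c → a +ℕ (c +ℕ 0) ≡ m +ℕ (b +ℕ 0) → a ≡ b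
    cancel-drops {a} {b} {c} refl eq = +-cancelʳ-≡ c a b (trans (cong (a +ℕ_) (sym (ℕ.+-identityʳ c)))
      (trans eq (trans (cong (c +ℕ_) (ℕ.+-identityʳ b)) (ℕ.+-comm c b))))

  -- A single edge, present or absent, has exactly `drops` components, which cancels the loss in the
  -- 2-sum formula. The same happens with its boundary components.
  kSt-deleteEdge : ∀ t → kSt (deleteEdge F i) t ≡ kSt F (extend i false t)
  kSt-deleteEdge t = cancel-drops (kSt-edgeGraph (connects F i t)) (Deletion.Count.ComponentCount.kSt-Ĝ t)

  bdSt-deleteEdge : Planar F → ∀ t → bdSt (deleteEdge F i) t ≡ bdSt F (extend i false t)
  bdSt-deleteEdge planar t = cancel-drops (bdSt-edgeGraph (connects F i t)) (Deletion.Count.FaceCount.bdSt-Ĝ t (λ _ → planar))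

  -- F / i is the 2-sum of F with a single loop.
  module Contraction where
    open TwoSum loopGraph (contract F i nl) (λ _ → nV) (λ _ → nE) (λ _ → F) (λ _ → i)

    C : RG nV nE
    C = contract F i nl

    w≢u : w ≢ u
    w≢u p = nl (sym p)

    rot-merged : ∀ {x} → punchIn w x ≡ u → rot C x ≡ dropEdge i (after (i , false) (rot F u) ++ after (i , true) (rot F w))
    rot-merged {x} p with u ≟ punchIn w x
    ... | yes _ = refl
    ... | no q = contradiction (sym p) q

    rot-other : ∀ {x} → punchIn w x ≢ u → rot C x ≡ dropEdge i (rot F (punchIn w x))
    rot-other {x} p with u ≟ punchIn w x
    ... | yes q = contradiction (sym q) p
    ... | no _ = refl

    end-w : ∀ {h} → endOf F (lift i h) ≡ w → punchIn w (endOf C h) ≡ u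
    end-w {j , b} p with w ≟ end F (punchIn i j) b
    ... | yes _ = punchIn-punchOut _
    ... | no q = contradiction (sym p) q

    end-other : ∀ {h} → endOf F (lift i h) ≢ w → punchIn w (endOf C h) ≡ endOf F (lift i h)
    end-other {j , b} p with w ≟ end F (punchIn i j) b
    ... | yes q = contradiction (sym q) p
    ... | no q = punchIn-punchOut q

    merged : List (HE nE)
    merged = dropEdge i (after (i , false) (rot F u)) ++ dropEdge i (after (i , true) (rot F w))

    rot-u : ∀ {x} → punchIn w x ≡ u → rot C x ≡ merged
    rot-u p = trans (rot-merged p) (dropEdge-++ i (after (i , false) (rot F u)) (after (i , true) (rot F w)))

    ∈-end⁺ : ∀ {h} b → lift i h ∈ rot F (end F i b) → h ∈ dropEdge i (after (i , b) (rot F (end F i b)))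
    ∈-end⁺ b m = ∈-resp-↭ (CycEq⇒↭ (ends-cyc b)) (∈-dropEdge⁺ i m)

    ∈-end⁻ : ∀ {h} b → h ∈ dropEdge i (after (i , b) (rot F (end F i b))) → lift i h ∈ rot F (end F i b)
    ∈-end⁻ b m = ∈-dropEdge⁻ i (∈-resp-↭ (↭-sym (CycEq⇒↭ (ends-cyc b))) m)

    contract-present : ∀ h → h ∈ rot C (endOf C h)
    contract-present h = at (endOf F (lift i h) ≟ w) (endOf F (lift i h) ≟ u)
      where
      at : Dec (endOf F (lift i h) ≡ w) → Dec (endOf F (lift i h) ≡ u) → h ∈ rot C (endOf C h)
      at (yes p) _ = subst (h ∈_) (sym (rot-u (end-w {h} p)))
        (∈-++⁺ʳ _ (∈-end⁺ true (subst (λ v → lift i h ∈ rot F v) p (present reg (lift i h)))))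
      at (no p) (yes q) = subst (h ∈_) (sym (rot-u (trans (end-other {h} p) q)))
        (∈-++⁺ˡ (∈-end⁺ false (subst (λ v → lift i h ∈ rot F v) q (present reg (lift i h)))))
      at (no p) (no q) = subst (h ∈_) (sym (rot-other (λ r → q (trans (sym (end-other {h} p)) r))))
        (∈-dropEdge⁺ i (subst (λ v → lift i h ∈ rot F v) (sym (end-other {h} p)) (present reg (lift i h))))

    contract-owner : ∀ {x h} → h ∈ rot C x → endOf C h ≡ x
    contract-owner {x} {h} m = at (punchIn w x ≟ u)
      where
      end-is : ∀ {v} → v ≢ w → endOf F (lift i h) ≡ v → punchIn w (endOf C h) ≡ v
      end-is v≢w eq = trans (end-other {h} (λ q → v≢w (trans (sym eq) q))) eq

      at : Dec (punchIn w x ≡ u) → endOf C h ≡ x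
      at (no p) = punchIn-injective w _ _ (end-is (punchInᵢ≢i w x) (owner reg (∈-dropEdge⁻ i (subst (h ∈_) (rot-other p) m))))
      at (yes p) = punchIn-injective w _ _ (trans (side (∈-++⁻ _ (subst (h ∈_) (rot-u p) m))) (sym p))
        where
        side : h ∈ dropEdge i (after (i , false) (rot F u)) ⊎ h ∈ dropEdge i (after (i , true) (rot F w)) → punchIn w (endOf C h) ≡ u
        side (inj₁ m') = end-is nl (owner reg (∈-end⁻ false m'))
        side (inj₂ m') = end-w {h} (owner reg (∈-end⁻ true m'))

    merged-unique : Unique merged
    merged-unique = Unique.++⁺ (end-unique false) (end-unique true)
      (λ (m , m') → nl (trans (sym (owner reg (∈-end⁻ false m))) (owner reg (∈-end⁻ true m'))))
      where
      end-unique : ∀ b → Unique (dropEdge i (after (i , b) (rot F (end F i b))))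
      end-unique b = Unique-resp-↭ (CycEq⇒↭ (ends-cyc b)) (dropEdge-unique i (unique reg (end F i b)))

    contract-unique : ∀ x → Unique (rot C x)
    contract-unique x = at (punchIn w x ≟ u)
      where
      at : Dec (punchIn w x ≡ u) → Unique (rot C x)
      at (yes p) = subst Unique (sym (rot-u p)) merged-unique
      at (no p) = subst Unique (sym (rot-other p)) (dropEdge-unique i (unique reg _))

    contract-regular : Regular C
    contract-regular = record { present = contract-present ; owner = contract-owner ; unique = contract-unique }

    w≢inner : ∀ {e v} → Inner e v → w ≢ v
    w≢inner (p , q) r = toWitnessFalse q (sym r)

    toV : Fin 1 ⊎ InnerV → Fin nV
    toV (inj₁ _) = punchOut w≢u
    toV (inj₂ (e , v , p)) = punchOut (w≢inner {e} p)

    locate : ∀ v → v ≢ w → Dec (v ≡ u) → Fin 1 ⊎ InnerV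
    locate v _ (yes _) = inj₁ zero
    locate v v≢w (no p) = inj₂ (zero , v , fromWitnessFalse p , fromWitnessFalse v≢w)

    fromV : Fin nV → Fin 1 ⊎ InnerV
    fromV x = locate (punchIn w x) (punchInᵢ≢i w x) (punchIn w x ≟ u)

    punchIn-toV-locate : ∀ v v≢w x → punchIn w (toV (locate v v≢w x)) ≡ v
    punchIn-toV-locate v v≢w (yes p) = trans (punchIn-punchOut w≢u) (sym p)
    punchIn-toV-locate v v≢w (no p) = punchIn-punchOut _

    locate-u : ∀ v v≢w x → v ≡ u → locate v v≢w x ≡ inj₁ zero
    locate-u v v≢w (yes _) p = refl
    locate-u v v≢w (no q) p = contradiction p q

    locate-inner : ∀ v v≢w x {v'} (r : Inner zero v') → v ≡ v' → locate v v≢w x ≡ inj₂ (zero , v' , r)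
    locate-inner v v≢w (yes p) (r , _) refl = contradiction p (toWitnessFalse r)
    locate-inner v v≢w (no p) (r , r') refl = cong₂ (λ r r' → inj₂ (zero , v , r , r')) (T-irrelevant _ r) (T-irrelevant _ r')

    fromV-toV : ∀ x → fromV (toV x) ≡ x
    fromV-toV (inj₁ zero) = locate-u _ _ _ (punchIn-punchOut w≢u)
    fromV-toV (inj₂ (zero , v , p)) = locate-inner _ _ _ p (punchIn-punchOut (w≢inner {zero} p))

    vmap : (Fin 1 ⊎ InnerV) ↔ Fin nV
    vmap = mk↔ₛ′ toV fromV (λ x → punchIn-injective w _ _ (punchIn-toV-locate (punchIn w x) _ (punchIn w x ≟ u))) fromV-toV

    emap : EdgesH ↔ Fin nE
    emap = mk↔ₛ′ proj₂ (zero ,_) (λ _ → refl) (λ { (zero , _) → refl })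

    endBlock : Bool → List (HE nE)
    endBlock b = dropEdge i (after (i , b) (rot F (end F i b)))

    isTwoSum : IsTwoSum vmap emap
    isTwoSum = record
      { rotG = λ _ → CycEq-reflexive (trans (rot-u (punchIn-punchOut w≢u))
          (cong₂ _++_ (sym (map-id (endBlock false))) (sym (trans (++-identityʳ (map id (endBlock true))) (map-id (endBlock true))))))
      ; rotH = λ { zero v p → CycEq-reflexive (trans (rot-other (λ r → toWitnessFalse (proj₁ p) (trans (sym (punchIn-punchOut (w≢inner {zero} p))) r)))
          (trans (cong (λ v → dropEdge i (rot F v)) (punchIn-punchOut (w≢inner {zero} p))) (sym (map-id _)))) } }

    module Count t = TwoSumCount loopGraph-regular contract-regular (λ _ → reg) (λ _ → nl) vmap emap isTwoSum
      (λ _ → t) (λ _ → connects F i t) (λ _ → refl)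

  kSt-contract : ∀ t → kSt (contract F i nl) t +ℕ drops (connects F i t) ≡ suc (kSt F (extend i false t))
  kSt-contract t = trans (cong (kSt (contract F i nl) t +ℕ_) (sym (ℕ.+-identityʳ _)))
    (trans (Contraction.Count.ComponentCount.kSt-Ĝ t) (cong₂ _+ℕ_ (kSt-loopGraph (connects F i t)) (ℕ.+-identityʳ _)))

  -- The constants are those of a disc with one loop: an annulus with two boundary components if the
  -- loop is present, a disc with one if not.
  bdSt-contract : Planar F → ∀ t → bdSt (contract F i nl) t +ℕ drops (connects F i t) ≡
    (if connects F i t then 2 else 1) +ℕ bdSt F (extend i false t)
  bdSt-contract planar t = trans (cong (bdSt (contract F i nl) t +ℕ_) (sym (ℕ.+-identityʳ _)))
    (trans (Contraction.Count.FaceCount.bdSt-Ĝ t (λ _ → planar)) (cong₂ _+ℕ_ (bdSt-loopGraph (connects F i t)) (ℕ.+-identityʳ _)))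

-- Sums and products over states

complete⇒↭ : {xs ys : List X} → Unique xs → Unique ys → (∀ x → x ∈ xs) → (∀ x → x ∈ ys) → xs ↭ ys
complete⇒↭ u u' c c' = ∼bag⇒↭ (unique∧set⇒bag u u' (λ {x} → mk⇔ (λ _ → c' x) (λ _ → c x)))

AllPairs-concatMap : {D : Rel Y 0ℓ} (f : X → List Y) {xs : List X} → (∀ x → AllPairs D (f x)) →
  AllPairs (λ x x' → All (λ y → All (D y) (f x')) (f x)) xs → AllPairs D (concatMap f xs)
AllPairs-concatMap f within across = AllPairs.concat⁺ (All.map⁺ (All.universal within _)) (AllPairs.map⁺ across)

Family : (n : ℕ) → (Fin n → ℕ) → Set
Family n m = (e : Fin n) → State (m e)

consF : {m : Fin (suc n) → ℕ} → State (m zero) → Family n (m ∘ suc) → Family (suc n) m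
consF s t zero = s
consF s t (suc e) = t e

allFamilies : (n : ℕ) (m : Fin n → ℕ) → List (Family n m)
allFamilies zero m = (λ ()) ∷ []
allFamilies (suc n) m = concatMap (λ t → map (λ s → consF s t) (allStates (m zero))) (allFamilies n (m ∘ suc))

-- States are functions, so distinctness is witnessed by an index; the inequality of two functions
-- would not provide one.
Differ : Rel (State n) 0ℓ
Differ s s' = ∃ λ i → s i ≢ s' i

DifferF : {m : Fin n → ℕ} → Rel (Family n m) 0ℓ
DifferF t t' = ∃ λ e → Differ (t e) (t' e)

allStates-distinct : (n : ℕ) → AllPairs Differ (allStates n)
allStates-distinct zero = [] ∷ []
allStates-distinct (suc n) = AllPairs-concatMap _
  (λ s → ((zero , λ ()) ∷ []) ∷ [] ∷ [])
  (AllPairs.map (λ (i , p) → ((suc i , p) ∷ (suc i , p) ∷ []) ∷ ((suc i , p) ∷ (suc i , p) ∷ []) ∷ []) (allStates-distinct n))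

allStates-complete : (s : State n) → ∃ λ s' → s' ∈ allStates n × (∀ i → s' i ≡ s i)
allStates-complete {zero} s = _ , here refl , λ ()
allStates-complete {suc n} s with allStates-complete (s ∘ suc)
... | s' , m , p = cons (s zero) s' , ∈-concatMap⁺ (λ s → cons false s ∷ cons true s ∷ []) (lose m (both (s zero))) ,
    λ { zero → refl ; (suc i) → p i }
  where
  both : ∀ b → cons b s' ∈ cons false s' ∷ cons true s' ∷ []
  both false = here refl
  both true = there (here refl)

allFamilies-distinct : (n : ℕ) (m : Fin n → ℕ) → AllPairs DifferF (allFamilies n m)
allFamilies-distinct zero m = [] ∷ []
allFamilies-distinct (suc n) m = AllPairs-concatMap _
  (λ t → AllPairs.map⁺ (AllPairs.map (λ p → zero , p) (allStates-distinct (m zero))))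
  (AllPairs.map (λ (e , p) → All.map⁺ (All.universal (λ _ → All.map⁺ (All.universal (λ _ → suc e , p) _)) _)) (allFamilies-distinct n (m ∘ suc)))

allFamilies-complete : {m : Fin n → ℕ} (t : Family n m) → ∃ λ t' → t' ∈ allFamilies n m × (∀ e i → t' e i ≡ t e i)
allFamilies-complete {zero} t = _ , here refl , λ ()
allFamilies-complete {suc n} {m} t with allFamilies-complete {m = m ∘ suc} (t ∘ suc) | allStates-complete (t zero)
... | t' , mt , p | s , ms , q = consF s t' ,
  ∈-concatMap⁺ (λ t → map (λ s → consF s t) (allStates (m zero))) (lose mt (∈-map⁺ (λ s → consF s t') ms)) ,
  λ { zero → q ; (suc e) → p e }

module _ {N : ℕ} {m : Fin n → ℕ} (emap : Σ (Fin n) (Fin ∘ m) ↔ Fin N) where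
  private
    toE = Inverse.to emap
    fromE = Inverse.from emap

  assembled : Family n m → State N
  assembled t i = t (proj₁ (fromE i)) (proj₂ (fromE i))

  private
    assembled-toE : ∀ t e f → assembled t (toE (e , f)) ≡ t e f
    assembled-toE t e f = cong (λ x → t (proj₁ x) (proj₂ x)) (Inverse.strictlyInverseʳ emap (e , f))

    tabulate-≢ : {s s' : State N} → Differ s s' → Vec.tabulate s ≢ Vec.tabulate s'
    tabulate-≢ {s} {s'} (i , p) eq =
      p (trans (sym (lookup∘tabulate s i)) (trans (cong (λ v → Vec.lookup v i) eq) (lookup∘tabulate s' i)))

  -- Pointwise equal states need not be identical, but their tables are. As lists of vectors both
  -- sides contain every vector exactly once, which makes them permutations of each other.
  states↭families : map Vec.tabulate (allStates N) ↭ map (Vec.tabulate ∘ assembled) (allFamilies n m)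
  states↭families = complete⇒↭
    (AllPairs.map⁺ (AllPairs.map tabulate-≢ (allStates-distinct N)))
    (AllPairs.map⁺ (AllPairs.map (λ {t} {t'} (e , f , p) → tabulate-≢ (toE (e , f) , λ eq →
      p (trans (sym (assembled-toE t e f)) (trans eq (assembled-toE t' e f))))) (allFamilies-distinct n m)))
    states-all families-all
    where
    states-all : ∀ v → v ∈ map Vec.tabulate (allStates N)
    states-all v with allStates-complete (Vec.lookup v)
    ... | s , ms , p = subst (_∈ map Vec.tabulate (allStates N)) (trans (tabulate-cong p) (tabulate∘lookup v)) (∈-map⁺ Vec.tabulate ms)

    families-all : ∀ v → v ∈ map (Vec.tabulate ∘ assembled) (allFamilies n m)
    families-all v with allFamilies-complete {m = m} (λ e f → Vec.lookup v (toE (e , f)))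
    ... | t , mt , p = subst (_∈ map (Vec.tabulate ∘ assembled) (allFamilies n m))
      (trans (tabulate-cong (λ i → trans (p _ _) (cong (Vec.lookup v) (Inverse.strictlyInverseˡ emap i)))) (tabulate∘lookup v))
      (∈-map⁺ (Vec.tabulate ∘ assembled) mt)

  edges↭ : allFin N ↭ concatMap (λ e → map (λ f → toE (e , f)) (allFin (m e))) (allFin n)
  edges↭ = complete⇒↭ (Unique.allFin⁺ N)
    (AllPairs-concatMap (λ e → map (λ f → toE (e , f)) (allFin (m e)))
      (λ e → AllPairs.map⁺ (AllPairs.map (λ p eq → p (inj-same (toE-injective eq))) (Unique.allFin⁺ (m e))))
      (AllPairs.map (λ p → All.map⁺ (All.universal (λ _ → All.map⁺ (All.universal (λ _ eq → p (cong proj₁ (toE-injective eq))) _)) _)) (Unique.allFin⁺ n)))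
    ∈-allFin
    (λ i → subst (_∈ _) (Inverse.strictlyInverseˡ emap i) (∈-concatMap⁺ (λ e → map (λ f → toE (e , f)) (allFin (m e)))
      (lose (∈-allFin (proj₁ (fromE i))) (∈-map⁺ (λ f → toE (proj₁ (fromE i) , f)) (∈-allFin (proj₂ (fromE i)))))))
    where
    toE-injective : ∀ {x y} → toE x ≡ toE y → x ≡ y
    toE-injective eq = trans (sym (Inverse.strictlyInverseʳ emap _)) (trans (cong fromE eq) (Inverse.strictlyInverseʳ emap _))
    inj-same : ∀ {e} {f f' : Fin (m e)} → _≡_ {A = Σ (Fin n) (Fin ∘ m)} (e , f) (e , f') → f ≡ f'
    inj-same refl = refl

module BigOp {c ℓ : Level} (M : CommutativeMonoid c ℓ) where
  open CommutativeMonoid M renaming (Carrier to C; refl to ≈-refl; sym to ≈-sym; trans to ≈-trans; reflexive to ≈-reflexive)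
  open import Algebra.Properties.CommutativeSemigroup commutativeSemigroup using (x∙yz≈y∙xz; interchange)

  fold : (X → C) → List X → C
  fold g = foldr (λ x r → g x ∙ r) ε

  fold-cong : {g g' : X → C} → (∀ x → g x ≈ g' x) → ∀ xs → fold g xs ≈ fold g' xs
  fold-cong p [] = ≈-refl
  fold-cong p (x ∷ xs) = ∙-cong (p x) (fold-cong p xs)

  fold-++ : (g : X → C) (xs ys : List X) → fold g (xs ++ ys) ≈ fold g xs ∙ fold g ys
  fold-++ g [] ys = ≈-sym (identityˡ _)
  fold-++ g (x ∷ xs) ys = ≈-trans (∙-congˡ (fold-++ g xs ys)) (≈-sym (assoc _ _ _))

  fold-concatMap : (g : Y → C) (f : X → List Y) (xs : List X) → fold g (concatMap f xs) ≈ fold (λ x → fold g (f x)) xs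
  fold-concatMap g f [] = ≈-refl
  fold-concatMap g f (x ∷ xs) = ≈-trans (fold-++ g (f x) (concatMap f xs)) (∙-congˡ (fold-concatMap g f xs))

  fold-map : (g : Y → C) (f : X → Y) (xs : List X) → fold g (map f xs) ≡ fold (g ∘ f) xs
  fold-map g f [] = refl
  fold-map g f (x ∷ xs) = cong (g (f x) ∙_) (fold-map g f xs)

  fold-∙ : (g g' : X → C) (xs : List X) → fold (λ x → g x ∙ g' x) xs ≈ fold g xs ∙ fold g' xs
  fold-∙ g g' [] = ≈-sym (identityˡ _)
  fold-∙ g g' (x ∷ xs) = ≈-trans (∙-congˡ (fold-∙ g g' xs)) (interchange _ _ _ _)

  fold-↭ : (g : X → C) {xs ys : List X} → xs ↭ ys → fold g xs ≈ fold g ys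
  fold-↭ g Perm.refl = ≈-refl
  fold-↭ g (Perm.prep x p) = ∙-congˡ (fold-↭ g p)
  fold-↭ g (Perm.swap x y p) = ≈-trans (x∙yz≈y∙xz _ _ _) (∙-congˡ (∙-congˡ (fold-↭ g p)))
  fold-↭ g (Perm.trans p q) = ≈-trans (fold-↭ g p) (fold-↭ g q)

  fold-states : {N : ℕ} {m : Fin n → ℕ} (emap : Σ (Fin n) (Fin ∘ m) ↔ Fin N) (F : State N → C) →
    (∀ {s s'} → (∀ i → s i ≡ s' i) → F s ≈ F s') →
    fold F (allStates N) ≈ fold (F ∘ assembled emap) (allFamilies n m)
  fold-states {n = n} {N} {m} emap F F-cong = begin
    fold F (allStates N)                                        ≈⟨ fold-cong (λ s → F-cong (λ i → sym (lookup∘tabulate s i))) (allStates N) ⟩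
    fold (F ∘ Vec.lookup ∘ Vec.tabulate) (allStates N)          ≡⟨ fold-map (F ∘ Vec.lookup) Vec.tabulate (allStates N) ⟨
    fold (F ∘ Vec.lookup) (map Vec.tabulate (allStates N))      ≈⟨ fold-↭ (F ∘ Vec.lookup) (states↭families emap) ⟩
    fold (F ∘ Vec.lookup) (map (Vec.tabulate ∘ assembled emap) (allFamilies n m)) ≡⟨ fold-map (F ∘ Vec.lookup) (Vec.tabulate ∘ assembled emap) (allFamilies n m) ⟩
    fold (F ∘ Vec.lookup ∘ Vec.tabulate ∘ assembled emap) (allFamilies n m) ≈⟨ fold-cong (λ t → F-cong (λ i → lookup∘tabulate (assembled emap t) i)) (allFamilies n m) ⟩
    fold (F ∘ assembled emap) (allFamilies n m)                 ∎
    where open import Relation.Binary.Reasoning.Setoid setoid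

  fold-edges : {N : ℕ} {m : Fin n → ℕ} (emap : Σ (Fin n) (Fin ∘ m) ↔ Fin N) (g : Fin N → C) →
    fold g (allFin N) ≈ fold (λ e → fold (λ f → g (Inverse.to emap (e , f))) (allFin (m e))) (allFin n)
  fold-edges {n = n} {m = m} emap g = begin
    fold g (allFin _)                                                                ≈⟨ fold-↭ g (edges↭ emap) ⟩
    fold g (concatMap (λ e → map (λ f → Inverse.to emap (e , f)) (allFin (m e))) (allFin n)) ≈⟨ fold-concatMap g _ (allFin n) ⟩
    fold (λ e → fold g (map (λ f → Inverse.to emap (e , f)) (allFin (m e)))) (allFin n) ≈⟨ fold-cong (λ e → ≈-reflexive (fold-map g (λ f → Inverse.to emap (e , f)) (allFin (m e)))) (allFin n) ⟩
    fold (λ e → fold (λ f → g (Inverse.to emap (e , f))) (allFin (m e))) (allFin n) ∎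
    where open import Relation.Binary.Reasoning.Setoid setoid

  fold-tabulate : (g : X → C) (f : Fin n → X) → fold g (tabulate f) ≡ fold (g ∘ f) (allFin n)
  fold-tabulate {n = zero} g f = refl
  fold-tabulate {n = suc n} g f = cong (g (f zero) ∙_) (trans (fold-tabulate g (f ∘ suc)) (sym (fold-tabulate (g ∘ f) suc)))

  fold-allFin-suc : (g : Fin (suc n) → C) → fold g (allFin (suc n)) ≡ g zero ∙ fold (g ∘ suc) (allFin n)
  fold-allFin-suc g = cong (g zero ∙_) (fold-tabulate g suc)

-- Polynomial identities

module RingLemmas {c ℓ : Level} (R : CommutativeRing c ℓ) where
  open CommutativeRing R hiding (zero) renaming (refl to ≈-refl; sym to ≈-sym; trans to ≈-trans; reflexive to ≈-reflexive)
  open import Algebra.Properties.CommutativeSemigroup *-commutativeSemigroup using (interchange; xy∙z≈xz∙y)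
  open import Algebra.Properties.AbelianGroup +-abelianGroup using (∙-cancelʳ)
  open import Algebra.Solver.Ring.NaturalCoefficients.Default commutativeSemiring using (solve; _:+_; _:*_; _:=_; con)
  open import Relation.Binary.Reasoning.Setoid setoid
  module Sums = BigOp +-commutativeMonoid
  module Products = BigOp *-commutativeMonoid

  ∏ : (Fin n → Carrier) → Carrier
  ∏ = prodFin R

  ∏-suc : (g : Fin (suc n) → Carrier) → ∏ g ≈ g zero * ∏ (g ∘ suc)
  ∏-suc g = ≈-reflexive (Products.fold-allFin-suc g)

  ∏-cong : {g g' : Fin n → Carrier} → (∀ e → g e ≈ g' e) → ∏ g ≈ ∏ g'
  ∏-cong {n = n} p = Products.fold-cong p (allFin n)

  ∏-* : (g g' : Fin n → Carrier) → ∏ (λ e → g e * g' e) ≈ ∏ g * ∏ g'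
  ∏-* {n = n} g g' = Products.fold-∙ g g' (allFin n)

  ∏-const : ∀ n x → ∏ {n} (λ _ → x) ≈ pow R x n
  ∏-const zero x = ≈-refl
  ∏-const (suc n) x = ≈-trans (∏-suc {n} (λ _ → x)) (*-congˡ (∏-const n x))

  pow-+ : ∀ x m n → pow R x (m +ℕ n) ≈ pow R x m * pow R x n
  pow-+ x zero n = ≈-sym (*-identityˡ _)
  pow-+ x (suc m) n = ≈-trans (*-congˡ (pow-+ x m n)) (≈-sym (*-assoc _ _ _))

  pow-sum : ∀ x (k : Fin n → ℕ) → pow R x (sumFin k) ≈ ∏ (λ e → pow R x (k e))
  pow-sum {zero} x k = ≈-refl
  pow-sum {suc n} x k = ≈-trans (pow-+ x (k zero) (sumFin (k ∘ suc))) (≈-trans (*-congˡ (pow-sum x (k ∘ suc))) (≈-sym (∏-suc (λ e → pow R x (k e)))))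

  pow-* : ∀ x y n → pow R (x * y) n ≈ pow R x n * pow R y n
  pow-* x y zero = ≈-sym (*-identityˡ 1#)
  pow-* x y (suc n) = ≈-trans (*-congˡ (pow-* x y n)) (interchange _ _ _ _)

  pow-inverse : ∀ {x y} → x * y ≈ 1# → ∀ n → pow R x n * pow R y n ≈ 1#
  pow-inverse p zero = *-identityˡ 1#
  pow-inverse p (suc n) = ≈-trans (interchange _ _ _ _) (≈-trans (*-cong p (pow-inverse p n)) (*-identityˡ 1#))

  sum-*ˡ : ∀ x (g : X → Carrier) xs → sumL R (λ y → x * g y) xs ≈ x * sumL R g xs
  sum-*ˡ x g [] = ≈-sym (zeroʳ x)
  sum-*ˡ x g (y ∷ xs) = ≈-trans (+-congˡ (sum-*ˡ x g xs)) (≈-sym (distribˡ x _ _))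

  only : Bool → Bool → Carrier → Carrier
  only true true x = x
  only false false x = x
  only _ _ _ = 0#

  sumOver : (X → Bool) → Bool → (X → Carrier) → List X → Carrier
  sumOver κ c h = sumL R (λ t → only (κ t) c (h t))

  -- Terms are grouped by the value of `κ`, on which alone the coefficient depends. In the
  -- distributive law `y` will be the product over the remaining edges.
  sum-by-value : (κ : X → Bool) (Q : Bool → Carrier) (h : X → Carrier) (y : Carrier) (xs : List X) →
    sumL R (λ t → Q (κ t) * (h t * y)) xs ≈
    (Q false * sumOver κ false h xs + Q true * sumOver κ true h xs) * y
  sum-by-value κ Q h y [] = ≈-sym (≈-trans (*-congʳ (≈-trans (+-cong (zeroʳ _) (zeroʳ _)) (+-identityˡ 0#))) (zeroˡ y))
  sum-by-value κ Q h y (t ∷ xs) = ≈-trans (+-congˡ (sum-by-value κ Q h y xs)) (step (κ t))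
    where
    A = sumOver κ false h xs
    B = sumOver κ true h xs
    step : ∀ b → Q b * (h t * y) + (Q false * A + Q true * B) * y ≈
      (Q false * (only b false (h t) + A) + Q true * (only b true (h t) + B)) * y
    step false = ≈-trans (solve 6 (λ p q x a b y → p :* (x :* y) :+ (p :* a :+ q :* b) :* y := (p :* (x :+ a) :+ q :* b) :* y)
                   ≈-refl (Q false) (Q true) (h t) A B y) (*-congʳ (+-congˡ (*-congˡ (≈-sym (+-identityˡ B)))))
    step true = ≈-trans (solve 6 (λ p q x a b y → q :* (x :* y) :+ (p :* a :+ q :* b) :* y := (p :* a :+ q :* (x :+ b)) :* y)
                  ≈-refl (Q false) (Q true) (h t) A B y) (*-congʳ (+-congʳ (*-congˡ (≈-sym (+-identityˡ A)))))

  -- The distributive law, one edge at a time. Summing over the states of the part at the first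
  -- edge, grouped by `κ`, absorbs that part into a new coefficient `P'` of the other bits. The
  -- coefficient has to be arbitrary for the induction to apply to `P'`.
  sum-families : (m : Fin n → ℕ) (κ : ∀ e → State (m e) → Bool) (h : ∀ e → State (m e) → Carrier)
    (P : State n → Carrier) → (∀ {s s'} → (∀ i → s i ≡ s' i) → P s ≈ P s') →
    sumL R (λ t → P (λ e → κ e (t e)) * ∏ (λ e → h e (t e))) (allFamilies n m) ≈
    sumL R (λ s → P s * ∏ (λ e → sumOver (κ e) (s e) (h e) (allStates (m e)))) (allStates n)
  sum-families {zero} m κ h P P-cong = +-congʳ (*-congʳ (P-cong (λ ())))
  sum-families {suc n} m κ h P P-cong = begin
    sumL R term (allFamilies (suc n) m)
      ≈⟨ Sums.fold-concatMap term extensions (allFamilies n (m ∘ suc)) ⟩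
    sumL R (λ t → sumL R term (extensions t)) (allFamilies n (m ∘ suc))
      ≈⟨ Sums.fold-cong first-factor (allFamilies n (m ∘ suc)) ⟩
    sumL R (λ t → P' (λ e → κ (suc e) (t e)) * ∏ (λ e → h (suc e) (t e))) (allFamilies n (m ∘ suc))
      ≈⟨ sum-families (m ∘ suc) (κ ∘ suc) (h ∘ suc) P' (λ p → +-cong (*-congʳ (P-cong (cons-cong p))) (*-congʳ (P-cong (cons-cong p)))) ⟩
    sumL R (λ s → P' s * rest s) (allStates n)
      ≈⟨ Sums.fold-cong both (allStates n) ⟩
    sumL R (λ s → sumL R termS (cons false s ∷ cons true s ∷ [])) (allStates n)
      ≈⟨ Sums.fold-concatMap termS (λ s → cons false s ∷ cons true s ∷ []) (allStates n) ⟨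
    sumL R termS (allStates (suc n)) ∎
    where
    term : Family (suc n) m → Carrier
    term t = P (λ e → κ e (t e)) * ∏ (λ e → h e (t e))

    extensions : Family n (m ∘ suc) → List (Family (suc n) m)
    extensions t = map (λ s → consF {m = m} s t) (allStates (m zero))

    piece : ∀ e → Bool → Carrier
    piece e b = sumOver (κ e) b (h e) (allStates (m e))

    termS : State (suc n) → Carrier
    termS s = P s * ∏ (λ e → piece e (s e))

    rest : State n → Carrier
    rest s = ∏ (λ e → piece (suc e) (s e))

    P' : State n → Carrier
    P' s = P (cons false s) * piece zero false + P (cons true s) * piece zero true

    cons-cong : ∀ {b} {s s' : State n} → (∀ i → s i ≡ s' i) → ∀ i → cons b s i ≡ cons b s' i
    cons-cong p zero = refl
    cons-cong p (suc i) = p i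

    cons-κ : ∀ t₀ (t : Family n (m ∘ suc)) i → κ i (consF {m = m} t₀ t i) ≡ cons (κ zero t₀) (λ e → κ (suc e) (t e)) i
    cons-κ t₀ t zero = refl
    cons-κ t₀ t (suc i) = refl

    first-factor : ∀ t → sumL R term (extensions t) ≈ P' (λ e → κ (suc e) (t e)) * ∏ (λ e → h (suc e) (t e))
    first-factor t = begin
      sumL R term (extensions t)
        ≡⟨ Sums.fold-map term (λ s → consF {m = m} s t) (allStates (m zero)) ⟩
      sumL R (λ t₀ → term (consF {m = m} t₀ t)) (allStates (m zero))
        ≈⟨ Sums.fold-cong (λ t₀ → *-cong (P-cong (cons-κ t₀ t)) (∏-suc (λ e → h e (consF {m = m} t₀ t e)))) (allStates (m zero)) ⟩
      sumL R (λ t₀ → P (cons (κ zero t₀) (λ e → κ (suc e) (t e))) * (h zero t₀ * ∏ (λ e → h (suc e) (t e)))) (allStates (m zero))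
        ≈⟨ sum-by-value (κ zero) (λ b → P (cons b (λ e → κ (suc e) (t e)))) (h zero) _ (allStates (m zero)) ⟩
      P' (λ e → κ (suc e) (t e)) * ∏ (λ e → h (suc e) (t e)) ∎

    both : ∀ s → P' s * rest s ≈ sumL R termS (cons false s ∷ cons true s ∷ [])
    both s = begin
      P' s * rest s
        ≈⟨ solve 5 (λ p x q y r → (p :* x :+ q :* y) :* r := p :* (x :* r) :+ (q :* (y :* r) :+ con 0)) ≈-refl
             (P (cons false s)) (piece zero false) (P (cons true s)) (piece zero true) (rest s) ⟩
      P (cons false s) * (piece zero false * rest s) + (P (cons true s) * (piece zero true * rest s) + 0#)
        ≈⟨ +-cong (*-congˡ (≈-sym (∏-suc (λ e → piece e (cons false s e))))) (+-congʳ (*-congˡ (≈-sym (∏-suc (λ e → piece e (cons true s e)))))) ⟩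
      sumL R termS (cons false s ∷ cons true s ∷ []) ∎

  only-* : ∀ b c (q : Bool → Carrier) x → only b c (q b * x) ≈ q c * only b c x
  only-* false false q x = ≈-refl
  only-* false true q x = ≈-sym (zeroʳ _)
  only-* true false q x = ≈-sym (zeroʳ _)
  only-* true true q x = ≈-refl

  sumOver-scale : (κ : X → Bool) (q : Bool → Carrier) (w : X → Carrier) (c : Bool) (xs : List X) →
    sumOver κ c (λ t → q (κ t) * w t) xs ≈ q c * sumOver κ c w xs
  sumOver-scale κ q w c xs = ≈-trans (Sums.fold-cong (λ t → only-* (κ t) c q (w t)) xs) (sum-*ˡ (q c) (λ t → only (κ t) c (w t)) xs)

  sum-weighted : (κ : X → Bool) (q : Bool → Carrier) (w : X → Carrier) (xs : List X) →
    sumL R (λ t → q (κ t) * w t) xs ≈ q false * sumOver κ false w xs + q true * sumOver κ true w xs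
  sum-weighted κ q w xs = ≈-trans (Sums.fold-cong (λ t → *-congˡ (≈-sym (*-identityʳ (w t)))) xs)
    (≈-trans (sum-by-value κ q w 1# xs) (*-identityʳ _))

  module _ {a c det⁻¹ : Carrier} (det : (1# - a * (c * c)) * det⁻¹ ≈ 1#) where

    private
      D = 1# - a * (c * c)

      eliminate : ∀ f g → D * f + a * c * (g + c * f) ≈ a * c * g + f
      eliminate f g = begin
        D * f + a * c * (g + c * f)
          -- The solver works in semirings, so `z` stands for the negated term, which is cancelled
          -- afterwards.
          ≈⟨ solve 5 (λ z f g a c → (con 1 :+ z) :* f :+ a :* c :* (g :+ c :* f) := a :* c :* g :+ f :+ (z :+ a :* (c :* c)) :* f)
               ≈-refl (- (a * (c * c))) f g a c ⟩
        a * c * g + f + (- (a * (c * c)) + a * (c * c)) * f  ≈⟨ +-congˡ (≈-trans (*-congʳ (-‿inverseˡ _)) (zeroˡ f)) ⟩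
        a * c * g + f + 0#                                   ≈⟨ +-identityʳ _ ⟩
        a * c * g + f ∎

      D-cancel : ∀ {x y} → D * x ≈ D * y → x ≈ y
      D-cancel {x} {y} p = ≈-trans (≈-sym (undo x)) (≈-trans (*-congʳ p) (undo y))
        where
        undo : ∀ x → D * x * det⁻¹ ≈ x
        undo x = ≈-trans (xy∙z≈xz∙y D x det⁻¹) (≈-trans (*-congʳ det) (*-identityˡ x))

    -- Subtracting `a * c` times the second equation from the first leaves `f` times the determinant
    -- `1# - a * (c * c)`; the second equation then gives `g`.
    system-unique : ∀ {f g f' g'} → a * c * g + f ≈ a * c * g' + f' → g + c * f ≈ g' + c * f' → f ≈ f' × g ≈ g'
    system-unique {f} {g} {f'} {g'} p q = f≈f' , ∙-cancelʳ (c * f) g g' (≈-trans q (+-congˡ (*-congˡ (≈-sym f≈f'))))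
      where
      f≈f' : f ≈ f'
      f≈f' = D-cancel (∙-cancelʳ (a * c * (g + c * f)) (D * f) (D * f')
        (≈-trans (eliminate f g) (≈-trans p (≈-trans (≈-sym (eliminate f' g')) (+-congˡ (*-congˡ (≈-sym q)))))))

-- Weights of states and the state sum of a 2-sum

module _ {cℓ ℓ : Level} (R : CommutativeRing cℓ ℓ) where
  open CommutativeRing R hiding (zero) renaming (refl to ≈-refl; sym to ≈-sym; trans to ≈-trans; reflexive to ≈-reflexive)
  open RingLemmas R
  open import Algebra.Solver.Ring.NaturalCoefficients.Default commutativeSemiring using (solve; _:*_; _:=_)
  open import Relation.Binary.Reasoning.Setoid setoid

  weight : ∀ {nV nE} → RG nV nE → (a b c : Carrier) → State nE → Carrier
  weight F a b c s = pow R a (kSt F s) * (∏ (λ e → if s e then b else 1#) * pow R c (bdSt F s))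

  weight-cong : ∀ {nV nE} {F : RG nV nE} → Regular F → ∀ {a b c s s'} → (∀ e → s e ≡ s' e) → weight F a b c s ≈ weight F a b c s'
  weight-cong {F = F} reg {a} {b} {c} p = *-cong (≈-reflexive (cong (pow R a) (kSt-cong F p)))
    (*-cong (∏-cong (λ e → ≈-reflexive (cong (if_then b else 1#) (p e)))) (≈-reflexive (cong (pow R c) (bdSt-cong reg p))))

  module Local {nV nE : ℕ} {F : RG (suc nV) (suc nE)} (reg : Regular F) (planar : Planar F) (i : Fin (suc nE)) (nl : NonLoop F i)
    (a b c ac⁻¹ : Carrier) (inv : (a * c) * ac⁻¹ ≈ 1#) where

    κ : State nE → Bool
    κ = connects F i

    wH : State nE → Carrier
    wH = weight (deleteEdge F i) a b c

    conn disc : Carrier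
    conn = sumOver κ true wH (allStates nE)
    disc = sumOver κ false wH (allStates nE)

    -- The effect of contraction in place of deletion: a connecting state gains one boundary
    -- component, while any other state loses one component and one boundary component.
    factor : Bool → Carrier
    factor false = ac⁻¹
    factor true = c

    weight-contract : ∀ t → weight (contract F i nl) a b c t ≈ factor (κ t) * wH t
    weight-contract t = at (κ t) (trans (kSt-contract reg i nl t) (cong suc (sym (kSt-deleteEdge reg i nl t))))
      (trans (bdSt-contract reg i nl planar t) (cong ((if κ t then 2 else 1) +ℕ_) (sym (bdSt-deleteEdge reg i nl planar t))))
      where
      B = ∏ (λ e → if t e then b else 1#)
      at : ∀ {k k' m m'} x → k +ℕ drops x ≡ suc k' → m +ℕ drops x ≡ (if x then 2 else 1) +ℕ m' →
        pow R a k * (B * pow R c m) ≈ factor x * (pow R a k' * (B * pow R c m'))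
      at {k} {m = m} true p q with trans (ℕ.+-comm 1 k) p | trans (ℕ.+-comm 1 m) q
      at {k} {m' = m'} true p q | refl | refl =
        solve 4 (λ a b c m → a :* (b :* (c :* m)) := c :* (a :* (b :* m))) ≈-refl (pow R a k) B c (pow R c m')
      at {k} {m = m} false p q with trans (ℕ.+-comm 2 k) p | trans (ℕ.+-comm 2 m) q
      at {k} {m = m} false p q | refl | refl = begin
        pow R a k * (B * pow R c m)                       ≈⟨ *-identityˡ _ ⟨
        1# * (pow R a k * (B * pow R c m))                ≈⟨ *-congʳ inv ⟨
        a * c * ac⁻¹ * (pow R a k * (B * pow R c m))
          ≈⟨ solve 6 (λ a c i k b m → a :* c :* i :* (k :* (b :* m)) := i :* (a :* k :* (b :* (c :* m)))) ≈-refl a c ac⁻¹ (pow R a k) B (pow R c m) ⟩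
        ac⁻¹ * (a * pow R a k * (B * (c * pow R c m)))    ∎

    Z-contract : ac⁻¹ * disc + c * conn ≈ Z R (contract F i nl) a b c
    Z-contract = ≈-sym (≈-trans (Sums.fold-cong weight-contract (allStates nE)) (sum-weighted κ factor wH (allStates nE)))

    Z-delete : a * c * (ac⁻¹ * disc) + conn ≈ Z R (deleteEdge F i) a b c
    Z-delete = begin
      a * c * (ac⁻¹ * disc) + conn    ≈⟨ +-cong (≈-trans (≈-sym (*-assoc _ _ _)) (*-congʳ inv)) (≈-sym (*-identityˡ conn)) ⟩
      1# * disc + 1# * conn           ≈⟨ sum-weighted κ (λ _ → 1#) wH (allStates nE) ⟨
      sumL R (λ t → 1# * wH t) (allStates nE) ≈⟨ Sums.fold-cong (λ t → *-identityˡ (wH t)) (allStates nE) ⟩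
      Z R (deleteEdge F i) a b c      ∎

    module _ {f g det⁻¹ : Carrier} (eqH : a * c * g + f ≈ Z R (deleteEdge F i) a b c)
      (eqC : g + c * f ≈ Z R (contract F i nl) a b c) (det : (1# - a * (c * c)) * det⁻¹ ≈ 1#) where

      -- `f` and `g` are known only through two equations, which the sums over connecting and
      -- non-connecting states satisfy as well.
      solution : f ≈ conn × g ≈ ac⁻¹ * disc
      solution = system-unique det (≈-trans eqH (≈-sym Z-delete)) (≈-trans eqC (≈-sym Z-contract))

      -- A non-connecting state carries two factors `ac⁻¹`, one of which belongs to `g`. A
      -- connecting state carries one, and its `f` is written as `g * (f * g⁻¹)`. Both cases then
      -- share the factor `ac⁻¹ * g`, which can be taken out of the sum over the states of `G`.
      part-sum : ∀ {g⁻¹} → g * g⁻¹ ≈ 1# → ∀ x →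
        sumOver κ x (λ t → pow R ac⁻¹ (drops (κ t)) * wH t) (allStates nE) ≈ ac⁻¹ * (g * (if x then f * g⁻¹ else 1#))
      part-sum {g⁻¹} gg x = ≈-trans (sumOver-scale κ (λ y → pow R ac⁻¹ (drops y)) wH x (allStates nE)) (at x)
        where
        at : ∀ x → pow R ac⁻¹ (drops x) * sumOver κ x wH (allStates nE) ≈ ac⁻¹ * (g * (if x then f * g⁻¹ else 1#))
        at true = *-cong (*-identityʳ ac⁻¹) (begin
          conn              ≈⟨ proj₁ solution ⟨
          f                 ≈⟨ *-identityˡ f ⟨
          1# * f            ≈⟨ *-congʳ gg ⟨
          g * g⁻¹ * f       ≈⟨ solve 3 (λ g i f → g :* i :* f := g :* (f :* i)) ≈-refl g g⁻¹ f ⟩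
          g * (f * g⁻¹)     ∎)
        at false = ≈-trans (*-congʳ (*-congˡ (*-identityʳ ac⁻¹))) (≈-trans (*-assoc _ _ _)
          (*-congˡ (≈-trans (≈-sym (proj₂ solution)) (≈-sym (*-identityʳ g)))))

  module Global {nV nE nV̂ nÊ : ℕ} {G : RG nV nE} {Ĝ : RG nV̂ nÊ} {pA mA : Fin nE → ℕ}
    {A : (e : Fin nE) → RG (suc (pA e)) (suc (mA e))} {d : (e : Fin nE) → Fin (suc (mA e))}
    (regG : Regular G) (regĜ : Regular Ĝ) (regA : ∀ e → Regular (A e)) (nl : ∀ e → NonLoop (A e) (d e))
    (vmap : (Fin nV ⊎ TwoSum.InnerV G Ĝ pA mA A d) ↔ Fin nV̂) (emap : TwoSum.EdgesH G Ĝ pA mA A d ↔ Fin nÊ)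
    (ts : TwoSum.IsTwoSum G Ĝ pA mA A d vmap emap) (planar : ∀ e → Planar (A e))
    (a b c ac⁻¹ : Carrier) (inv : (a * c) * ac⁻¹ ≈ 1#) where

    open TwoSum G Ĝ pA mA A d using (H)

    κ : ∀ e → State (mA e) → Bool
    κ e = connects (A e) (d e)

    wH : ∀ e → State (mA e) → Carrier
    wH e = weight (H e) a b c

    -- The power of `ac⁻¹` corrects the loss at `e`, which is the same for components and boundary
    -- components and so costs equal powers of `a` and `c`.
    h : ∀ e → State (mA e) → Carrier
    h e t = pow R ac⁻¹ (drops (κ e t)) * wH e t

    Gweight : State nE → Carrier
    Gweight s = pow R a (kSt G s) * pow R c (bdSt G s)

    Gweight-cong : ∀ {s s'} → (∀ e → s e ≡ s' e) → Gweight s ≈ Gweight s'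
    Gweight-cong p = *-cong (≈-reflexive (cong (pow R a) (kSt-cong G p))) (≈-reflexive (cong (pow R c) (bdSt-cong regG p)))

    module _ (t : Family nE mA) where
      private
        s : State nE
        s e = κ e (t e)

        ŝ : State nÊ
        ŝ = assembled emap t

        module Count = TwoSumCount regG regĜ regA nl vmap emap ts t s (λ _ → refl)

        Δ kH ∂H : ℕ
        Δ = sumFin (λ e → drops (s e))
        kH = sumFin (λ e → kSt (H e) (t e))
        ∂H = sumFin (λ e → bdSt (H e) (t e))

        k-eq : kSt Ĝ ŝ +ℕ Δ ≡ kSt G s +ℕ kH
        k-eq = trans Count.ComponentCount.kSt-Ĝ (cong (kSt G s +ℕ_) (sumFin-cong (λ e → sym (kSt-deleteEdge (regA e) (d e) (nl e) (t e)))))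

        ∂-eq : bdSt Ĝ ŝ +ℕ Δ ≡ bdSt G s +ℕ ∂H
        ∂-eq = trans (Count.FaceCount.bdSt-Ĝ planar) (cong (bdSt G s +ℕ_) (sumFin-cong (λ e → sym (bdSt-deleteEdge (regA e) (d e) (nl e) (planar e) (t e)))))

        B̂ : Carrier
        B̂ = ∏ (λ ê → if ŝ ê then b else 1#)

        B : Fin nE → Carrier
        B e = ∏ (λ f → if t e f then b else 1#)

        B-eq : ∏ B ≈ B̂
        B-eq = ≈-sym (≈-trans (Products.fold-edges emap (λ ê → if ŝ ê then b else 1#))
          (∏-cong (λ e → ∏-cong (λ f → ≈-reflexive (cong (if_then b else 1#) (cong (λ x → t (proj₁ x) (proj₂ x)) (Inverse.strictlyInverseʳ emap (e , f))))))))

        ∏h : ∏ (λ e → h e (t e)) ≈ pow R ac⁻¹ Δ * (pow R a kH * (B̂ * pow R c ∂H))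
        ∏h = begin
          ∏ (λ e → h e (t e))
            ≈⟨ ∏-* (λ e → pow R ac⁻¹ (drops (s e))) (λ e → wH e (t e)) ⟩
          ∏ (λ e → pow R ac⁻¹ (drops (s e))) * ∏ (λ e → wH e (t e))
            ≈⟨ *-cong (≈-sym (pow-sum ac⁻¹ (λ e → drops (s e)))) (∏-* (λ e → pow R a (kSt (H e) (t e))) (λ e → B e * pow R c (bdSt (H e) (t e)))) ⟩
          pow R ac⁻¹ Δ * (∏ (λ e → pow R a (kSt (H e) (t e))) * ∏ (λ e → B e * pow R c (bdSt (H e) (t e))))
            ≈⟨ *-congˡ (*-cong (≈-sym (pow-sum a (λ e → kSt (H e) (t e)))) (∏-* B (λ e → pow R c (bdSt (H e) (t e))))) ⟩
          pow R ac⁻¹ Δ * (pow R a kH * (∏ B * ∏ (λ e → pow R c (bdSt (H e) (t e)))))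
            ≈⟨ *-congˡ (*-congˡ (*-cong B-eq (≈-sym (pow-sum c (λ e → bdSt (H e) (t e)))))) ⟩
          pow R ac⁻¹ Δ * (pow R a kH * (B̂ * pow R c ∂H)) ∎

      weight-factors : weight Ĝ a b c ŝ ≈ Gweight s * ∏ (λ e → h e (t e))
      weight-factors = ≈-sym (begin
        Gweight s * ∏ (λ e → h e (t e))
          ≈⟨ *-congˡ ∏h ⟩
        pow R a (kSt G s) * pow R c (bdSt G s) * (pow R ac⁻¹ Δ * (pow R a kH * (B̂ * pow R c ∂H)))
          ≈⟨ solve 6 (λ k m i k' b m' → k :* m :* (i :* (k' :* (b :* m'))) := i :* ((k :* k') :* (b :* (m :* m')))) ≈-refl
               (pow R a (kSt G s)) (pow R c (bdSt G s)) (pow R ac⁻¹ Δ) (pow R a kH) B̂ (pow R c ∂H) ⟩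
        pow R ac⁻¹ Δ * ((pow R a (kSt G s) * pow R a kH) * (B̂ * (pow R c (bdSt G s) * pow R c ∂H)))
          ≈⟨ *-congˡ (*-cong (regroup a (kSt Ĝ ŝ) Δ (kSt G s) kH k-eq) (*-congˡ (regroup c (bdSt Ĝ ŝ) Δ (bdSt G s) ∂H ∂-eq))) ⟩
        pow R ac⁻¹ Δ * ((pow R a (kSt Ĝ ŝ) * pow R a Δ) * (B̂ * (pow R c (bdSt Ĝ ŝ) * pow R c Δ)))
          ≈⟨ solve 6 (λ i k x b m y → i :* ((k :* x) :* (b :* (m :* y))) := x :* y :* i :* (k :* (b :* m))) ≈-refl
               (pow R ac⁻¹ Δ) (pow R a (kSt Ĝ ŝ)) (pow R a Δ) B̂ (pow R c (bdSt Ĝ ŝ)) (pow R c Δ) ⟩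
        pow R a Δ * pow R c Δ * pow R ac⁻¹ Δ * weight Ĝ a b c ŝ
          ≈⟨ *-congʳ (≈-trans (*-congʳ (≈-sym (pow-* a c Δ))) (pow-inverse inv Δ)) ⟩
        1# * weight Ĝ a b c ŝ
          ≈⟨ *-identityˡ _ ⟩
        weight Ĝ a b c ŝ ∎)
        where
        regroup : ∀ x k l m n → k +ℕ l ≡ m +ℕ n → pow R x m * pow R x n ≈ pow R x k * pow R x l
        regroup x k l m n p = ≈-trans (≈-sym (pow-+ x m n)) (≈-trans (≈-reflexive (cong (pow R x) (sym p))) (pow-+ x k l))

    Z-Ĝ : Z R Ĝ a b c ≈ sumL R (λ s → Gweight s * ∏ (λ e → sumOver (κ e) (s e) (h e) (allStates (mA e)))) (allStates nE)
    Z-Ĝ = begin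
      Z R Ĝ a b c
        ≈⟨ Sums.fold-states emap (weight Ĝ a b c) (weight-cong regĜ) ⟩
      sumL R (weight Ĝ a b c ∘ assembled emap) (allFamilies nE mA)
        ≈⟨ Sums.fold-cong weight-factors (allFamilies nE mA) ⟩
      sumL R (λ t → Gweight (λ e → κ e (t e)) * ∏ (λ e → h e (t e))) (allFamilies nE mA)
        ≈⟨ sum-families mA κ h Gweight Gweight-cong ⟩
      sumL R (λ s → Gweight s * ∏ (λ e → sumOver (κ e) (s e) (h e) (allStates (mA e)))) (allStates nE) ∎

    module _ (f g g⁻¹ : Fin nE → Carrier)
      (eqH : ∀ e → a * c * g e + f e ≈ Z R (H e) a b c)
      (eqC : ∀ e → g e + c * f e ≈ Z R (contract (A e) (d e) (nl e)) a b c)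
      {det⁻¹ : Carrier} (det : (1# - a * (c * c)) * det⁻¹ ≈ 1#) (inverse : ∀ e → g e * g⁻¹ e ≈ 1#) where

      private
        x : State nE → Fin nE → Carrier
        x s e = if s e then f e * g⁻¹ e else 1#

        term : State nE → Carrier
        term s = pow R a (kSt G s) * (∏ (x s) * pow R c (bdSt G s))

        factored : ∀ s → Gweight s * ∏ (λ e → sumOver (κ e) (s e) (h e) (allStates (mA e))) ≈ pow R ac⁻¹ nE * (∏ g * term s)
        factored s = begin
          Gweight s * ∏ (λ e → sumOver (κ e) (s e) (h e) (allStates (mA e)))
            ≈⟨ *-congˡ (∏-cong (λ e → Local.part-sum (regA e) (planar e) (d e) (nl e) a b c ac⁻¹ inv (eqH e) (eqC e) det (inverse e) (s e))) ⟩
          Gweight s * ∏ (λ e → ac⁻¹ * (g e * x s e))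
            ≈⟨ *-congˡ (≈-trans (∏-* (λ _ → ac⁻¹) (λ e → g e * x s e)) (*-cong (∏-const nE ac⁻¹) (∏-* g (x s)))) ⟩
          Gweight s * (pow R ac⁻¹ nE * (∏ g * ∏ (x s)))
            ≈⟨ solve 5 (λ k m i g x → k :* m :* (i :* (g :* x)) := i :* (g :* (k :* (x :* m)))) ≈-refl
                 (pow R a (kSt G s)) (pow R c (bdSt G s)) (pow R ac⁻¹ nE) (∏ g) (∏ (x s)) ⟩
          pow R ac⁻¹ nE * (∏ g * term s) ∎

      Z-twoSum : Z R Ĝ a b c ≈ pow R ac⁻¹ nE * (∏ g * Zx R G a (λ e → f e * g⁻¹ e) c)
      Z-twoSum = begin
        Z R Ĝ a b c                                                        ≈⟨ Z-Ĝ ⟩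
        sumL R (λ s → Gweight s * ∏ (λ e → sumOver (κ e) (s e) (h e) (allStates (mA e)))) (allStates nE)
                                                                           ≈⟨ Sums.fold-cong factored (allStates nE) ⟩
        sumL R (λ s → pow R ac⁻¹ nE * (∏ g * term s)) (allStates nE)       ≈⟨ sum-*ˡ (pow R ac⁻¹ nE) (λ s → ∏ g * term s) (allStates nE) ⟩
        pow R ac⁻¹ nE * sumL R (λ s → ∏ g * term s) (allStates nE)         ≈⟨ *-congˡ (sum-*ˡ (∏ g) term (allStates nE)) ⟩
        pow R ac⁻¹ nE * (∏ g * sumL R term (allStates nE))                 ∎

theorem4p3 : ∀ {cℓ ℓ : Level} (R : CommutativeRing cℓ ℓ) →
    let open CommutativeRing R in
    ∀ {nV nE nV̂ nÊ : ℕ} (G : RG nV nE) (Ĝ : RG nV̂ nÊ)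
    (pA mA : Fin nE → ℕ)
    (A : (e : Fin nE) → RG (suc (pA e)) (suc (mA e)))
    (d : (e : Fin nE) → Fin (suc (mA e))) →
    WellFormed G → WellFormed Ĝ → (∀ e → WellFormed (A e)) →
    (nl : ∀ e → NonLoop (A e) (d e)) →
    TwoSum.TwoDecomposition G Ĝ pA mA A d →
    (∀ e → Planar (A e)) →
    (a b c : Carrier) (f g : Fin nE → Carrier) →
    (∀ e → a * c * g e + f e ≈ Z R (TwoSum.H G Ĝ pA mA A d e) a b c) →
    (∀ e → g e + c * f e ≈ Z R (contract (A e) (d e) (nl e)) a b c) →
    (det⁻¹ : Carrier) → (1# - a * (c * c)) * det⁻¹ ≈ 1# →
    (ac⁻¹ : Carrier) → (a * c) * ac⁻¹ ≈ 1# →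
    (g⁻¹ : Fin nE → Carrier) → (∀ e → g e * g⁻¹ e ≈ 1#) →
    Z R Ĝ a b c ≈ pow R ac⁻¹ nE * (prodFin R g * Zx R G a (λ e → f e * g⁻¹ e) c)
theorem4p3 R G Ĝ pA mA A d wfG wfĜ wfA nl (vmap , emap , ts) planar a b c f g eqH eqC det⁻¹ det ac⁻¹ inv g⁻¹ inverse =
  Global.Z-twoSum R (WellFormed⇒Regular wfG) (WellFormed⇒Regular wfĜ) (λ e → WellFormed⇒Regular (wfA e)) nl vmap emap ts planar
    a b c ac⁻¹ inv f g g⁻¹ eqH eqC det inverse
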